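{- The Generalized Linial-Nisan Conjecture (stated in the context) is false. Indeed, for each positive integer $m$ let $M=2^m$, $N=\lceil Mm\ln 2\rceil$, $n=Nm$, and let $f_{\mathrm{Surj}}:\{0,1\}^n\to\{0,1\}$ be the surjectivity function. Then, as $m$ ranges over the positive integers, $f_{\mathrm{Surj}}$ is computable by $\mathsf{AC}^0$ circuits of size $O(n^2)$, depth $3$, and bottom fanin $O(\log n)$, and there exists a distribution $\mathcal{D}$ over $\{0,1\}^n$ that is $O\left((k\log^2 n)/n\right)$-almost $k$-wise independent for every positive integer $k\le M/2$ (with an absolute implied constant), such that $$\mathop{\mathrm{E}}_{\mathcal{U}}\left[f_{\mathrm{Surj}}\right]-\mathop{\mathrm{E}}_{\mathcal{D}}\left[f_{\mathrm{Surj}}\right]=\Omega(1).$$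
   Context: $\mathcal{U}$ denotes the uniform distribution over $\{0,1\}^n$. For a Boolean function $f$ and a distribution $\mathcal{D}$, $\Pr_{\mathcal{D}}[f]=\mathrm{E}_{\mathcal{D}}[f]=\Pr_{X\sim\mathcal{D}}[f(X)=1]$. Terms. A literal is an expression $x_i$ or $1-x_i$; a $k$-term is a product of $k$ literals, each involving a different variable $x_i$. Almost $k$-wise independence. A $k$-term $C$ is $\varepsilon$-fooled by a distribution $\mathcal{D}$ over $\{0,1\}^n$ if $1-\varepsilon\le \Pr_{\mathcal{D}}[C]/\Pr_{\mathcal{U}}[C]\le 1+\varepsilon$ (here $\Pr_{\mathcal{U}}[C]=2^{ -k}$). $\mathcal{D}$ is $\varepsilon$-almost $k$-wise independent if every $k$-term is $\varepsilon$-fooled by $\mathcal{D}$. Circuits. Circuits consist of AND, OR, and NOT gates with unbounded fanin; the depth is the number of alternating layers of AND and OR gates (NOT gates are not counted); $\mathsf{AC}^0$ circuits have constant depth (and size $n^{O(1)}$ unless another size is specified). The bottom fanin is the maximum fanin of the AND/OR gates in the layer closest to the inputs. Surjectivity function. Identify $[M]=\{1,\dots,M\}$ with $\{0,1\}^m$ through a fixed binary encoding, so that $X\in\{0,1\}^n$ is identified with $X=x_1\ldots x_N\in[M]^N$. Then $f_{\mathrm{Surj}}(X)=1$ if $\{x_1,\ldots,x_N\}=[M]$ and $f_{\mathrm{Surj}}(X)=0$ otherwise. Generalized Linial-Nisan (GLN) Conjecture: Let $\mathcal{D}=\mathcal{D}_n$ be a $1/n^{\Omega(1)}$-almost $n^{\Omega(1)}$-wise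 independent distribution over $\{0,1\}^n$ for each $n$, and let $f=f_n:\{0,1\}^n\to\{0,1\}$ be computed by an $\mathsf{AC}^0$ circuit (i.e. of depth $O(1)$) of size $2^{n^{o(1)}}$. Then $\left|\Pr_{\mathcal{D}}[f]-\Pr_{\mathcal{U}}[f]\right|=o(1)$ as $n\to\infty$. -}

module Defs where

open import Data.Bool.Base using (Bool; true; false; not; _∧_; if_then_else_)
open import Data.Fin.Base using (Fin; zero; combine; funToFin)
open import Data.Fin.Properties using (2↔Bool; all?; any?) renaming (_≟_ to _≟ᶠ_)
open import Data.Integer.Base using (+_)
open import Data.Bool.ListAction using (and; or)
open import Data.List.Base using (List)
import Data.List.Base as List
open import Data.Nat.Base as ℕ using (ℕ; zero; suc)
open import Data.Product.Base using (∃-syntax; _×_)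
open import Data.Rational.Base as ℚ using (ℚ; 0ℚ; 1ℚ; ½; _/_)
import Data.Rational.Properties as ℚ
open import Data.Vec.Base as Vec using (Vec; []; _∷_; _++_; lookup)
open import Data.Vec.Relation.Unary.Unique.Propositional using (Unique)
open import Algebra.Definitions.RawSemiring ℚ.+-*-rawSemiring using (_^_)
open import Function.Base using (_∘_)
open import Function.Bundles using (Inverse)
open import Relation.Binary.PropositionalEquality
  using (_≡_; sym; trans; cong; cong₂)
open import Relation.Nullary.Decidable using (does)

fromℕ : ℕ → ℚ
fromℕ n = + n / 1

infixr 8 _^ℚ_
_^ℚ_ : ℚ → ℕ → ℚ
_^ℚ_ = _^_

Bits : ℕ → Set
Bits = Vec Bool

∑ : ∀ n → (Bits n → ℚ) → ℚ
∑ zero    g = g []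
∑ (suc n) g = ∑ n (g ∘ (false ∷_)) ℚ.+ ∑ n (g ∘ (true ∷_))

record Distribution (n : ℕ) : Set where
  field
    mass     : Bits n → ℚ
    mass-≥0  : ∀ X → 0ℚ ℚ.≤ mass X
    mass-sum : ∑ n mass ≡ 1ℚ

open Distribution public

Pr : ∀ {n} → Distribution n → (Bits n → Bool) → ℚ
Pr {n} D f = ∑ n (λ X → if f X then mass D X else 0ℚ)

∑-const : ∀ n c → ∑ n (λ _ → ½ ^ℚ n ℚ.* c) ≡ c
∑-const zero    c = ℚ.*-identityˡ c
∑-const (suc n) c = trans (cong₂ ℚ._+_ half half) double
  where
  ∑-cong : ∀ m {g h : Bits m → ℚ} → (∀ X → g X ≡ h X) → ∑ m g ≡ ∑ m h
  ∑-cong zero    eq = eq []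
  ∑-cong (suc m) eq = cong₂ ℚ._+_ (∑-cong m (eq ∘ (false ∷_))) (∑-cong m (eq ∘ (true ∷_)))

  pull : ½ ^ℚ suc n ℚ.* c ≡ ½ ^ℚ n ℚ.* (½ ℚ.* c)
  pull = trans (cong (ℚ._* c) (ℚ.*-comm ½ (½ ^ℚ n))) (ℚ.*-assoc (½ ^ℚ n) ½ c)

  half : ∑ n (λ _ → ½ ^ℚ suc n ℚ.* c) ≡ ½ ℚ.* c
  half = trans (∑-cong n (λ _ → pull)) (∑-const n (½ ℚ.* c))

  double : ½ ℚ.* c ℚ.+ ½ ℚ.* c ≡ c
  double = trans (sym (ℚ.*-distribʳ-+ c ½ ½)) (ℚ.*-identityˡ c)

½^n≥0 : ∀ n → 0ℚ ℚ.≤ ½ ^ℚ n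
½^n≥0 zero    = ℚ.nonNegative⁻¹ 1ℚ
½^n≥0 (suc n) = ℚ.≤-trans (ℚ.≤-reflexive (sym (ℚ.*-zeroʳ ½)))
                          (ℚ.*-monoˡ-≤-nonNeg ½ (½^n≥0 n))

𝒰 : ∀ n → Distribution n
𝒰 n .mass _    = ½ ^ℚ n
𝒰 n .mass-≥0 _ = ½^n≥0 n
𝒰 n .mass-sum  = trans (cong (λ (q : ℚ) → ∑ n (λ _ → q)) (sym (ℚ.*-identityʳ (½ ^ℚ n))))
                       (∑-const n 1ℚ)

data Literal (n : ℕ) : Set where
  pos neg : Fin n → Literal n   -- xᵢ and 1 - xᵢ

var : ∀ {n} → Literal n → Fin n
var (pos i) = i
var (neg i) = i

⟦_⟧ˡ : ∀ {n} → Literal n → Bits n → Bool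
⟦ pos i ⟧ˡ X = lookup X i
⟦ neg i ⟧ˡ X = not (lookup X i)

record Term (n k : ℕ) : Set where
  field
    literals : Vec (Literal n) k
    distinct : Unique (Vec.map var literals)

open Term public

⟦_⟧ : ∀ {n k} → Term n k → Bits n → Bool
⟦ C ⟧ X = Vec.foldr′ _∧_ true (Vec.map (λ l → ⟦ l ⟧ˡ X) (literals C))

-- 1 - ε ≤ Pr_D[C] / Pr_U[C] ≤ 1 + ε, multiplied by Pr_U[C] = 2⁻ᵏ > 0.
Fooled : ∀ {n k} → ℚ → Distribution n → Term n k → Set
Fooled {n} ε D C =
    ((1ℚ ℚ.- ε) ℚ.* Pr (𝒰 n) ⟦ C ⟧ ℚ.≤ Pr D ⟦ C ⟧)
  × (Pr D ⟦ C ⟧ ℚ.≤ (1ℚ ℚ.+ ε) ℚ.* Pr (𝒰 n) ⟦ C ⟧)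

AlmostIndependent : ∀ {n} → ℚ → ℕ → Distribution n → Set
AlmostIndependent {n} ε k D = ∀ (C : Term n k) → Fooled ε D C

data Gate : Set where
  AND OR : Gate

dual : Gate → Gate
dual AND = OR
dual OR  = AND

evalGate : Gate → List Bool → Bool
evalGate AND = and
evalGate OR  = or

-- A layer of w′ gates of one kind over w wires.  Each entry of `negated` is a
-- NOT gate on one of the w wires; the gates read the wires and the NOT gates.
record Layer (w w′ : ℕ) : Set where
  field
    {nots}  : ℕ
    negated : Vec (Fin w) nots
    gates   : Vec (List (Fin (w ℕ.+ nots))) w′

open Layer public

evalLayer : ∀ {w w′} → Gate → Layer w w′ → Bits w → Bits w′
evalLayer g L ws = Vec.map (λ is → evalGate g (List.map (lookup ws′) is)) (gates L)
  where ws′ = ws ++ Vec.map (not ∘ lookup ws) (negated L)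

maxFanIn : ∀ {w w′} → Layer w w′ → ℕ
maxFanIn L = Vec.foldr′ ℕ._⊔_ 0 (Vec.map List.length (gates L))

-- Layers n g d w: d alternating layers over n inputs, the top one consisting
-- of w gates of kind g.
data Layers (n : ℕ) : Gate → ℕ → ℕ → Set where
  inputs : ∀ {g} → Layers n g 0 n
  layer  : ∀ {g d w w′} → Layers n (dual g) d w → Layer w w′ → Layers n g (suc d) w′

evalLayers : ∀ {n g d w} → Layers n g d w → Bits n → Bits w
evalLayers inputs           X = X
evalLayers (layer {g} Ls L) X = evalLayer g L (evalLayers Ls X)

sizeLayers : ∀ {n g d w} → Layers n g d w → ℕ
sizeLayers inputs                 = 0
sizeLayers (layer {w′ = w′} Ls L) = sizeLayers Ls ℕ.+ nots L ℕ.+ w′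

bottomFanInLayers : ∀ {n g d w} → Layers n g d w → ℕ
bottomFanInLayers inputs                   = 0
bottomFanInLayers (layer inputs L)         = maxFanIn L
bottomFanInLayers (layer Ls@(layer _ _) _) = bottomFanInLayers Ls

record Circuit (n : ℕ) : Set where
  field
    {top}  : Gate
    depth  : ℕ
    layers : Layers n top depth 1

  size : ℕ
  size = sizeLayers layers

  bottomFanIn : ℕ
  bottomFanIn = bottomFanInLayers layers

  eval : Bits n → Bool
  eval X = lookup (evalLayers layers X) zero

open Circuit public

Computes : ∀ {n} → Circuit n → (Bits n → Bool) → Set
Computes C f = ∀ X → eval C X ≡ f X

Eventually : (ℕ → Set) → Set
Eventually P = ∃[ n₀ ] ∀ n → n₀ ℕ.≤ n → P n

-- ε(n) = 1/n^Ω(1): eventually |ε(n)| ≤ n^(-1/a) for some a.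
InversePolynomial : (ℕ → ℚ) → Set
InversePolynomial ε = ∃[ a ] 0 ℕ.< a × Eventually λ n → ℚ.∣ ε n ∣ ^ℚ a ℚ.* fromℕ n ℚ.≤ 1ℚ

-- k(n) = n^Ω(1): eventually k(n) ≥ n^(1/a) for some a.
Polynomial : (ℕ → ℕ) → Set
Polynomial k = ∃[ a ] 0 ℕ.< a × Eventually λ n → n ℕ.≤ k n ℕ.^ a

-- t(n) = n^o(1): for every a, eventually t(n) ≤ n^(1/a).
Subpolynomial : (ℕ → ℕ) → Set
Subpolynomial t = ∀ a → 0 ℕ.< a → Eventually λ n → t n ℕ.^ a ℕ.≤ n

Vanishing : (ℕ → ℚ) → Set
Vanishing g = ∀ δ → 0ℚ ℚ.< δ → Eventually λ n → ℚ.∣ g n ∣ ℚ.< δ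

-- There are no k-terms in n < k variables, so without k n ≤ n the independence
-- hypothesis could be empty and the conjecture trivially false.
GLN : Set
GLN =
  (D : ∀ n → Distribution n) (ε : ℕ → ℚ) (k : ℕ → ℕ) →
  InversePolynomial ε → Polynomial k → (∀ n → k n ℕ.≤ n) →
  (∀ n → AlmostIndependent (ε n) (k n) (D n)) →
  (f : ∀ n → Bits n → Bool) (C : ∀ n → Circuit n) → (∀ n → Computes (C n) (f n)) →
  (∃[ d ] ∀ n → depth (C n) ℕ.≤ d) →
  (∃[ t ] Subpolynomial t × (∀ n → size (C n) ℕ.≤ 2 ℕ.^ t n)) →
  Vanishing λ n → Pr (D n) (f n) ℚ.- Pr (𝒰 n) (f n)

-- The binary encoding {0,1}ᵐ ≅ [2ᵐ], first bit most significant.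
encode : ∀ {m} → (Fin m → Bool) → Fin (2 ℕ.^ m)
encode b = funToFin (Inverse.from 2↔Bool ∘ b)

block : ∀ N m → Bits (N ℕ.* m) → Fin N → Fin (2 ℕ.^ m)
block N m X i = encode (λ j → lookup X (combine i j))

fSurj : ∀ N m → Bits (N ℕ.* m) → Bool
fSurj N m X = does (all? λ y → any? λ i → block N m X i ≟ᶠ y)

-- Partial sums of ln 2 = - ln (1 - ½) = ∑_{j ≥ 1} ½ʲ / j, which increase to ln 2.
ln2-partial : ℕ → ℚ
ln2-partial zero    = 0ℚ
ln2-partial (suc j) = ln2-partial j ℚ.+ (+ 1 / suc j) ℚ.* ½ ^ℚ suc j

_·ln2≤_ : ℕ → ℕ → Set
a ·ln2≤ N = ∀ j → fromℕ a ℚ.* ln2-partial j ℚ.≤ fromℕ N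

record _≡⌈_·ln2⌉ (N a : ℕ) : Set where
  field
    upper : a ·ln2≤ N
    least : ∀ N′ → a ·ln2≤ N′ → N ℕ.≤ N′

{-# OPTIONS --safe #-}

-- Let D pick a block value y uniformly and then an input uniformly among those with no block equal to y; the
-- support of D contains no surjective input.  If a k-term confines block i to the set Sᵢ, avoiding y multiplies its
-- probability by the product of (1 - [y ∈ Sᵢ] / |Sᵢ|) M / (M - 1) over the at most k blocks it touches.  The mean of
-- this over y lies between 1 - k / M and (M / (M - 1))ᵏ ≤ 1 + 2k / M.
--
-- Under the uniform distribution the expected number s = M (1 - 1/M)ᴺ of missed values is at most 1.  Inclusion-exclusion
-- truncated after the triples, together with (1 - 2/M)ᴺ ≈ (1 - 1/M)²ᴺ and (1 - 3/M)ᴺ ≤ (1 - 1/M)³ᴺ, bounds the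
-- probability of surjectivity below by 1 - s + (2/9) s² - s³/6 ≥ 1/18 as soon as M ≥ 8.
--
-- To get s ≤ 1 from the partial sums of ln 2 alone, write 1/2 as the product of (i - 1) / i for M < i ≤ 2M, where each
-- factor is at least (1 - 1/M) ^ (M / i).  The sum of the 1 / i is a lower Riemann sum of ∫ da / (1 - a) over [0, 1/2],
-- so (1 - 2⁻ʲ) times it is at most the j-th partial sum.
--
-- For the refutation of GLN the choice N = M m avoids ln 2, and the lengths n not of this form carry 𝒰 itself.
module Submission where

open import Defs
open import Data.Bool.Base using (Bool; true; false; not; _∧_; if_then_else_)
open import Data.Bool.ListAction using (and; or)
open import Data.Fin.Base using (Fin; zero; suc; toℕ; fromℕ<; combine; remQuot; funToFin; finToFun; _↑ˡ_; _↑ʳ_)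
open import Data.Fin.Properties
  using (2↔Bool; all?; any?; toℕ-fromℕ<; remQuot-combine; funToFin-finToFin; finToFun-funToFin; ¬∀⟶∃¬)
  renaming (_≟_ to _≟ᶠ_)
import Data.Integer.Base as ℤ
import Data.Integer.Properties as ℤ
open import Data.List.Base as List using (List; []; _∷_; length; allFin)
import Data.List.Properties as List
open import Data.List.Membership.Propositional using (_∈_)
open import Data.List.Membership.Propositional.Properties using (∈-map⁺; ∈-allFin)
open import Data.List.Relation.Unary.All as All using ([]; _∷_)
open import Data.List.Relation.Unary.AllPairs using ([]; _∷_)
open import Data.List.Relation.Unary.Any using (here; there)
import Data.List.Relation.Unary.Unique.Propositional as ListUnique
import Data.List.Relation.Unary.Unique.Propositional.Properties as Unique
open import Data.Maybe.Base using (Maybe; just; nothing)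
open import Data.Nat.Base as ℕ using (ℕ; zero; suc; z≤n; s≤s)
open import Data.Nat.DivMod using (m≡m%n+[m/n]*n; m%n<n; /-monoˡ-≤; m*n/n≡m)
open import Data.Nat.Logarithm using (⌊log₂_⌋; ⌊log₂⌋-mono-≤; ⌊log₂[2^n]⌋≡n)
import Data.Nat.Properties as ℕ
open import Data.Product.Base using (Σ-syntax; ∃-syntax; _×_; _,_; proj₁; proj₂; uncurry)
open import Data.Rational.Base as ℚ using (ℚ; 0ℚ; 1ℚ; ½; _/_)
import Data.Rational.Properties as ℚ
import Data.Rational.Unnormalised.Base as ℚᵘ
import Data.Rational.Unnormalised.Properties as ℚᵘ
open import Data.Sum.Base using (inj₁; inj₂)
open import Data.Vec.Base as Vec using (Vec; []; _∷_; _++_; lookup; take; drop; concat; replicate; tabulate; _[_]≔_)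
open import Data.Vec.Properties
  using (++-injective; take++drop≡id; lookup-concat; lookup∘update′; lookup-replicate; lookup∘tabulate; tabulate∘lookup;
         tabulate-cong; lookup-++ˡ; lookup-++ʳ; lookup-map; lookup-allFin)
import Data.Vec.Relation.Unary.All as VecAll
import Data.Vec.Relation.Unary.AllPairs as VecAllPairs
import Data.Vec.Relation.Unary.Unique.Propositional as VecUnique
open import Function.Base using (_∘_)
open import Function.Bundles using (Inverse)
open import Relation.Binary.PropositionalEquality
open import Relation.Nullary.Decidable.Core
  using (Dec; yes; no; _because_; proof; from-yes; map′; dec⇒maybe; _×-dec_; _⊎-dec_)
open import Relation.Nullary.Negation using (¬_; contradiction)
open import Relation.Nullary.Reflects using (Reflects; ofʸ; ofⁿ; invert; det)
open import Tactic.RingSolver using (solve-∀)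
open import Tactic.RingSolver.Core.AlmostCommutativeRing using (AlmostCommutativeRing; fromCommutativeRing)

-- The average over y carries the argument. For a fixed y, a term that pins a block to y has
-- probability 0, so such a distribution fools nothing; averaged over y, this loss is diluted by
-- 1/M. The upper bound holds for each y separately. The lower bound holds only in the mean, and
-- since one y governs all blocks, the mean of a product is not the product of means. Hence deficits
-- are kept as functions of y and added up, and only the final sum is averaged. As D gives
-- surjective inputs no mass, the gap is exactly the uniform probability of surjectivity. Truncation
-- after single values gives only 1 - s, which is worthless when s is close to 1, and truncation
-- after pairs gives an upper bound; triples are the first order that helps. For M < 8 one explicit
-- surjective input suffices, because n is at most 16 there. Everything is rational: a fractional
-- power x^(p/q) occurs only in inequalities between integer powers, and ln 2 only through its
-- partial sums, so the passage to the limit is replaced by integrality of N.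

-- Ordered arithmetic and powers in ℚ

module Rationals where

  open import Data.Rational.Base using (_+_; _*_; _-_; -_; _≤_; _<_; nonNegative; positive)
  open import Data.Rational.Properties using (≤-trans; ≤-refl; ≤-reflexive)

  ℚ-ring : AlmostCommutativeRing _ _
  ℚ-ring = fromCommutativeRing ℚ.+-*-commutativeRing (λ x → dec⇒maybe (0ℚ ℚ.≟ x))

  0≤1 : 0ℚ ≤ 1ℚ
  0≤1 = ℚ.nonNegative⁻¹ 1ℚ

  0≤½ : 0ℚ ≤ ½
  0≤½ = ℚ.nonNegative⁻¹ ½

  infixl 6 _⊕_
  infixl 7 _⊗_

  _⊕_ : ∀ {p q} → 0ℚ ≤ p → 0ℚ ≤ q → 0ℚ ≤ p + q
  _⊕_ {p} {q} 0≤p 0≤q = ℚ.+-mono-≤ 0≤p 0≤q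

  *-monoˡ : ∀ {p q r} → 0ℚ ≤ r → p ≤ q → r * p ≤ r * q
  *-monoˡ {r = r} 0≤r = ℚ.*-monoˡ-≤-nonNeg r {{nonNegative 0≤r}}

  *-monoʳ : ∀ {p q r} → 0ℚ ≤ r → p ≤ q → p * r ≤ q * r
  *-monoʳ {r = r} 0≤r = ℚ.*-monoʳ-≤-nonNeg r {{nonNegative 0≤r}}

  _⊗_ : ∀ {p q} → 0ℚ ≤ p → 0ℚ ≤ q → 0ℚ ≤ p * q
  _⊗_ {p} {q} 0≤p 0≤q = subst (_≤ p * q) (ℚ.*-zeroʳ p) (*-monoˡ 0≤p 0≤q)

  *-mono : ∀ {p q r s} → 0ℚ ≤ p → 0ℚ ≤ s → p ≤ q → r ≤ s → p * r ≤ q * s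
  *-mono 0≤p 0≤s p≤q r≤s = ≤-trans (*-monoˡ 0≤p r≤s) (*-monoʳ 0≤s p≤q)

  p≤p+q : ∀ p {q} → 0ℚ ≤ q → p ≤ p + q
  p≤p+q p {q} 0≤q = subst (_≤ p + q) (ℚ.+-identityʳ p) (ℚ.+-monoʳ-≤ p 0≤q)

  ≤-by : ∀ {p q d} → 0ℚ ≤ d → q ≡ p + d → p ≤ q
  ≤-by {p} 0≤d refl = p≤p+q p 0≤d

  0≤q-p : ∀ {p q} → p ≤ q → 0ℚ ≤ q - p
  0≤q-p {p} {q} p≤q = subst (_≤ q - p) (ℚ.+-inverseʳ p) (ℚ.+-monoˡ-≤ (- p) p≤q)

  0≤q*q : ∀ q → 0ℚ ≤ q * q
  0≤q*q q with ℚ.≤-total 0ℚ q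
  ... | inj₁ 0≤q = 0≤q ⊗ 0≤q
  ... | inj₂ q≤0 = subst (0ℚ ≤_) (square q) (0≤-q ⊗ 0≤-q)
    where
    0≤-q : 0ℚ ≤ 0ℚ - q
    0≤-q = 0≤q-p q≤0
    square : ∀ q → (0ℚ - q) * (0ℚ - q) ≡ q * q
    square = solve-∀ ℚ-ring

  fromℕ-+ : ∀ a b → fromℕ (a ℕ.+ b) ≡ fromℕ a + fromℕ b
  fromℕ-+ a b = ℚ.toℚᵘ-injective (ℚᵘ.≃-trans (ℚ.toℚᵘ-fromℚᵘ (ℚᵘ.mkℚᵘ (ℤ.+ (a ℕ.+ b)) 0))
    (ℚᵘ.≃-sym (ℚᵘ.≃-trans (ℚ.toℚᵘ-homo-+ (fromℕ a) (fromℕ b))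
      (ℚᵘ.≃-trans (ℚᵘ.+-cong (ℚ.toℚᵘ-fromℚᵘ (ℚᵘ.mkℚᵘ (ℤ.+ a) 0)) (ℚ.toℚᵘ-fromℚᵘ (ℚᵘ.mkℚᵘ (ℤ.+ b) 0)))
        (ℚᵘ.*≡* (cong (ℤ._* ℤ.+ 1) (cong₂ ℤ._+_ (ℤ.*-identityʳ (ℤ.+ a)) (ℤ.*-identityʳ (ℤ.+ b)))))))))

  fromℕ-suc : ∀ a → fromℕ (suc a) ≡ 1ℚ + fromℕ a
  fromℕ-suc = fromℕ-+ 1

  fromℕ-* : ∀ a b → fromℕ (a ℕ.* b) ≡ fromℕ a * fromℕ b
  fromℕ-* zero    b = sym (ℚ.*-zeroˡ (fromℕ b))
  fromℕ-* (suc a) b = begin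
    fromℕ (b ℕ.+ a ℕ.* b)          ≡⟨ fromℕ-+ b (a ℕ.* b) ⟩
    fromℕ b + fromℕ (a ℕ.* b)      ≡⟨ cong (fromℕ b +_) (fromℕ-* a b) ⟩
    fromℕ b + fromℕ a * fromℕ b    ≡⟨ distrib (fromℕ a) (fromℕ b) ⟩
    (1ℚ + fromℕ a) * fromℕ b       ≡⟨ cong (_* fromℕ b) (fromℕ-suc a) ⟨
    fromℕ (suc a) * fromℕ b        ∎
    where
    open ≡-Reasoning
    distrib : ∀ a b → b + a * b ≡ (1ℚ + a) * b
    distrib = solve-∀ ℚ-ring

  0≤fromℕ : ∀ a → 0ℚ ≤ fromℕ a
  0≤fromℕ zero    = ≤-refl
  0≤fromℕ (suc a) = subst (0ℚ ≤_) (sym (fromℕ-suc a)) (0≤1 ⊕ 0≤fromℕ a)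

  fromℕ-mono-≤ : ∀ {a b} → a ℕ.≤ b → fromℕ a ≤ fromℕ b
  fromℕ-mono-≤ {a} {b} a≤b = ≤-by (0≤fromℕ (b ℕ.∸ a))
    (trans (cong fromℕ (sym (ℕ.m+[n∸m]≡n a≤b))) (fromℕ-+ a (b ℕ.∸ a)))

  0<fromℕ-suc : ∀ a → 0ℚ < fromℕ (suc a)
  0<fromℕ-suc a = ℚ.<-≤-trans (ℚ.positive⁻¹ 1ℚ) (fromℕ-mono-≤ {1} {suc a} (ℕ.s≤s ℕ.z≤n))

  fromℕ-mono-< : ∀ {a b} → a ℕ.< b → fromℕ a < fromℕ b
  fromℕ-mono-< {a} {b} a<b = ℚ.<-≤-trans
    (subst₂ _<_ (ℚ.+-identityˡ (fromℕ a)) (sym (fromℕ-suc a)) (ℚ.+-monoˡ-< (fromℕ a) (ℚ.positive⁻¹ 1ℚ)))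
    (fromℕ-mono-≤ a<b)

  fromℕ-cancel-≤ : ∀ {a b} → fromℕ a ≤ fromℕ b → a ℕ.≤ b
  fromℕ-cancel-≤ le = ℕ.≮⇒≥ λ b<a → ℚ.<-irrefl refl (ℚ.<-≤-trans (fromℕ-mono-< b<a) le)

  fromℕ-cancel-< : ∀ {a b} → fromℕ a < fromℕ b → a ℕ.< b
  fromℕ-cancel-< {a} {b} lt = ℕ.≰⇒> λ b≤a → ℚ.<-irrefl refl (ℚ.<-≤-trans lt (fromℕ-mono-≤ b≤a))

  *-cancelˡ-≤ : ∀ r {p q} → 0ℚ < r → r * p ≤ r * q → p ≤ q
  *-cancelˡ-≤ r 0<r = ℚ.*-cancelˡ-≤-pos r {{positive 0<r}}

  1/suc : ∀ j → fromℕ (suc j) * (ℤ.+ 1 / suc j) ≡ 1ℚ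
  1/suc j = ℚ.toℚᵘ-injective (ℚᵘ.≃-trans (ℚ.toℚᵘ-homo-* (fromℕ (suc j)) (ℤ.+ 1 / suc j))
     (ℚᵘ.≃-trans (ℚᵘ.*-cong (ℚ.toℚᵘ-fromℚᵘ (ℚᵘ.mkℚᵘ (ℤ.+ suc j) 0)) (ℚ.toℚᵘ-fromℚᵘ (ℚᵘ.mkℚᵘ (ℤ.+ 1) j)))
       (ℚᵘ.*≡* (trans (ℤ.*-identityʳ _) (trans (ℤ.*-identityʳ (ℤ.+ suc j)) (sym (trans (ℤ.*-identityˡ _) (ℤ.*-identityˡ (ℤ.+ suc j)))))))))

  0≤1/suc : ∀ j → 0ℚ ≤ ℤ.+ 1 / suc j
  0≤1/suc j = *-cancelˡ-≤ (fromℕ (suc j)) (0<fromℕ-suc j)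
    (subst₂ _≤_ (sym (ℚ.*-zeroʳ (fromℕ (suc j)))) (sym (1/suc j)) 0≤1)

  ^-nonneg : ∀ {a} n → 0ℚ ≤ a → 0ℚ ≤ a ^ℚ n
  ^-nonneg zero    _   = 0≤1
  ^-nonneg (suc n) 0≤a = 0≤a ⊗ ^-nonneg n 0≤a

  ^-mono : ∀ {a b} n → 0ℚ ≤ a → a ≤ b → a ^ℚ n ≤ b ^ℚ n
  ^-mono zero    _   _   = ≤-refl
  ^-mono (suc n) 0≤a a≤b = *-mono 0≤a (^-nonneg n (≤-trans 0≤a a≤b)) a≤b (^-mono n 0≤a a≤b)

  1^ : ∀ n → 1ℚ ^ℚ n ≡ 1ℚ
  1^ zero    = refl
  1^ (suc n) = trans (ℚ.*-identityˡ _) (1^ n)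

  ^-+ : ∀ a m n → a ^ℚ (m ℕ.+ n) ≡ a ^ℚ m * a ^ℚ n
  ^-+ a zero    n = sym (ℚ.*-identityˡ _)
  ^-+ a (suc m) n = trans (cong (a *_) (^-+ a m n)) (sym (ℚ.*-assoc a _ _))

  ^-distrib-* : ∀ a b n → (a * b) ^ℚ n ≡ a ^ℚ n * b ^ℚ n
  ^-distrib-* a b zero    = refl
  ^-distrib-* a b (suc n) = trans (cong ((a * b) *_) (^-distrib-* a b n)) (inter a b (a ^ℚ n) (b ^ℚ n))
    where
    inter : ∀ a b c d → (a * b) * (c * d) ≡ (a * c) * (b * d)
    inter = solve-∀ ℚ-ring

  ^-* : ∀ a m n → a ^ℚ (m ℕ.* n) ≡ (a ^ℚ n) ^ℚ m
  ^-* a zero    n = refl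
  ^-* a (suc m) n = trans (^-+ a n (m ℕ.* n)) (cong (a ^ℚ n *_) (^-* a m n))

  ^-≤1 : ∀ {a} n → 0ℚ ≤ a → a ≤ 1ℚ → a ^ℚ n ≤ 1ℚ
  ^-≤1 n 0≤a a≤1 = ≤-trans (^-mono n 0≤a a≤1) (≤-reflexive (1^ n))

  ^-antimono : ∀ {a m n} → 0ℚ ≤ a → a ≤ 1ℚ → m ℕ.≤ n → a ^ℚ n ≤ a ^ℚ m
  ^-antimono {a} {m} {n} 0≤a a≤1 m≤n = subst₂ _≤_
    (trans (sym (^-+ a m (n ℕ.∸ m))) (cong (a ^ℚ_) (ℕ.m+[n∸m]≡n m≤n)))
    (ℚ.*-identityʳ (a ^ℚ m))
    (*-monoˡ (^-nonneg m 0≤a) (^-≤1 (n ℕ.∸ m) 0≤a a≤1))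

  ^-mono-< : ∀ {a b} n → 0ℚ ≤ a → a < b → a ^ℚ suc n < b ^ℚ suc n
  ^-mono-< {a} {b} zero    0≤a a<b = subst₂ _<_ (sym (ℚ.*-identityʳ a)) (sym (ℚ.*-identityʳ b)) a<b
  ^-mono-< {a} {b} (suc n) 0≤a a<b = ℚ.≤-<-trans
    (*-monoˡ 0≤a (ℚ.<⇒≤ (^-mono-< n 0≤a a<b)))
    (ℚ.*-monoˡ-<-pos (b ^ℚ suc n) {{positive (ℚ.≤-<-trans (^-nonneg (suc n) 0≤a) (^-mono-< n 0≤a a<b))}} a<b)

  ^-cancel-≤ : ∀ {a b} n → 0ℚ ≤ b → a ^ℚ suc n ≤ b ^ℚ suc n → a ≤ b
  ^-cancel-≤ {a} {b} n 0≤b le = ℚ.≮⇒≥ λ b<a → ℚ.<-irrefl refl (ℚ.<-≤-trans (^-mono-< n 0≤b b<a) le)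

  fromℕ-^ : ∀ a n → fromℕ (a ℕ.^ n) ≡ fromℕ a ^ℚ n
  fromℕ-^ a zero    = refl
  fromℕ-^ a (suc n) = trans (fromℕ-* a (a ℕ.^ n)) (cong (fromℕ a *_) (fromℕ-^ a n))

  ½^*2^ : ∀ m → ½ ^ℚ m * fromℕ (2 ℕ.^ m) ≡ 1ℚ
  ½^*2^ m = trans (cong (½ ^ℚ m *_) (fromℕ-^ 2 m)) (trans (sym (^-distrib-* ½ (fromℕ 2) m)) (1^ m))

  -- Convexity of t^(p+1) on t ≥ 0: the left side is its tangent at a, evaluated at b, with a^p
  -- factored out. It yields Bernoulli's inequality (a = 1), the monotonicity of (1 - 1/n)^n, and
  -- the tangents of the logarithmic sums.
  tangent : ∀ {a b} p → 0ℚ ≤ a → 0ℚ ≤ b → a ^ℚ p * (fromℕ (suc p) * b - fromℕ p * a) ≤ b ^ℚ suc p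
  tangent {a} {b} zero    0≤a 0≤b = ≤-reflexive (lem a b)
    where
    lem : ∀ a b → 1ℚ * (1ℚ * b - 0ℚ * a) ≡ b * 1ℚ
    lem = solve-∀ ℚ-ring
  -- Multiplying the case p by b overshoots the next tangent by a^p (p + 1) (b - a)².
  tangent {a} {b} (suc p) 0≤a 0≤b = ≤-trans step (*-monoˡ 0≤b (tangent p 0≤a 0≤b))
    where
    q = fromℕ p
    lem : ∀ a b q s → b * (s * ((1ℚ + q) * b - q * a)) ≡ (a * s) * ((1ℚ + (1ℚ + q)) * b - (1ℚ + q) * a) + s * (1ℚ + q) * ((b - a) * (b - a))
    lem = solve-∀ ℚ-ring
    step : a ^ℚ suc p * (fromℕ (suc (suc p)) * b - fromℕ (suc p) * a) ≤ b * (a ^ℚ p * (fromℕ (suc p) * b - q * a))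
    step rewrite fromℕ-suc (suc p) | fromℕ-suc p =
      ≤-by (^-nonneg p 0≤a ⊗ (0≤1 ⊕ 0≤fromℕ p) ⊗ 0≤q*q (b - a)) (lem a b q (a ^ℚ p))

  bernoulli : ∀ {x} n → x ≤ 1ℚ → 1ℚ - fromℕ n * x ≤ (1ℚ - x) ^ℚ n
  bernoulli {x} zero    _   = ≤-reflexive (lem x)
    where
    lem : ∀ x → 1ℚ - 0ℚ * x ≡ 1ℚ
    lem = solve-∀ ℚ-ring
  bernoulli {x} (suc n) x≤1 = subst (_≤ (1ℚ - x) ^ℚ suc n) eq (tangent n 0≤1 (0≤q-p x≤1))
    where
    lem : ∀ q x → 1ℚ * ((1ℚ + q) * (1ℚ - x) - q * 1ℚ) ≡ 1ℚ - (1ℚ + q) * x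
    lem = solve-∀ ℚ-ring
    eq : 1ℚ ^ℚ n * (fromℕ (suc n) * (1ℚ - x) - fromℕ n * 1ℚ) ≡ 1ℚ - fromℕ (suc n) * x
    eq rewrite 1^ n | fromℕ-suc n = lem (fromℕ n) x

open Rationals

-- Sums over bit strings, and their factorisation over blocks

module Sums where

  open import Data.Rational.Base using (_+_; _*_; _-_; -_; _≤_; _<_; nonNegative; positive)
  open import Data.Rational.Properties using (≤-trans; ≤-refl; ≤-reflexive)

  ∑-cong : ∀ n {f g : Bits n → ℚ} → (∀ X → f X ≡ g X) → ∑ n f ≡ ∑ n g
  ∑-cong zero    eq = eq []
  ∑-cong (suc n) eq = cong₂ _+_ (∑-cong n (eq ∘ (false ∷_))) (∑-cong n (eq ∘ (true ∷_)))

  ∑-mono : ∀ n {f g : Bits n → ℚ} → (∀ X → f X ≤ g X) → ∑ n f ≤ ∑ n g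
  ∑-mono zero    le = le []
  ∑-mono (suc n) le = ℚ.+-mono-≤ (∑-mono n (le ∘ (false ∷_))) (∑-mono n (le ∘ (true ∷_)))

  ∑-+ : ∀ n (f g : Bits n → ℚ) → ∑ n (λ X → f X + g X) ≡ ∑ n f + ∑ n g
  ∑-+ zero    f g = refl
  ∑-+ (suc n) f g = trans (cong₂ _+_ (∑-+ n _ _) (∑-+ n _ _)) (swap (∑ n (f ∘ (false ∷_))) _ _ _)
    where
    swap : ∀ a b c d → (a + b) + (c + d) ≡ (a + c) + (b + d)
    swap = solve-∀ ℚ-ring

  ∑-*ˡ : ∀ n c (f : Bits n → ℚ) → ∑ n (λ X → c * f X) ≡ c * ∑ n f
  ∑-*ˡ zero    c f = refl
  ∑-*ˡ (suc n) c f = trans (cong₂ _+_ (∑-*ˡ n c _) (∑-*ˡ n c _)) (sym (ℚ.*-distribˡ-+ c _ _))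

  ∑-*ʳ : ∀ n c (f : Bits n → ℚ) → ∑ n (λ X → f X * c) ≡ ∑ n f * c
  ∑-*ʳ n c f = trans (∑-cong n (λ X → ℚ.*-comm (f X) c)) (trans (∑-*ˡ n c f) (ℚ.*-comm c _))

  ∑-minus : ∀ n (f g : Bits n → ℚ) → ∑ n (λ X → f X - g X) ≡ ∑ n f - ∑ n g
  ∑-minus zero    f g = refl
  ∑-minus (suc n) f g = trans (cong₂ _+_ (∑-minus n _ _) (∑-minus n _ _)) (swap (∑ n (f ∘ (false ∷_))) _ _ _)
    where
    swap : ∀ a b c d → (a - b) + (c - d) ≡ (a + c) - (b + d)
    swap = solve-∀ ℚ-ring

  ∑-0 : ∀ n → ∑ n (λ _ → 0ℚ) ≡ 0ℚ
  ∑-0 zero    = refl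
  ∑-0 (suc n) = cong₂ _+_ (∑-0 n) (∑-0 n)

  ∑-nonneg : ∀ n {f : Bits n → ℚ} → (∀ X → 0ℚ ≤ f X) → 0ℚ ≤ ∑ n f
  ∑-nonneg n {f} 0≤f = subst (_≤ ∑ n f) (∑-0 n) (∑-mono n 0≤f)

  ∑-swap : ∀ m n (f : Bits m → Bits n → ℚ) →
    ∑ m (λ X → ∑ n (f X)) ≡ ∑ n (λ Y → ∑ m (λ X → f X Y))
  ∑-swap zero    n f = refl
  ∑-swap (suc m) n f = trans (cong₂ _+_ (∑-swap m n _) (∑-swap m n _)) (sym (∑-+ n _ _))

  ∑-++ : ∀ m n (f : Bits (m ℕ.+ n) → ℚ) → ∑ (m ℕ.+ n) f ≡ ∑ m (λ X → ∑ n (λ Y → f (X ++ Y)))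
  ∑-++ zero    n f = refl
  ∑-++ (suc m) n f = cong₂ _+_ (∑-++ m n _) (∑-++ m n _)

  ∑-product : ∀ {m n} {F : Bits (m ℕ.+ n) → ℚ} {f : Bits m → ℚ} {g : Bits n → ℚ} →
    (∀ X Y → F (X ++ Y) ≡ f X * g Y) → ∑ (m ℕ.+ n) F ≡ ∑ m f * ∑ n g
  ∑-product {m} {n} {F} {f} {g} eq = begin
    ∑ (m ℕ.+ n) F                              ≡⟨ ∑-++ m n F ⟩
    ∑ m (λ X → ∑ n (λ Y → F (X ++ Y)))         ≡⟨ ∑-cong m (λ X → ∑-cong n (eq X)) ⟩
    ∑ m (λ X → ∑ n (λ Y → f X * g Y))          ≡⟨ ∑-cong m (λ X → ∑-*ˡ n (f X) g) ⟩
    ∑ m (λ X → f X * ∑ n g)                    ≡⟨ ∑-*ʳ m (∑ n g) f ⟩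
    ∑ m f * ∑ n g                              ∎
    where open ≡-Reasoning

  ∑-term : ∀ n {f : Bits n → ℚ} → (∀ X → 0ℚ ≤ f X) → ∀ X → f X ≤ ∑ n f
  ∑-term zero    0≤f []          = ≤-refl
  ∑-term (suc n) 0≤f (false ∷ X) =
    ≤-trans (∑-term n (0≤f ∘ (false ∷_)) X) (p≤p+q _ (∑-nonneg n (0≤f ∘ (true ∷_))))
  ∑-term (suc n) {f} 0≤f (true ∷ X) =
    ≤-trans (∑-term n (0≤f ∘ (true ∷_)) X)
      (subst (∑ n (f ∘ (true ∷_)) ≤_) (ℚ.+-comm (∑ n (f ∘ (true ∷_))) _) (p≤p+q _ (∑-nonneg n (0≤f ∘ (false ∷_)))))

  ⟨_⟩ : Bool → ℚ
  ⟨ b ⟩ = if b then 1ℚ else 0ℚ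

  ⟨⟩-nonneg : ∀ b → 0ℚ ≤ ⟨ b ⟩
  ⟨⟩-nonneg true  = 0≤1
  ⟨⟩-nonneg false = ≤-refl

  ⟨⟩-∧ : ∀ a b → ⟨ a ∧ b ⟩ ≡ ⟨ a ⟩ * ⟨ b ⟩
  ⟨⟩-∧ true  b = sym (ℚ.*-identityˡ ⟨ b ⟩)
  ⟨⟩-∧ false b = sym (ℚ.*-zeroˡ ⟨ b ⟩)

  if-⟨⟩ : ∀ b q → (if b then q else 0ℚ) ≡ ⟨ b ⟩ * q
  if-⟨⟩ true  q = sym (ℚ.*-identityˡ q)
  if-⟨⟩ false q = sym (ℚ.*-zeroˡ q)

  Pr-⟨⟩ : ∀ {n} (D : Distribution n) f → Pr D f ≡ ∑ n (λ X → ⟨ f X ⟩ * mass D X)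
  Pr-⟨⟩ {n} D f = ∑-cong n (λ X → if-⟨⟩ (f X) (mass D X))

  -- Kronecker's delta with values in ℚ, recursive along the bits as `∑` is, so that sifting (`∑-δ`)
  -- is a structural induction.
  δ : ∀ {m} → Bits m → Bits m → ℚ
  δ []          []          = 1ℚ
  δ (false ∷ y) (false ∷ b) = δ y b
  δ (true  ∷ y) (true  ∷ b) = δ y b
  δ (false ∷ _) (true  ∷ _) = 0ℚ
  δ (true  ∷ _) (false ∷ _) = 0ℚ

  δ-refl : ∀ {m} (y : Bits m) → δ y y ≡ 1ℚ
  δ-refl []          = refl
  δ-refl (false ∷ y) = δ-refl y
  δ-refl (true  ∷ y) = δ-refl y

  δ-≢ : ∀ {m} {y b : Bits m} → y ≢ b → δ y b ≡ 0ℚ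
  δ-≢ {y = []}        {[]}        y≢b = contradiction refl y≢b
  δ-≢ {y = false ∷ y} {false ∷ b} y≢b = δ-≢ (y≢b ∘ cong (false ∷_))
  δ-≢ {y = true  ∷ y} {true  ∷ b} y≢b = δ-≢ (y≢b ∘ cong (true ∷_))
  δ-≢ {y = false ∷ y} {true  ∷ b} y≢b = refl
  δ-≢ {y = true  ∷ y} {false ∷ b} y≢b = refl

  δ-nonneg : ∀ {m} (y b : Bits m) → 0ℚ ≤ δ y b
  δ-nonneg []          []          = 0≤1
  δ-nonneg (false ∷ y) (false ∷ b) = δ-nonneg y b
  δ-nonneg (true  ∷ y) (true  ∷ b) = δ-nonneg y b
  δ-nonneg (false ∷ _) (true  ∷ _) = ≤-refl
  δ-nonneg (true  ∷ _) (false ∷ _) = ≤-refl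

  δ-≤1 : ∀ {m} (y b : Bits m) → δ y b ≤ 1ℚ
  δ-≤1 []          []          = ≤-refl
  δ-≤1 (false ∷ y) (false ∷ b) = δ-≤1 y b
  δ-≤1 (true  ∷ y) (true  ∷ b) = δ-≤1 y b
  δ-≤1 (false ∷ _) (true  ∷ _) = 0≤1
  δ-≤1 (true  ∷ _) (false ∷ _) = 0≤1

  ∑-δ : ∀ {m} (y : Bits m) (g : Bits m → ℚ) → ∑ m (λ b → δ y b * g b) ≡ g y
  ∑-δ []      g = ℚ.*-identityˡ (g [])
  ∑-δ {suc m} (false ∷ y) g = trans (cong₂ _+_ (∑-δ y (g ∘ (false ∷_)))
    (trans (∑-cong m (λ b → ℚ.*-zeroˡ (g (true ∷ b)))) (∑-0 m))) (ℚ.+-identityʳ _)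
  ∑-δ {suc m} (true ∷ y) g = trans (cong₂ _+_ 
    (trans (∑-cong m (λ b → ℚ.*-zeroˡ (g (false ∷ b)))) (∑-0 m)) (∑-δ y (g ∘ (true ∷_)))) (ℚ.+-identityˡ _)

  -- Cutting recursively, in contrast to the index arithmetic of `block`, lets a sum over inputs
  -- split off one block at a time; `lookup-blocks` reconciles the two views.
  blocks : ∀ N m → Bits (N ℕ.* m) → Vec (Bits m) N
  blocks zero    m X = []
  blocks (suc N) m X = take m X ∷ blocks N m (drop m X)

  blocks-++ : ∀ N {m} (b : Bits m) (X : Bits (N ℕ.* m)) → blocks (suc N) m (b ++ X) ≡ b ∷ blocks N m X
  blocks-++ N {m} b X with ++-injective (take m (b ++ X)) b (take++drop≡id m (b ++ X))
  ... | eq₁ , eq₂ = cong₂ _∷_ eq₁ (cong (blocks N m) eq₂)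

  concat-blocks : ∀ N m (X : Bits (N ℕ.* m)) → concat (blocks N m X) ≡ X
  concat-blocks zero    m [] = refl
  concat-blocks (suc N) m X  =
    trans (cong (take m X ++_) (concat-blocks N m (drop m X))) (take++drop≡id m X)

  lookup-blocks : ∀ N m (X : Bits (N ℕ.* m)) i j → lookup (lookup (blocks N m X) i) j ≡ lookup X (combine i j)
  lookup-blocks N m X i j = trans (sym (lookup-concat (blocks N m X) i j))
    (cong (λ Y → lookup Y (combine i j)) (concat-blocks N m X))

  ∏ : ∀ {A : Set} {n} → (A → ℚ) → Vec A n → ℚ
  ∏ g []       = 1ℚ
  ∏ g (x ∷ xs) = g x * ∏ g xs

  ∏-nonneg : ∀ {A : Set} {n} {g : A → ℚ} → (∀ x → 0ℚ ≤ g x) → (xs : Vec A n) → 0ℚ ≤ ∏ g xs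
  ∏-nonneg 0≤g []       = 0≤1
  ∏-nonneg 0≤g (x ∷ xs) = 0≤g x ⊗ ∏-nonneg 0≤g xs

  ∏-≤1 : ∀ {A : Set} {n} {g : A → ℚ} → (∀ x → 0ℚ ≤ g x) → (∀ x → g x ≤ 1ℚ) → (xs : Vec A n) → ∏ g xs ≤ 1ℚ
  ∏-≤1 0≤g g≤1 []       = ≤-refl
  ∏-≤1 0≤g g≤1 (x ∷ xs) = *-mono (0≤g x) 0≤1 (g≤1 x) (∏-≤1 0≤g g≤1 xs)

  ∏-cong : ∀ {A : Set} {n} {f g : A → ℚ} → (∀ x → f x ≡ g x) → (xs : Vec A n) → ∏ f xs ≡ ∏ g xs
  ∏-cong eq []       = refl
  ∏-cong eq (x ∷ xs) = cong₂ _*_ (eq x) (∏-cong eq xs)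

  ∏-zero : ∀ {A : Set} {n} {g : A → ℚ} (xs : Vec A n) i → g (lookup xs i) ≡ 0ℚ → ∏ g xs ≡ 0ℚ
  ∏-zero {g = g} (x ∷ xs) zero    eq = trans (cong (_* ∏ g xs) eq) (ℚ.*-zeroˡ (∏ g xs))
  ∏-zero {g = g} (x ∷ xs) (suc i) eq = trans (cong (g x *_) (∏-zero xs i eq)) (ℚ.*-zeroʳ (g x))

  ∏-one : ∀ {A : Set} {n} {g : A → ℚ} (xs : Vec A n) → (∀ i → g (lookup xs i) ≡ 1ℚ) → ∏ g xs ≡ 1ℚ
  ∏-one []       eq = refl
  ∏-one (x ∷ xs) eq = cong₂ _*_ (eq zero) (∏-one xs (eq ∘ suc))

  ∏-* : ∀ {A : Set} {n} (f g : A → ℚ) (xs : Vec A n) → ∏ (λ x → f x * g x) xs ≡ ∏ f xs * ∏ g xs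
  ∏-* f g []       = refl
  ∏-* f g (x ∷ xs) = trans (cong (f x * g x *_) (∏-* f g xs)) (swap (f x) (g x) _ _)
    where
    swap : ∀ a b c d → (a * b) * (c * d) ≡ (a * c) * (b * d)
    swap = solve-∀ ℚ-ring

  -- Independence of the blocks under the uniform distribution, before normalisation.
  ∑-∏-blocks : ∀ N m (g : Bits m → ℚ) → ∑ (N ℕ.* m) (λ X → ∏ g (blocks N m X)) ≡ ∑ m g ^ℚ N
  ∑-∏-blocks zero    m g = refl
  ∑-∏-blocks (suc N) m g = trans (∑-product (λ b X → cong (∏ g) (blocks-++ N b X)))
    (cong (∑ m g *_) (∑-∏-blocks N m g))

open Sums

-- Terms as subcubes, and how the distribution missing a value fools them

module Terms where

  open import Data.Rational.Base using (_+_; _*_; _-_; -_; _≤_; _<_; nonNegative; positive)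
  open import Data.Rational.Properties using (≤-trans; ≤-refl; ≤-reflexive)
  open VecAll using (All; []; _∷_)
  open VecAllPairs using ([]; _∷_)
  open VecUnique using (Unique)

  -- Subcubes: nothing marks a free coordinate.
  Pattern : ℕ → Set
  Pattern = Vec (Maybe Bool)

  cell : Maybe Bool → Bool → ℚ
  cell nothing      _ = 1ℚ
  cell (just true)  x = ⟨ x ⟩
  cell (just false) x = ⟨ not x ⟩

  match : ∀ {n} → Pattern n → Bits n → ℚ
  match []      []      = 1ℚ
  match (c ∷ ρ) (x ∷ X) = cell c x * match ρ X

  weight : ∀ {n} → Pattern n → ℕ
  weight []            = 0
  weight (nothing ∷ ρ) = weight ρ
  weight (just _  ∷ ρ) = suc (weight ρ)

  vol : ∀ {n} → Pattern n → ℚ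
  vol ρ = ½ ^ℚ weight ρ

  cell-nonneg : ∀ c x → 0ℚ ≤ cell c x
  cell-nonneg nothing      x = 0≤1
  cell-nonneg (just true)  x = ⟨⟩-nonneg x
  cell-nonneg (just false) x = ⟨⟩-nonneg (not x)

  match-nonneg : ∀ {n} (ρ : Pattern n) X → 0ℚ ≤ match ρ X
  match-nonneg []      []      = 0≤1
  match-nonneg (c ∷ ρ) (x ∷ X) = cell-nonneg c x ⊗ match-nonneg ρ X

  match-++ : ∀ {m n} (σ : Pattern m) (ρ : Pattern n) b X →
    match (σ ++ ρ) (b ++ X) ≡ match σ b * match ρ X
  match-++ []      ρ []      X = sym (ℚ.*-identityˡ _)
  match-++ (c ∷ σ) ρ (x ∷ b) X = trans (cong (cell c x *_) (match-++ σ ρ b X)) (sym (ℚ.*-assoc (cell c x) _ _))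

  weight-++ : ∀ {m n} (σ : Pattern m) (ρ : Pattern n) → weight (σ ++ ρ) ≡ weight σ ℕ.+ weight ρ
  weight-++ []            ρ = refl
  weight-++ (nothing ∷ σ) ρ = weight-++ σ ρ
  weight-++ (just _  ∷ σ) ρ = cong suc (weight-++ σ ρ)

  vol-++ : ∀ {m n} (σ : Pattern m) (ρ : Pattern n) → vol (σ ++ ρ) ≡ vol σ * vol ρ
  vol-++ σ ρ = trans (cong (½ ^ℚ_) (weight-++ σ ρ)) (^-+ ½ (weight σ) (weight ρ))

  vol-nonneg : ∀ {n} (ρ : Pattern n) → 0ℚ ≤ vol ρ
  vol-nonneg ρ = ½^n≥0 (weight ρ)

  ∑-match : ∀ {n} (ρ : Pattern n) → ½ ^ℚ n * ∑ n (match ρ) ≡ vol ρ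
  ∑-match []                      = refl
  ∑-match {suc n} (nothing    ∷ ρ) = trans
    (cong (λ s → ½ ^ℚ suc n * (s + s)) (∑-*ˡ n 1ℚ (match ρ)))
    (trans (halve (½ ^ℚ n) (∑ n (match ρ))) (∑-match ρ))
    where
    halve : ∀ p s → (½ * p) * (1ℚ * s + 1ℚ * s) ≡ p * s
    halve = solve-∀ ℚ-ring
  ∑-match {suc n} (just true  ∷ ρ) = trans
    (cong₂ (λ s t → ½ ^ℚ suc n * (s + t)) (∑-*ˡ n 0ℚ (match ρ)) (∑-*ˡ n 1ℚ (match ρ)))
    (trans (halve (½ ^ℚ n) (∑ n (match ρ))) (cong (½ *_) (∑-match ρ)))
    where
    halve : ∀ p s → (½ * p) * (0ℚ * s + 1ℚ * s) ≡ ½ * (p * s)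
    halve = solve-∀ ℚ-ring
  ∑-match {suc n} (just false ∷ ρ) = trans
    (cong₂ (λ s t → ½ ^ℚ suc n * (s + t)) (∑-*ˡ n 1ℚ (match ρ)) (∑-*ˡ n 0ℚ (match ρ)))
    (trans (halve (½ ^ℚ n) (∑ n (match ρ))) (cong (½ *_) (∑-match ρ)))
    where
    halve : ∀ p s → (½ * p) * (1ℚ * s + 0ℚ * s) ≡ ½ * (p * s)
    halve = solve-∀ ℚ-ring

  match-update : ∀ {n} (ρ : Pattern n) i s X → lookup ρ i ≡ nothing →
    match (ρ [ i ]≔ just s) X ≡ cell (just s) (lookup X i) * match ρ X
  match-update (nothing ∷ ρ) zero    s (x ∷ X) refl = cong (cell (just s) x *_) (sym (ℚ.*-identityˡ _))
  match-update (c ∷ ρ)       (suc i) s (x ∷ X) eq   =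
    trans (cong (cell c x *_) (match-update ρ i s X eq)) (swap (cell c x) (cell (just s) (lookup X i)) _)
    where
    swap : ∀ a b c → a * (b * c) ≡ b * (a * c)
    swap = solve-∀ ℚ-ring

  weight-update : ∀ {n} (ρ : Pattern n) i s → lookup ρ i ≡ nothing →
    weight (ρ [ i ]≔ just s) ≡ suc (weight ρ)
  weight-update (nothing ∷ ρ) zero    s refl = refl
  weight-update (nothing ∷ ρ) (suc i) s eq   = weight-update ρ i s eq
  weight-update (just _  ∷ ρ) (suc i) s eq   = cong suc (weight-update ρ i s eq)

  free : ∀ n → Pattern n
  free n = replicate n nothing

  match-free : ∀ n X → match (free n) X ≡ 1ℚ
  match-free zero    []      = refl
  match-free (suc n) (x ∷ X) = trans (ℚ.*-identityˡ _) (match-free n X)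

  weight-free : ∀ n → weight (free n) ≡ 0
  weight-free zero    = refl
  weight-free (suc n) = weight-free n

  sign : ∀ {n} → Literal n → Bool
  sign (pos _) = true
  sign (neg _) = false

  -- Since the variables of a term are distinct, every update meets a free coordinate; this makes
  -- the conjunction a product of cells and the weight equal to k.
  subcube : ∀ {n k} → Vec (Literal n) k → Pattern n
  subcube {n} []       = free n
  subcube     (l ∷ ls) = subcube ls [ var l ]≔ just (sign l)

  subcube-free : ∀ {n k} {i : Fin n} (ls : Vec (Literal n) k) →
    All (i ≢_) (Vec.map var ls) → lookup (subcube ls) i ≡ nothing
  subcube-free {i = i} []       []         = lookup-replicate i nothing
  subcube-free         (l ∷ ls) (i≢ ∷ all) =
    trans (lookup∘update′ i≢ (subcube ls) (just (sign l))) (subcube-free ls all)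

  weight-subcube : ∀ {n k} (ls : Vec (Literal n) k) → Unique (Vec.map var ls) → weight (subcube ls) ≡ k
  weight-subcube {n} []       []          = weight-free n
  weight-subcube     (l ∷ ls) (new ∷ uniq) =
    trans (weight-update (subcube ls) (var l) (sign l) (subcube-free ls new)) (cong suc (weight-subcube ls uniq))

  cell-literal : ∀ {n} (l : Literal n) X → cell (just (sign l)) (lookup X (var l)) ≡ ⟨ ⟦ l ⟧ˡ X ⟩
  cell-literal (pos i) X = refl
  cell-literal (neg i) X = refl

  match-subcube : ∀ {n k} (ls : Vec (Literal n) k) → Unique (Vec.map var ls) → ∀ X →
    ⟨ Vec.foldr′ _∧_ true (Vec.map (λ l → ⟦ l ⟧ˡ X) ls) ⟩ ≡ match (subcube ls) X
  match-subcube {n} []       []           X = sym (match-free n X)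
  match-subcube     (l ∷ ls) (new ∷ uniq) X = trans (⟨⟩-∧ (⟦ l ⟧ˡ X) _)
    (trans (cong₂ _*_ (sym (cell-literal l X)) (match-subcube ls uniq X))
      (sym (match-update (subcube ls) (var l) (sign l) X (subcube-free ls new))))

  Pr-term : ∀ {n k} (D : Distribution n) (C : Term n k) →
    Pr D ⟦ C ⟧ ≡ ∑ n (λ X → match (subcube (literals C)) X * mass D X)
  Pr-term {n} D C = trans (Pr-⟨⟩ D ⟦ C ⟧)
    (∑-cong n (λ X → cong (_* mass D X) (match-subcube (literals C) (distinct C) X)))

  Pr-𝒰-term : ∀ {n k} (C : Term n k) → Pr (𝒰 n) ⟦ C ⟧ ≡ ½ ^ℚ k
  Pr-𝒰-term {n} {k} C = begin
    Pr (𝒰 n) ⟦ C ⟧                            ≡⟨ Pr-term (𝒰 n) C ⟩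
    ∑ n (λ X → match ρ X * ½ ^ℚ n)            ≡⟨ ∑-*ʳ n (½ ^ℚ n) (match ρ) ⟩
    ∑ n (match ρ) * ½ ^ℚ n                    ≡⟨ ℚ.*-comm _ (½ ^ℚ n) ⟩
    ½ ^ℚ n * ∑ n (match ρ)                    ≡⟨ ∑-match ρ ⟩
    ½ ^ℚ weight ρ                             ≡⟨ cong (½ ^ℚ_) (weight-subcube (literals C) (distinct C)) ⟩
    ½ ^ℚ k                                    ∎
    where
    open ≡-Reasoning
    ρ = subcube (literals C)

  weight-zero : ∀ {n} (ρ : Pattern n) → weight ρ ≡ 0 → ∀ X → match ρ X ≡ 1ℚ
  weight-zero []            eq []      = refl
  weight-zero (nothing ∷ ρ) eq (x ∷ X) = trans (ℚ.*-identityˡ _) (weight-zero ρ eq X)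

  -- Here r = M / (M - 1), the normalising factor of a block conditioned to avoid one value. It
  -- enters through its defining equation, so all identities stay polynomial in h and r.
  module Missing (m : ℕ) (r : ℚ) (0≤r : 0ℚ ≤ r) (r-inv : r * (1ℚ - ½ ^ℚ m) ≡ 1ℚ) where

    h : ℚ
    h = ½ ^ℚ m

    0≤h : 0ℚ ≤ h
    0≤h = ½^n≥0 m

    r≡ : r ≡ 1ℚ + h * r
    r≡ = trans (lem r h) (cong (_+ h * r) r-inv)
      where
      lem : ∀ r h → r ≡ r * (1ℚ - h) + h * r
      lem = solve-∀ ℚ-ring

    1≤r : 1ℚ ≤ r
    1≤r = ≤-by (0≤h ⊗ 0≤r) r≡

    -- The uniform distribution on the M - 1 values other than y, as h r = 1 / (M - 1).
    avoid : Bits m → Bits m → ℚ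
    avoid y b = h * r * (1ℚ - δ y b)

    avoid-nonneg : ∀ y b → 0ℚ ≤ avoid y b
    avoid-nonneg y b = 0≤h ⊗ 0≤r ⊗ 0≤q-p (δ-≤1 y b)

    v : Bits m → Pattern m → ℚ
    v y σ = ∑ m (λ b → match σ b * avoid y b)

    v-nonneg : ∀ y σ → 0ℚ ≤ v y σ
    v-nonneg y σ = ∑-nonneg m (λ b → match-nonneg σ b ⊗ avoid-nonneg y b)

    -- Conditioning on avoiding y takes the mass h of y away from σ if y lies there, and then
    -- rescales by r.
    v-value : ∀ y σ → v y σ ≡ r * (vol σ - h * match σ y)
    v-value y σ = begin
      v y σ
        ≡⟨ ∑-cong m (λ b → split (match σ b) h r (δ y b)) ⟩
      ∑ m (λ b → h * r * (match σ b - δ y b * match σ b))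
        ≡⟨ ∑-*ˡ m (h * r) _ ⟩
      h * r * ∑ m (λ b → match σ b - δ y b * match σ b)
        ≡⟨ cong (h * r *_) (∑-minus m _ _) ⟩
      h * r * (∑ m (match σ) - ∑ m (λ b → δ y b * match σ b))
        ≡⟨ cong (λ s → h * r * (∑ m (match σ) - s)) (∑-δ y (match σ)) ⟩
      h * r * (∑ m (match σ) - match σ y)
        ≡⟨ merge h r _ _ ⟩
      r * (h * ∑ m (match σ) - h * match σ y)
        ≡⟨ cong (λ s → r * (s - h * match σ y)) (∑-match σ) ⟩
      r * (vol σ - h * match σ y) ∎
      where
      open ≡-Reasoning
      split : ∀ a h r d → a * (h * r * (1ℚ - d)) ≡ h * r * (a - d * a)
      split = solve-∀ ℚ-ring
      merge : ∀ h r s t → h * r * (s - t) ≡ r * (h * s - h * t)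
      merge = solve-∀ ℚ-ring

    h*match≤vol : ∀ y σ → h * match σ y ≤ vol σ
    h*match≤vol y σ = ≤-trans (*-monoˡ 0≤h (∑-term m (match-nonneg σ) y)) (≤-reflexive (∑-match σ))

    v-free : ∀ y σ → weight σ ≡ 0 → v y σ ≡ 1ℚ
    v-free y σ eq = trans (v-value y σ) (trans (cong₂ (λ a b → r * (a - b)) (cong (½ ^ℚ_) eq)
      (trans (cong (h *_) (weight-zero σ eq y)) (ℚ.*-identityʳ h))) r-inv)

    -- A free block contributes exactly 1, so the factor r arises only for blocks with a fixed
    -- coordinate and can be charged to it. Over all blocks at most k such factors accumulate.
    v-upper : ∀ y σ → v y σ ≤ r ^ℚ weight σ * vol σ
    v-upper y σ with weight σ in eq
    ... | zero  = ≤-reflexive (v-free y σ eq)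
    ... | suc w = ≤-trans
      (≤-trans (≤-reflexive (trans (v-value y σ) (cong (λ k → r * (½ ^ℚ k - h * match σ y)) eq)))
        (*-monoˡ 0≤r (≤-by {d = h * match σ y} (0≤h ⊗ match-nonneg σ y) (restore _ _))))
      (*-monoʳ (½^n≥0 (suc w)) r≤)
      where
      restore : ∀ a b → a ≡ (a - b) + b
      restore = solve-∀ ℚ-ring
      r≤ : r ≤ r ^ℚ suc w
      r≤ = ≤-trans (≤-reflexive (sym (ℚ.*-identityʳ r)))
        (*-monoˡ 0≤r (≤-trans (≤-reflexive (sym (1^ w))) (^-mono w 0≤1 1≤r)))

    -- An additive error bound: (u - w)(U - W) ≥ u U - (w U + u W), so deficits of blocks add up without any division.
    record Deficit {n} (ρ : Pattern n) (V : Bits m → ℚ) : Set where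
      field
        W        : Bits m → ℚ
        W-nonneg : ∀ y → 0ℚ ≤ W y
        W-lower  : ∀ y → vol ρ - W y ≤ V y
        W-mean   : h * ∑ m W ≤ fromℕ (weight ρ) * h * vol ρ

    open Deficit

    -- A free block has no deficit. Otherwise r ≥ 1 is dropped and y costs h when it lies in σ;
    -- averaged over y this is h `vol σ`, charged to one fixed coordinate. The extra bound W ≤
    -- `vol σ` keeps the factor of this block nonnegative when blocks are multiplied.
    v-lower : ∀ σ k → weight σ ≡ k → Σ[ d ∈ Deficit σ (λ y → v y σ) ] (∀ y → W d y ≤ vol σ)
    v-lower σ zero eq = record
      { W        = λ _ → 0ℚ
      ; W-nonneg = λ _ → ≤-refl
      ; W-lower  = λ y → ≤-reflexive (trans (cong (λ k → ½ ^ℚ k - 0ℚ) eq) (sym (v-free y σ eq)))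
      ; W-mean   = ≤-reflexive (trans (cong (h *_) (∑-0 m)) (trans (zeros h (vol σ)) (cong (λ k → fromℕ k * h * vol σ) (sym eq))))
      } , λ _ → vol-nonneg σ
      where
      zeros : ∀ h u → h * 0ℚ ≡ 0ℚ * h * u
      zeros = solve-∀ ℚ-ring
    v-lower σ (suc w) eq = record
      { W        = λ y → h * match σ y
      ; W-nonneg = λ y → 0≤h ⊗ match-nonneg σ y
      ; W-lower  = λ y → ≤-trans (≤-reflexive (sym (ℚ.*-identityˡ _)))
                          (≤-trans (*-monoʳ (0≤q-p (h*match≤vol y σ)) 1≤r) (≤-reflexive (sym (v-value y σ))))
      ; W-mean   = ≤-trans (≤-reflexive (trans (cong (h *_) (trans (∑-*ˡ m h (match σ)) (∑-match σ))) (sym (ℚ.*-identityˡ _))))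
                          (≤-trans (*-monoʳ (0≤h ⊗ vol-nonneg σ) (fromℕ-mono-≤ {1} {weight σ} (subst (1 ℕ.≤_) (sym eq) (ℕ.s≤s ℕ.z≤n))))
                            (≤-reflexive (sym (ℚ.*-assoc (fromℕ (weight σ)) h (vol σ)))))
      } , λ y → h*match≤vol y σ

    module _ (N : ℕ) where

      -- Probability of the subcube ρ when all N blocks independently avoid the same y.
      V : Pattern (N ℕ.* m) → Bits m → ℚ
      V ρ y = ∑ (N ℕ.* m) (λ X → match ρ X * ∏ (avoid y) (blocks N m X))

      V-nonneg : ∀ ρ y → 0ℚ ≤ V ρ y
      V-nonneg ρ y = ∑-nonneg (N ℕ.* m) (λ X → match-nonneg ρ X ⊗ ∏-nonneg (avoid-nonneg y) (blocks N m X))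

    V-++ : ∀ N (σ : Pattern m) (ρ : Pattern (N ℕ.* m)) y → V (suc N) (σ ++ ρ) y ≡ v y σ * V N ρ y
    V-++ N σ ρ y = ∑-product λ b X →
      trans (cong₂ _*_ (match-++ σ ρ b X) (cong (∏ (avoid y)) (blocks-++ N b X)))
        (swap (match σ b) (match ρ X) (avoid y b) _)
      where
      swap : ∀ a b c d → a * b * (c * d) ≡ a * c * (b * d)
      swap = solve-∀ ℚ-ring

    V-upper : ∀ N ρ y → V N ρ y ≤ r ^ℚ weight ρ * vol ρ
    V-upper zero    [] y = ≤-refl
    V-upper (suc N) ρ  y with Vec.splitAt m ρ
    ... | σ , ρ′ , refl = begin
      V (suc N) (σ ++ ρ′) y                                          ≡⟨ V-++ N σ ρ′ y ⟩
      v y σ * V N ρ′ y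
        ≤⟨ *-mono (v-nonneg y σ) (^-nonneg (weight ρ′) 0≤r ⊗ vol-nonneg ρ′) (v-upper y σ) (V-upper N ρ′ y) ⟩
      r ^ℚ weight σ * vol σ * (r ^ℚ weight ρ′ * vol ρ′)              ≡⟨ swap (r ^ℚ weight σ) (vol σ) _ _ ⟩
      r ^ℚ weight σ * r ^ℚ weight ρ′ * (vol σ * vol ρ′)
        ≡⟨ cong₂ _*_ (trans (cong (r ^ℚ_) (weight-++ σ ρ′)) (^-+ r (weight σ) (weight ρ′))) (vol-++ σ ρ′) ⟨
      r ^ℚ weight (σ ++ ρ′) * vol (σ ++ ρ′)                          ∎
      where
      open ℚ.≤-Reasoning
      swap : ∀ a b c d → a * b * (c * d) ≡ a * c * (b * d)
      swap = solve-∀ ℚ-ring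

    V-lower : ∀ N ρ → Deficit ρ (V N ρ)
    V-lower zero    [] = record
      { W = λ _ → 0ℚ ; W-nonneg = λ _ → ≤-refl ; W-lower = λ _ → ≤-refl
      ; W-mean = ≤-reflexive (trans (cong (h *_) (∑-0 m)) (zeros h)) }
      where
      zeros : ∀ h → h * 0ℚ ≡ 0ℚ * h * 1ℚ
      zeros = solve-∀ ℚ-ring
    V-lower (suc N) ρ with Vec.splitAt m ρ
    ... | σ , ρ′ , refl with v-lower σ (weight σ) refl | V-lower N ρ′
    ... | d , d≤ | e = record
      { W        = λ y → W d y * vol ρ′ + vol σ * W e y
      ; W-nonneg = λ y → W-nonneg d y ⊗ vol-nonneg ρ′ ⊕ vol-nonneg σ ⊗ W-nonneg e y
      ; W-lower  = lower
      ; W-mean   = mean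
      }
      where
      open ℚ.≤-Reasoning
      lower : ∀ y → vol (σ ++ ρ′) - (W d y * vol ρ′ + vol σ * W e y) ≤ V (suc N) (σ ++ ρ′) y
      lower y = begin
        vol (σ ++ ρ′) - (W d y * vol ρ′ + vol σ * W e y)   ≡⟨ cong (_- (W d y * vol ρ′ + vol σ * W e y)) (vol-++ σ ρ′) ⟩
        vol σ * vol ρ′ - (W d y * vol ρ′ + vol σ * W e y)
          ≤⟨ ≤-by (W-nonneg d y ⊗ W-nonneg e y) (expand (vol σ) (vol ρ′) (W d y) (W e y)) ⟩
        -- Only the factor of the new block has to be nonnegative, so no bound W ≤ `vol` is carried
        -- through the induction.
        (vol σ - W d y) * (vol ρ′ - W e y)                 ≤⟨ *-monoˡ (0≤q-p (d≤ y)) (W-lower e y) ⟩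
        (vol σ - W d y) * V N ρ′ y                         ≤⟨ *-monoʳ (V-nonneg N ρ′ y) (W-lower d y) ⟩
        v y σ * V N ρ′ y                                   ≡⟨ V-++ N σ ρ′ y ⟨
        V (suc N) (σ ++ ρ′) y                              ∎
        where
        expand : ∀ u U w W → (u - w) * (U - W) ≡ u * U - (w * U + u * W) + w * W
        expand = solve-∀ ℚ-ring
      mean : h * ∑ m (λ y → W d y * vol ρ′ + vol σ * W e y) ≤ fromℕ (weight (σ ++ ρ′)) * h * vol (σ ++ ρ′)
      mean = begin
        h * ∑ m (λ y → W d y * vol ρ′ + vol σ * W e y)
          ≡⟨ cong (h *_) (trans (∑-+ m _ _) (cong₂ _+_ (∑-*ʳ m (vol ρ′) (W d)) (∑-*ˡ m (vol σ) (W e)))) ⟩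
        h * (∑ m (W d) * vol ρ′ + vol σ * ∑ m (W e))
          ≡⟨ regroup h (∑ m (W d)) (vol ρ′) (vol σ) _ ⟩
        h * ∑ m (W d) * vol ρ′ + vol σ * (h * ∑ m (W e))
          ≤⟨ ℚ.+-mono-≤ (*-monoʳ (vol-nonneg ρ′) (W-mean d)) (*-monoˡ (vol-nonneg σ) (W-mean e)) ⟩
        fromℕ (weight σ) * h * vol σ * vol ρ′ + vol σ * (fromℕ (weight ρ′) * h * vol ρ′)
          ≡⟨ collect (fromℕ (weight σ)) (fromℕ (weight ρ′)) h (vol σ) (vol ρ′) ⟩
        (fromℕ (weight σ) + fromℕ (weight ρ′)) * h * (vol σ * vol ρ′)
          ≡⟨ cong₂ (λ a b → a * h * b) (trans (cong fromℕ (weight-++ σ ρ′)) (fromℕ-+ (weight σ) (weight ρ′))) (vol-++ σ ρ′) ⟨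
        fromℕ (weight (σ ++ ρ′)) * h * vol (σ ++ ρ′) ∎
        where
        regroup : ∀ h s u w t → h * (s * u + w * t) ≡ h * s * u + w * (h * t)
        regroup = solve-∀ ℚ-ring
        collect : ∀ a b h u w → a * h * u * w + u * (b * h * w) ≡ (a + b) * h * (u * w)
        collect = solve-∀ ℚ-ring

    ∑-avoid : ∀ y → ∑ m (avoid y) ≡ 1ℚ
    ∑-avoid y = trans (∑-cong m (λ b → trans (sym (ℚ.*-identityˡ _)) (cong (_* avoid y b) (sym (match-free m b)))))
      (v-free y (free m) (weight-free m))

    module _ (N : ℕ) where

      n : ℕ
      n = N ℕ.* m

      missing : Distribution n
      missing .mass X   = h * ∑ m (λ y → ∏ (avoid y) (blocks N m X))
      missing .mass-≥0 X = 0≤h ⊗ ∑-nonneg m (λ y → ∏-nonneg (avoid-nonneg y) (blocks N m X))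
      missing .mass-sum = begin
        ∑ n (λ X → h * ∑ m (λ y → ∏ (avoid y) (blocks N m X)))   ≡⟨ ∑-*ˡ n h _ ⟩
        h * ∑ n (λ X → ∑ m (λ y → ∏ (avoid y) (blocks N m X)))   ≡⟨ cong (h *_) (∑-swap n m _) ⟩
        h * ∑ m (λ y → ∑ n (λ X → ∏ (avoid y) (blocks N m X)))
          ≡⟨ cong (h *_) (∑-cong m (λ y → trans (∑-∏-blocks N m (avoid y)) (trans (cong (_^ℚ N) (∑-avoid y)) (1^ N)))) ⟩
        h * ∑ m (λ _ → 1ℚ)                                       ≡⟨ ∑-*ˡ m h _ ⟨
        ∑ m (λ _ → h * 1ℚ)                                       ≡⟨ ∑-const m 1ℚ ⟩
        1ℚ                                                       ∎
        where open ≡-Reasoning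

      Pr-missing-term : ∀ {k} (C : Term n k) → Pr missing ⟦ C ⟧ ≡ h * ∑ m (V N (subcube (literals C)))
      Pr-missing-term C = begin
        Pr missing ⟦ C ⟧                                                     ≡⟨ Pr-term missing C ⟩
        ∑ n (λ X → match ρ X * (h * ∑ m (λ y → ∏ (avoid y) (blocks N m X))))
          ≡⟨ ∑-cong n (λ X → trans (swap (match ρ X) h _) (cong (h *_) (sym (∑-*ˡ m (match ρ X) _)))) ⟩
        ∑ n (λ X → h * ∑ m (λ y → match ρ X * ∏ (avoid y) (blocks N m X)))   ≡⟨ ∑-*ˡ n h _ ⟩
        h * ∑ n (λ X → ∑ m (λ y → match ρ X * ∏ (avoid y) (blocks N m X)))   ≡⟨ cong (h *_) (∑-swap n m _) ⟩
        h * ∑ m (V N ρ)                                                      ∎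
        where
        open ≡-Reasoning
        ρ = subcube (literals C)
        swap : ∀ a b c → a * (b * c) ≡ b * (a * c)
        swap = solve-∀ ℚ-ring

      mean-const : ∀ c → h * ∑ m (λ _ → c) ≡ c
      mean-const c = trans (sym (∑-*ˡ m h (λ _ → c))) (∑-const m c)

      Pr-missing-upper : ∀ {k} (C : Term n k) → Pr missing ⟦ C ⟧ ≤ r ^ℚ k * ½ ^ℚ k
      Pr-missing-upper {k} C = begin
        Pr missing ⟦ C ⟧              ≡⟨ Pr-missing-term C ⟩
        h * ∑ m (V N ρ)               ≤⟨ *-monoˡ 0≤h (∑-mono m (V-upper N ρ)) ⟩
        h * ∑ m (λ _ → r ^ℚ weight ρ * vol ρ)  ≡⟨ mean-const _ ⟩
        r ^ℚ weight ρ * ½ ^ℚ weight ρ ≡⟨ cong (λ k → r ^ℚ k * ½ ^ℚ k) (weight-subcube (literals C) (distinct C)) ⟩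
        r ^ℚ k * ½ ^ℚ k               ∎
        where
        open ℚ.≤-Reasoning
        ρ = subcube (literals C)

      Pr-missing-lower : ∀ {k} (C : Term n k) → (1ℚ - fromℕ k * h) * ½ ^ℚ k ≤ Pr missing ⟦ C ⟧
      Pr-missing-lower {k} C = begin
        (1ℚ - fromℕ k * h) * ½ ^ℚ k
          ≡⟨ cong (λ k → (1ℚ - fromℕ k * h) * ½ ^ℚ k) (weight-subcube (literals C) (distinct C)) ⟨
        (1ℚ - fromℕ (weight ρ) * h) * vol ρ      ≡⟨ expand (fromℕ (weight ρ) * h) (vol ρ) ⟩
        vol ρ - fromℕ (weight ρ) * h * vol ρ     ≤⟨ ℚ.+-monoʳ-≤ (vol ρ) (ℚ.neg-antimono-≤ (W-mean d)) ⟩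
        vol ρ - h * ∑ m (W d)                    ≡⟨ cong (_- h * ∑ m (W d)) (mean-const (vol ρ)) ⟨
        h * ∑ m (λ _ → vol ρ) - h * ∑ m (W d)    ≡⟨ factor h _ _ ⟩
        h * (∑ m (λ _ → vol ρ) - ∑ m (W d))      ≡⟨ cong (h *_) (∑-minus m (λ _ → vol ρ) (W d)) ⟨
        h * ∑ m (λ y → vol ρ - W d y)            ≤⟨ *-monoˡ 0≤h (∑-mono m (W-lower d)) ⟩
        h * ∑ m (V N ρ)                          ≡⟨ Pr-missing-term C ⟨
        Pr missing ⟦ C ⟧                         ∎
        where
        open ℚ.≤-Reasoning
        ρ = subcube (literals C)
        d = V-lower N ρ
        expand : ∀ a b → (1ℚ - a) * b ≡ b - a * b
        expand = solve-∀ ℚ-ring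
        factor : ∀ a b c → a * b - a * c ≡ a * (b - c)
        factor = solve-∀ ℚ-ring

      -- The lower side would hold with ε = k / M. The factor 2 comes from the upper side, (M / (M -
      -- 1))^k ≤ 1 / (1 - k/M) ≤ 1 + 2k/M, whose last step uses k ≤ M / 2.
      missing-fooled : ∀ k → fromℕ k * h ≤ ½ → AlmostIndependent (fromℕ 2 * (fromℕ k * h)) k missing
      missing-fooled k kh≤½ C = lower , upper
        where
        open ℚ.≤-Reasoning
        x = fromℕ k * h
        0≤x : 0ℚ ≤ x
        0≤x = 0≤fromℕ k ⊗ 0≤h
        lower : (1ℚ - fromℕ 2 * x) * Pr (𝒰 n) ⟦ C ⟧ ≤ Pr missing ⟦ C ⟧
        lower = begin
          (1ℚ - fromℕ 2 * x) * Pr (𝒰 n) ⟦ C ⟧  ≡⟨ cong ((1ℚ - fromℕ 2 * x) *_) (Pr-𝒰-term C) ⟩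
          (1ℚ - fromℕ 2 * x) * ½ ^ℚ k          ≤⟨ *-monoʳ (½^n≥0 k) (≤-by {1ℚ - fromℕ 2 * x} {1ℚ - x} 0≤x (weaken x)) ⟩
          (1ℚ - x) * ½ ^ℚ k                    ≤⟨ Pr-missing-lower C ⟩
          Pr missing ⟦ C ⟧                     ∎
          where
          weaken : ∀ x → 1ℚ - x ≡ 1ℚ - (1ℚ + 1ℚ) * x + x
          weaken = solve-∀ ℚ-ring
        0≤1+2x : 0ℚ ≤ 1ℚ + fromℕ 2 * x
        0≤1+2x = 0≤1 ⊕ 0≤fromℕ 2 ⊗ 0≤x
        h≤1 : h ≤ 1ℚ
        h≤1 = ^-≤1 m 0≤½ (p≤p+q ½ 0≤½)
        -- (1 + 2x)(1 - x) ≥ 1 for 0 ≤ x ≤ 1/2, and r = 1 / (1 - h)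
        key : r ^ℚ k ≤ 1ℚ + fromℕ 2 * x
        key = begin
          r ^ℚ k                                              ≡⟨ ℚ.*-identityʳ _ ⟨
          r ^ℚ k * 1ℚ
            ≤⟨ *-monoˡ (^-nonneg k 0≤r) (≤-by (0≤fromℕ 2 ⊗ 0≤x ⊗ 0≤q-p kh≤½) (gain x)) ⟩
          r ^ℚ k * ((1ℚ + fromℕ 2 * x) * (1ℚ - x))
            ≤⟨ *-monoˡ (^-nonneg k 0≤r) (*-monoˡ 0≤1+2x (bernoulli k h≤1)) ⟩
          r ^ℚ k * ((1ℚ + fromℕ 2 * x) * (1ℚ - h) ^ℚ k)       ≡⟨ swap (r ^ℚ k) (1ℚ + fromℕ 2 * x) _ ⟩
          (1ℚ + fromℕ 2 * x) * (r ^ℚ k * (1ℚ - h) ^ℚ k)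
            ≡⟨ cong ((1ℚ + fromℕ 2 * x) *_) (trans (sym (^-distrib-* r (1ℚ - h) k)) (trans (cong (_^ℚ k) r-inv) (1^ k))) ⟩
          (1ℚ + fromℕ 2 * x) * 1ℚ                             ≡⟨ ℚ.*-identityʳ _ ⟩
          1ℚ + fromℕ 2 * x                                    ∎
          where
          gain : ∀ x → (1ℚ + (1ℚ + 1ℚ) * x) * (1ℚ - x) ≡ 1ℚ + (1ℚ + 1ℚ) * x * (½ - x)
          gain = solve-∀ ℚ-ring
          swap : ∀ a b c → a * (b * c) ≡ b * (a * c)
          swap = solve-∀ ℚ-ring
        upper : Pr missing ⟦ C ⟧ ≤ (1ℚ + fromℕ 2 * x) * Pr (𝒰 n) ⟦ C ⟧
        upper = begin
          Pr missing ⟦ C ⟧                       ≤⟨ Pr-missing-upper C ⟩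
          r ^ℚ k * ½ ^ℚ k                        ≤⟨ *-monoʳ (½^n≥0 k) key ⟩
          (1ℚ + fromℕ 2 * x) * ½ ^ℚ k            ≡⟨ cong ((1ℚ + fromℕ 2 * x) *_) (Pr-𝒰-term C) ⟨
          (1ℚ + fromℕ 2 * x) * Pr (𝒰 n) ⟦ C ⟧    ∎

open Terms

-- From the partial sums of ln 2 to (1 - 1/M)^N ≤ 1/M

module Logarithm where

  open import Data.Rational.Base using (_+_; _*_; _-_; -_; _≤_; _<_; nonNegative; positive)
  open import Data.Rational.Properties using (≤-trans; ≤-refl; ≤-reflexive)

  -- partial sums of - ln (1 - a)
  logSum : ℕ → ℚ → ℚ
  logSum zero    a = 0ℚ
  logSum (suc j) a = logSum j a + (ℤ.+ 1 / suc j) * a ^ℚ suc j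

  ln2-partial≡logSum : ∀ j → ln2-partial j ≡ logSum j ½
  ln2-partial≡logSum zero    = refl
  ln2-partial≡logSum (suc j) = cong (_+ (ℤ.+ 1 / suc j) * ½ ^ℚ suc j) (ln2-partial≡logSum j)

  logSum-nonneg : ∀ j {a} → 0ℚ ≤ a → 0ℚ ≤ logSum j a
  logSum-nonneg zero    0≤a = ≤-refl
  logSum-nonneg (suc j) 0≤a = logSum-nonneg j 0≤a ⊕ 0≤1/suc j ⊗ ^-nonneg (suc j) 0≤a

  -- The derivative of `logSum j`, a truncation of 1 / (1 - a).
  geometric : ℕ → ℚ → ℚ
  geometric zero    a = 0ℚ
  geometric (suc j) a = geometric j a + a ^ℚ j

  geometric-sum : ∀ j a → (1ℚ - a) * geometric j a ≡ 1ℚ - a ^ℚ j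
  geometric-sum zero    a = ℚ.*-zeroʳ (1ℚ - a)
  geometric-sum (suc j) a = trans (ℚ.*-distribˡ-+ (1ℚ - a) _ _)
    (trans (cong (_+ (1ℚ - a) * a ^ℚ j) (geometric-sum j a)) (telescope a (a ^ℚ j)))
    where
    telescope : ∀ a p → (1ℚ - p) + (1ℚ - a) * p ≡ 1ℚ - a * p
    telescope = solve-∀ ℚ-ring

  -- Each summand is convex on nonnegative arguments, so the sum lies above its tangent at a. This
  -- bounds a Riemann rectangle by the growth of the antiderivative.
  logSum-increment : ∀ j {a b} → 0ℚ ≤ a → 0ℚ ≤ b →
    logSum j a + (b - a) * geometric j a ≤ logSum j b
  logSum-increment zero    {a} {b} 0≤a 0≤b = ≤-reflexive (zeros (b - a))
    where
    zeros : ∀ c → 0ℚ + c * 0ℚ ≡ 0ℚ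
    zeros = solve-∀ ℚ-ring
  logSum-increment (suc j) {a} {b} 0≤a 0≤b = begin
    (logSum j a + s * (a * p)) + (b - a) * (geometric j a + p)
      ≡⟨ cong (λ o → (logSum j a + s * (a * p)) + (b - a) * (geometric j a + o)) (trans (sym (ℚ.*-identityˡ p)) (cong (_* p) (sym (1/suc j)))) ⟩
    (logSum j a + s * (a * p)) + (b - a) * (geometric j a + fromℕ (suc j) * s * p)
      ≡⟨ cong (λ q → (logSum j a + s * (a * p)) + (b - a) * (geometric j a + q * s * p)) (fromℕ-suc j) ⟩
    (logSum j a + s * (a * p)) + (b - a) * (geometric j a + (1ℚ + fromℕ j) * s * p)
      ≡⟨ regroup (logSum j a) s a b p (geometric j a) (fromℕ j) ⟩
    (logSum j a + (b - a) * geometric j a) + s * (p * ((1ℚ + fromℕ j) * b - fromℕ j * a))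
      ≡⟨ cong (λ q → (logSum j a + (b - a) * geometric j a) + s * (p * (q * b - fromℕ j * a))) (fromℕ-suc j) ⟨
    (logSum j a + (b - a) * geometric j a) + s * (p * (fromℕ (suc j) * b - fromℕ j * a))
      ≤⟨ ℚ.+-mono-≤ (logSum-increment j 0≤a 0≤b) (*-monoˡ (0≤1/suc j) (tangent j 0≤a 0≤b)) ⟩
    logSum j b + s * b ^ℚ suc j ∎
    where
    open ℚ.≤-Reasoning
    s = ℤ.+ 1 / suc j
    p = a ^ℚ j
    regroup : ∀ l s a b p g q → (l + s * (a * p)) + (b - a) * (g + (1ℚ + q) * s * p)
      ≡ (l + (b - a) * g) + s * (p * ((1ℚ + q) * b - q * a))
    regroup = solve-∀ ℚ-ring

  -- Replacing each 1 / j by 1 leaves a geometric sum. This crude bound on ln 2 serves to derive N ≤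
  -- M m.
  ln2-partial≤1 : ∀ j → ln2-partial j ≤ 1ℚ
  ln2-partial≤1 j = ≤-trans (bound j) (≤-by {1ℚ - ½ ^ℚ j} {1ℚ} (½^n≥0 j) (restore (½ ^ℚ j)))
    where
    restore : ∀ p → 1ℚ ≡ 1ℚ - p + p
    restore = solve-∀ ℚ-ring
    telescope : ∀ p → (1ℚ - p) + ½ * p ≡ 1ℚ - ½ * p
    telescope = solve-∀ ℚ-ring
    1/suc≤1 : ∀ j → ℤ.+ 1 / suc j ≤ 1ℚ
    1/suc≤1 j = ≤-trans (≤-reflexive (sym (ℚ.*-identityˡ (ℤ.+ 1 / suc j))))
      (≤-trans (*-monoʳ {1ℚ} {fromℕ (suc j)} (0≤1/suc j) (fromℕ-mono-≤ {1} {suc j} (ℕ.s≤s ℕ.z≤n))) (≤-reflexive (1/suc j)))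
    bound : ∀ j → ln2-partial j ≤ 1ℚ - ½ ^ℚ j
    bound zero    = ≤-refl
    bound (suc j) = ≤-trans (ℚ.+-mono-≤ (bound j) (≤-trans (*-monoʳ (½^n≥0 (suc j)) (1/suc≤1 j)) (≤-reflexive (ℚ.*-identityˡ _))))
      (≤-reflexive (telescope (½ ^ℚ j)))

  n<2^n : ∀ n → n ℕ.< 2 ℕ.^ n
  n<2^n zero    = ℕ.s≤s ℕ.z≤n
  n<2^n (suc n) = subst (suc (suc n) ℕ.≤_) (cong (2 ℕ.^ n ℕ.+_) (sym (ℕ.+-identityʳ _)))
    (ℕ.+-mono-≤ (ℕ.m^n>0 2 n) (n<2^n n))

  -- This is 1 - 1/(i + 1), with the index shifted so that the denominator never vanishes.
  ratio : ℕ → ℚ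
  ratio i = fromℕ i * (ℤ.+ 1 / suc i)

  suc*ratio : ∀ i → fromℕ (suc i) * ratio i ≡ fromℕ i
  suc*ratio i = trans (swap (fromℕ (suc i)) (fromℕ i) _) (trans (cong (fromℕ i *_) (1/suc i)) (ℚ.*-identityʳ _))
    where
    swap : ∀ a b c → a * (b * c) ≡ b * (a * c)
    swap = solve-∀ ℚ-ring

  ratio-nonneg : ∀ i → 0ℚ ≤ ratio i
  ratio-nonneg i = 0≤fromℕ i ⊗ 0≤1/suc i

  ratio-unique : ∀ i {x} → fromℕ (suc i) * x ≡ fromℕ i → x ≡ ratio i
  ratio-unique i {x} eq = ℚ.≤-antisym
    (*-cancelˡ-≤ (fromℕ (suc i)) (0<fromℕ-suc i) (≤-reflexive (trans eq (sym (suc*ratio i)))))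
    (*-cancelˡ-≤ (fromℕ (suc i)) (0<fromℕ-suc i) (≤-reflexive (trans (suc*ratio i) (sym eq))))

  ratio-≤1 : ∀ i → ratio i ≤ 1ℚ
  ratio-≤1 i = *-cancelˡ-≤ (fromℕ (suc i)) (0<fromℕ-suc i)
    (≤-trans (≤-reflexive (suc*ratio i)) (≤-trans (fromℕ-mono-≤ (ℕ.n≤1+n i)) (≤-reflexive (sym (ℚ.*-identityʳ _)))))

  -- Monotonicity of (1 - 1/n)^n. In the tangent inequality with p = i + 1, between `ratio i` and
  -- `ratio (suc i)`, the bracket is (i + 1) - i = 1.
  ratio-power-step : ∀ i → ratio i ^ℚ suc i ≤ ratio (suc i) ^ℚ suc (suc i)
  ratio-power-step i = subst (_≤ ratio (suc i) ^ℚ suc (suc i)) eq (tangent (suc i) (ratio-nonneg i) (ratio-nonneg (suc i)))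
    where
    cancel : ∀ q → (1ℚ + q) - q ≡ 1ℚ
    cancel = solve-∀ ℚ-ring
    eq : ratio i ^ℚ suc i * (fromℕ (suc (suc i)) * ratio (suc i) - fromℕ (suc i) * ratio i) ≡ ratio i ^ℚ suc i
    eq = trans (cong (ratio i ^ℚ suc i *_) (trans (cong₂ _-_ (trans (suc*ratio (suc i)) (fromℕ-suc i)) (suc*ratio i)) (cancel (fromℕ i))))
      (ℚ.*-identityʳ _)

  ratio-power : ∀ i e → ratio i ^ℚ suc i ≤ ratio (i ℕ.+ e) ^ℚ suc (i ℕ.+ e)
  ratio-power i zero    = ≤-reflexive (cong (λ k → ratio k ^ℚ suc k) (sym (ℕ.+-identityʳ i)))
  ratio-power i (suc e) = ≤-trans (ratio-power i e)
    (subst (λ k → ratio (i ℕ.+ e) ^ℚ suc (i ℕ.+ e) ≤ ratio k ^ℚ suc k) (sym (ℕ.+-suc i e)) (ratio-power-step (i ℕ.+ e)))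

  module _ (M′ : ℕ) where

    private
      M = suc M′
      x = ratio M′
      g = ½ * (ℤ.+ 1 / M)

    -- The grid (M + d) / (2M), from 1/2 at d = 0 to 1 at d = M. Quotients of neighbours are the
    -- factors 1 - 1/(M + d + 1) of the telescoping product for 1/2.
    point : ℕ → ℚ
    point d = fromℕ (M ℕ.+ d) * g

    0≤g : 0ℚ ≤ g
    0≤g = 0≤½ ⊗ 0≤1/suc M′

    M*g : fromℕ M * g ≡ ½
    M*g = trans (swap (fromℕ M) _) (trans (cong (½ *_) (1/suc M′)) (ℚ.*-identityʳ ½))
      where
      swap : ∀ a b → a * (½ * b) ≡ ½ * (a * b)
      swap = solve-∀ ℚ-ring

    point≡ : ∀ d → point d ≡ ½ + fromℕ d * g
    point≡ d = trans (cong (_* g) (fromℕ-+ M d)) (trans (ℚ.*-distribʳ-+ g (fromℕ M) (fromℕ d)) (cong (_+ fromℕ d * g) M*g))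

    point-zero : point 0 ≡ ½
    point-zero = trans (cong (λ k → fromℕ k * g) (ℕ.+-identityʳ M)) M*g

    point-M : point M ≡ 1ℚ
    point-M = trans (point≡ M) (cong (½ +_) M*g)

    point-≤1 : ∀ {d} → d ℕ.≤ M → point d ≤ 1ℚ
    point-≤1 d≤M = ≤-trans (*-monoʳ 0≤g (fromℕ-mono-≤ (ℕ.+-monoʳ-≤ M d≤M))) (≤-reflexive point-M)

    1-point-≤½ : ∀ d → 1ℚ - point d ≤ ½
    1-point-≤½ d = ≤-by (0≤fromℕ d ⊗ 0≤g) (trans (lem (fromℕ d * g)) (cong (λ s → 1ℚ - s + fromℕ d * g) (sym (point≡ d))))
      where
      lem : ∀ s → ½ ≡ 1ℚ - (½ + s) + s
      lem = solve-∀ ℚ-ring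

    -- x ^ (p / (q + 1)) ≤ point d with p / (q + 1) ≤ - M ln (point d), the logarithm being given by its partial sums.
    record Exponent (d : ℕ) : Set where
      field
        p q   : ℕ
        power : x ^ℚ p ≤ point d ^ℚ suc q
        bound : ∀ j → fromℕ p * (1ℚ - ½ ^ℚ j) ≤ fromℕ (suc q) * fromℕ M * logSum j (1ℚ - point d)

    open Exponent

    -- Induction from the point 1 downwards. Since `point d` = y u with u = 1 - 1/i, and x^M ≤ u^i,
    -- the exponent p / Q belonging to y grows by M / i, while the logarithm grows by at least one
    -- rectangle of width g.
    exponent : ∀ t d → t ℕ.+ d ≡ M → Exponent d
    exponent zero d refl = record
      { p = 0 ; q = 0
      ; power = ≤-reflexive (sym (trans (ℚ.*-identityʳ _) point-M))
      ; bound = λ j → ≤-trans (≤-reflexive (ℚ.*-zeroˡ (1ℚ - ½ ^ℚ j)))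
          (0≤fromℕ 1 ⊗ 0≤fromℕ M ⊗ logSum-nonneg j (0≤q-p (point-≤1 ℕ.≤-refl)))
      }
    exponent (suc t) d eq = record
      { p = p e ℕ.* i ℕ.+ M ℕ.* Q
      -- Chosen so that `suc q` unfolds to Q * i, the common denominator of p / Q and M / i.
      ; q = i′ ℕ.+ q e ℕ.* i
      ; power = power′
      ; bound = bound′
      }
      where
      open ℚ.≤-Reasoning
      1+d≤M : suc d ℕ.≤ M
      1+d≤M = ℕ.≤-trans (ℕ.m≤n+m (suc d) t) (ℕ.≤-reflexive (trans (ℕ.+-suc t d) eq))
      e : Exponent (suc d)
      e = exponent t (suc d) (trans (ℕ.+-suc t d) eq)
      i′ = M ℕ.+ d
      i = suc i′
      Q = suc (q e)
      y = point (suc d)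
      i*g≡y : fromℕ i * g ≡ y
      i*g≡y = cong (λ k → fromℕ k * g) (sym (ℕ.+-suc M d))
      u = ratio i′
      point-step : point d ≡ y * u
      point-step = trans (cong (_* g) (sym (suc*ratio i′))) (trans (swap (fromℕ i) u g) (cong (_* u) i*g≡y))
        where
        swap : ∀ a b c → a * b * c ≡ a * c * b
        swap = solve-∀ ℚ-ring
      difference : y - point d ≡ g
      difference = trans (cong₂ _-_ (trans (sym i*g≡y) (cong (_* g) (fromℕ-suc i′))) refl) (lem (fromℕ i′) g)
        where
        lem : ∀ a g → (1ℚ + a) * g - a * g ≡ g
        lem = solve-∀ ℚ-ring
      power-u : x ^ℚ M ≤ u ^ℚ i
      power-u = subst (λ k → x ^ℚ M ≤ ratio k ^ℚ suc k) (ℕ.+-suc M′ d) (ratio-power M′ (suc d))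
      power′ : x ^ℚ (p e ℕ.* i ℕ.+ M ℕ.* Q) ≤ point d ^ℚ (Q ℕ.* i)
      power′ = begin
        x ^ℚ (p e ℕ.* i ℕ.+ M ℕ.* Q)             ≡⟨ ^-+ x (p e ℕ.* i) (M ℕ.* Q) ⟩
        x ^ℚ (p e ℕ.* i) * x ^ℚ (M ℕ.* Q)
          ≡⟨ cong₂ _*_ (trans (cong (x ^ℚ_) (ℕ.*-comm (p e) i)) (^-* x i (p e))) (trans (cong (x ^ℚ_) (ℕ.*-comm M Q)) (^-* x Q M)) ⟩
        (x ^ℚ p e) ^ℚ i * (x ^ℚ M) ^ℚ Q
          ≤⟨ *-mono (^-nonneg i (^-nonneg (p e) (ratio-nonneg M′))) (^-nonneg Q (^-nonneg i (ratio-nonneg i′))) (^-mono i (^-nonneg (p e) (ratio-nonneg M′)) (power e)) (^-mono Q (^-nonneg M (ratio-nonneg M′)) power-u) ⟩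
        (y ^ℚ Q) ^ℚ i * (u ^ℚ i) ^ℚ Q
          ≡⟨ cong₂ _*_ (trans (sym (^-* y i Q)) (cong (y ^ℚ_) (ℕ.*-comm i Q))) (sym (^-* u Q i)) ⟩
        y ^ℚ (Q ℕ.* i) * u ^ℚ (Q ℕ.* i)          ≡⟨ ^-distrib-* y u (Q ℕ.* i) ⟨
        (y * u) ^ℚ (Q ℕ.* i)                     ≡⟨ cong (_^ℚ (Q ℕ.* i)) point-step ⟨
        point d ^ℚ (Q ℕ.* i)                     ∎
      a = 1ℚ - y
      b = 1ℚ - point d
      0≤a : 0ℚ ≤ a
      0≤a = 0≤q-p (point-≤1 1+d≤M)
      0≤b : 0ℚ ≤ b
      0≤b = 0≤q-p (point-≤1 (ℕ.≤-trans (ℕ.n≤1+n d) 1+d≤M))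
      -- The rectangle over [a, b] of height `geometric j a` has area (1 - a^j) / i, because 1 - a =
      -- i g and b - a = g; and a ≤ 1/2 bounds the truncation error uniformly over the grid.
      increment : ∀ j → 1ℚ - ½ ^ℚ j ≤ fromℕ i * ((b - a) * geometric j a)
      increment j = begin
        1ℚ - ½ ^ℚ j                           ≤⟨ ℚ.+-monoʳ-≤ 1ℚ (ℚ.neg-antimono-≤ (^-mono j 0≤a (1-point-≤½ (suc d)))) ⟩
        1ℚ - a ^ℚ j                           ≡⟨ geometric-sum j a ⟨
        (1ℚ - a) * geometric j a              ≡⟨ cong (_* geometric j a) (trans (double y) (sym i*g≡y)) ⟩
        fromℕ i * g * geometric j a
          ≡⟨ cong (λ s → fromℕ i * s * geometric j a) (trans (sym difference) (swap (point d) y)) ⟩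
        fromℕ i * (b - a) * geometric j a     ≡⟨ ℚ.*-assoc (fromℕ i) (b - a) _ ⟩
        fromℕ i * ((b - a) * geometric j a)   ∎
        where
        double : ∀ y → 1ℚ - (1ℚ - y) ≡ y
        double = solve-∀ ℚ-ring
        swap : ∀ z y → y - z ≡ (1ℚ - z) - (1ℚ - y)
        swap = solve-∀ ℚ-ring
      bound′ : ∀ j → fromℕ (p e ℕ.* i ℕ.+ M ℕ.* Q) * (1ℚ - ½ ^ℚ j) ≤ fromℕ (Q ℕ.* i) * fromℕ M * logSum j b
      bound′ j = begin
        fromℕ (p e ℕ.* i ℕ.+ M ℕ.* Q) * c
          ≡⟨ cong (_* c) (trans (fromℕ-+ (p e ℕ.* i) (M ℕ.* Q)) (cong₂ _+_ (fromℕ-* (p e) i) (fromℕ-* M Q))) ⟩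
        (fromℕ (p e) * fromℕ i + fromℕ M * fromℕ Q) * c
          ≡⟨ regroup (fromℕ (p e)) (fromℕ i) (fromℕ M) (fromℕ Q) c ⟩
        fromℕ i * (fromℕ (p e) * c) + fromℕ Q * fromℕ M * c
          ≤⟨ ℚ.+-mono-≤ (*-monoˡ (0≤fromℕ i) (bound e j)) (*-monoˡ (0≤fromℕ Q ⊗ 0≤fromℕ M) (increment j)) ⟩
        fromℕ i * (fromℕ Q * fromℕ M * logSum j a) + fromℕ Q * fromℕ M * (fromℕ i * ((b - a) * geometric j a))
          ≡⟨ collect (fromℕ i) (fromℕ Q) (fromℕ M) (logSum j a) _ ⟩
        (fromℕ Q * fromℕ i) * fromℕ M * (logSum j a + (b - a) * geometric j a)
          ≤⟨ *-monoˡ (0≤fromℕ Q ⊗ 0≤fromℕ i ⊗ 0≤fromℕ M) (logSum-increment j 0≤a 0≤b) ⟩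
        (fromℕ Q * fromℕ i) * fromℕ M * logSum j b
          ≡⟨ cong (λ s → s * fromℕ M * logSum j b) (fromℕ-* Q i) ⟨
        fromℕ (Q ℕ.* i) * fromℕ M * logSum j b ∎
        where
        c = 1ℚ - ½ ^ℚ j
        regroup : ∀ p i m q c → (p * i + m * q) * c ≡ i * (p * c) + q * m * c
        regroup = solve-∀ ℚ-ring
        collect : ∀ i q m l s → i * (q * m * l) + q * m * (i * s) ≡ (q * i) * m * (l + s)
        collect = solve-∀ ℚ-ring

    -- No limit in j is taken. For P = m p the single choice j = P gives P - P 2⁻ᴾ ≤ Q N with P 2⁻ᴾ
    -- < 1, and integrality turns this into P ≤ Q N.
    ratio^N≤½^m : ∀ m N → (M ℕ.* m) ·ln2≤ N → ratio M′ ^ℚ N ≤ ½ ^ℚ m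
    ratio^N≤½^m m N upper = ^-cancel-≤ (q e) (½^n≥0 m) (begin
      (x ^ℚ N) ^ℚ Q           ≡⟨ ^-* x Q N ⟨
      x ^ℚ (Q ℕ.* N)          ≤⟨ ^-antimono (ratio-nonneg M′) (ratio-≤1 M′) P≤QN ⟩
      x ^ℚ (m ℕ.* p e)        ≡⟨ ^-* x m (p e) ⟩
      (x ^ℚ p e) ^ℚ m         ≤⟨ ^-mono m (^-nonneg (p e) (ratio-nonneg M′)) (power e) ⟩
      (point 0 ^ℚ Q) ^ℚ m     ≡⟨ cong (λ s → (s ^ℚ Q) ^ℚ m) point-zero ⟩
      (½ ^ℚ Q) ^ℚ m           ≡⟨ ^-* ½ m Q ⟨
      ½ ^ℚ (m ℕ.* Q)          ≡⟨ cong (½ ^ℚ_) (ℕ.*-comm m Q) ⟩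
      ½ ^ℚ (Q ℕ.* m)          ≡⟨ ^-* ½ Q m ⟩
      (½ ^ℚ m) ^ℚ Q           ∎)
      where
      open ℚ.≤-Reasoning
      e = exponent M 0 (ℕ.+-identityʳ M)
      Q = suc (q e)
      P = m ℕ.* p e
      0<½^ : 0ℚ < ½ ^ℚ P
      0<½^ = ℚ.≰⇒> λ ½^≤0 → ℚ.<-irrefl refl (ℚ.<-≤-trans (ℚ.positive⁻¹ 1ℚ)
        (subst₂ _≤_ (½^*2^ P) (ℚ.*-zeroˡ (fromℕ (2 ℕ.^ P))) (*-monoʳ (0≤fromℕ (2 ℕ.^ P)) ½^≤0)))
      P½^<1 : fromℕ P * ½ ^ℚ P < 1ℚ
      P½^<1 = subst (fromℕ P * ½ ^ℚ P <_) (trans (ℚ.*-comm _ (½ ^ℚ P)) (½^*2^ P))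
        (ℚ.*-monoˡ-<-pos (½ ^ℚ P) {{positive 0<½^}} (fromℕ-mono-< (n<2^n P)))
      main : fromℕ P * (1ℚ - ½ ^ℚ P) ≤ fromℕ (Q ℕ.* N)
      main = begin
        fromℕ P * (1ℚ - ½ ^ℚ P)                               ≡⟨ cong (_* (1ℚ - ½ ^ℚ P)) (fromℕ-* m (p e)) ⟩
        fromℕ m * fromℕ (p e) * (1ℚ - ½ ^ℚ P)                 ≡⟨ ℚ.*-assoc (fromℕ m) _ _ ⟩
        fromℕ m * (fromℕ (p e) * (1ℚ - ½ ^ℚ P))               ≤⟨ *-monoˡ (0≤fromℕ m) (bound e P) ⟩
        fromℕ m * (fromℕ Q * fromℕ M * logSum P (1ℚ - point 0))
          ≡⟨ cong (λ s → fromℕ m * (fromℕ Q * fromℕ M * logSum P (1ℚ - s))) point-zero ⟩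
        fromℕ m * (fromℕ Q * fromℕ M * logSum P ½)            ≡⟨ regroup (fromℕ m) (fromℕ Q) (fromℕ M) (logSum P ½) ⟩
        fromℕ Q * (fromℕ M * fromℕ m * logSum P ½)
          ≡⟨ cong₂ (λ s t → fromℕ Q * (s * t)) (fromℕ-* M m) (ln2-partial≡logSum P) ⟨
        fromℕ Q * (fromℕ (M ℕ.* m) * ln2-partial P)           ≤⟨ *-monoˡ (0≤fromℕ Q) (upper P) ⟩
        fromℕ Q * fromℕ N                                     ≡⟨ fromℕ-* Q N ⟨
        fromℕ (Q ℕ.* N)                                       ∎
        where
        regroup : ∀ a b c d → a * (b * c * d) ≡ b * (c * a * d)
        regroup = solve-∀ ℚ-ring
      P≤QN : P ℕ.≤ Q ℕ.* N
      P≤QN = ℕ.s≤s⁻¹ (fromℕ-cancel-< (begin-strict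
        fromℕ P                                             ≡⟨ split (fromℕ P) (½ ^ℚ P) ⟩
        fromℕ P * (1ℚ - ½ ^ℚ P) + fromℕ P * ½ ^ℚ P          <⟨ ℚ.+-mono-≤-< main P½^<1 ⟩
        fromℕ (Q ℕ.* N) + 1ℚ                                ≡⟨ ℚ.+-comm (fromℕ (Q ℕ.* N)) 1ℚ ⟩
        1ℚ + fromℕ (Q ℕ.* N)                                ≡⟨ fromℕ-suc (Q ℕ.* N) ⟨
        fromℕ (suc (Q ℕ.* N))                               ∎))
        where
        split : ∀ a b → a ≡ a * (1ℚ - b) + a * b
        split = solve-∀ ℚ-ring

  -- Under the uniform distribution at most one block value is missed on average.
  FewMissing : ℕ → ℕ → Set
  FewMissing m N = fromℕ (2 ℕ.^ m) * (1ℚ - ½ ^ℚ m) ^ℚ N ≤ 1ℚ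

  1-½^m : ∀ m M′ → 2 ℕ.^ m ≡ suc M′ → 1ℚ - ½ ^ℚ m ≡ ratio M′
  1-½^m m M′ eq = ratio-unique M′ (trans (cong (λ k → fromℕ k * (1ℚ - ½ ^ℚ m)) (sym eq))
    (trans (expand (fromℕ (2 ℕ.^ m)) (½ ^ℚ m)) (trans (cong₂ _-_ (trans (cong fromℕ eq) (fromℕ-suc M′)) (½^*2^ m)) (cancel (fromℕ M′)))))
    where
    expand : ∀ a b → a * (1ℚ - b) ≡ a - b * a
    expand = solve-∀ ℚ-ring
    cancel : ∀ a → 1ℚ + a - 1ℚ ≡ a
    cancel = solve-∀ ℚ-ring

  ≤½^m⇒FewMissing : ∀ m N → (1ℚ - ½ ^ℚ m) ^ℚ N ≤ ½ ^ℚ m → FewMissing m N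
  ≤½^m⇒FewMissing m N le = ≤-trans (*-monoˡ (0≤fromℕ (2 ℕ.^ m)) le)
    (≤-reflexive (trans (ℚ.*-comm _ (½ ^ℚ m)) (½^*2^ m)))

  ln2⇒FewMissing : ∀ m N → (2 ℕ.^ m ℕ.* m) ·ln2≤ N → FewMissing m N
  ln2⇒FewMissing m N upper with 2 ℕ.^ m in eq | ℕ.m^n>0 2 m
  ... | suc M′ | _ = subst (λ k → fromℕ k * (1ℚ - ½ ^ℚ m) ^ℚ N ≤ 1ℚ) eq
    (≤½^m⇒FewMissing m N (subst (λ s → s ^ℚ N ≤ ½ ^ℚ m) (sym (1-½^m m M′ eq)) (ratio^N≤½^m M′ m N upper)))

  -- No logarithm is involved: (1 + h)^M ≥ 2 by Bernoulli and (1 + h)(1 - h) ≤ 1 give (1 - h)^M ≤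
  -- 1/2, which is then raised to the power m.
  full⇒FewMissing : ∀ m → FewMissing m (2 ℕ.^ m ℕ.* m)
  full⇒FewMissing m = ≤½^m⇒FewMissing m (M ℕ.* m) (begin
    x ^ℚ (M ℕ.* m)     ≡⟨ trans (cong (x ^ℚ_) (ℕ.*-comm M m)) (^-* x m M) ⟩
    (x ^ℚ M) ^ℚ m      ≤⟨ ^-mono m (^-nonneg M 0≤x) x^M≤½ ⟩
    ½ ^ℚ m             ∎)
    where
    open ℚ.≤-Reasoning
    M = 2 ℕ.^ m
    h = ½ ^ℚ m
    x = 1ℚ - h
    0≤h : 0ℚ ≤ h
    0≤h = ½^n≥0 m
    h≤1 : h ≤ 1ℚ
    h≤1 = ^-≤1 m 0≤½ (p≤p+q ½ 0≤½)
    0≤x : 0ℚ ≤ x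
    0≤x = 0≤q-p h≤1
    double : ∀ h → 1ℚ - (0ℚ - h) ≡ 1ℚ + h
    double = solve-∀ ℚ-ring
    2≤ : fromℕ 2 ≤ (1ℚ + h) ^ℚ M
    2≤ = begin
      1ℚ + 1ℚ                         ≡⟨ cong (1ℚ +_) (trans (ℚ.*-comm (fromℕ M) h) (½^*2^ m)) ⟨
      1ℚ + fromℕ M * h                ≡⟨ negate (fromℕ M) h ⟩
      1ℚ - fromℕ M * (0ℚ - h)         ≤⟨ bernoulli {0ℚ - h} M (≤-trans (≤-by {0ℚ - h} {0ℚ} 0≤h (lem h)) 0≤1) ⟩
      (1ℚ - (0ℚ - h)) ^ℚ M            ≡⟨ cong (_^ℚ M) (double h) ⟩
      (1ℚ + h) ^ℚ M                   ∎
      where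
      negate : ∀ a h → 1ℚ + a * h ≡ 1ℚ - a * (0ℚ - h)
      negate = solve-∀ ℚ-ring
      lem : ∀ h → 0ℚ ≡ 0ℚ - h + h
      lem = solve-∀ ℚ-ring
    x^M≤½ : x ^ℚ M ≤ ½
    x^M≤½ = begin
      x ^ℚ M                            ≡⟨ halve (x ^ℚ M) ⟩
      ½ * (fromℕ 2 * x ^ℚ M)            ≤⟨ *-monoˡ 0≤½ (*-monoʳ (^-nonneg M 0≤x) 2≤) ⟩
      ½ * ((1ℚ + h) ^ℚ M * x ^ℚ M)      ≡⟨ cong (½ *_) (^-distrib-* (1ℚ + h) x M) ⟨
      ½ * ((1ℚ + h) * x) ^ℚ M
        ≤⟨ *-monoˡ 0≤½ (^-≤1 M ((0≤1 ⊕ 0≤h) ⊗ 0≤x) (≤-by {(1ℚ + h) * x} {1ℚ} {h * h} (0≤h ⊗ 0≤h) (square h))) ⟩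
      ½ * 1ℚ                            ≡⟨⟩
      ½                                 ∎
      where
      halve : ∀ a → a ≡ ½ * ((1ℚ + 1ℚ) * a)
      halve = solve-∀ ℚ-ring
      square : ∀ h → 1ℚ ≡ (1ℚ + h) * (1ℚ - h) + h * h
      square = solve-∀ ℚ-ring

  module Ceiling {m N : ℕ} (1≤m : 1 ℕ.≤ m) (ceil : N ≡⌈ 2 ℕ.^ m ℕ.* m ·ln2⌉) where
    open _≡⌈_·ln2⌉ ceil

    N≤Mm : N ℕ.≤ 2 ℕ.^ m ℕ.* m
    N≤Mm = least _ λ j → ≤-trans (*-monoˡ (0≤fromℕ (2 ℕ.^ m ℕ.* m)) (ln2-partial≤1 j)) (≤-reflexive (ℚ.*-identityʳ _))

    few : FewMissing m N
    few = ln2⇒FewMissing m N upper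

    -- ln 2 ≥ 5/8
    5Mm≤8N : 5 ℕ.* (2 ℕ.^ m ℕ.* m) ℕ.≤ 8 ℕ.* N
    5Mm≤8N = fromℕ-cancel-≤ (begin
      fromℕ (5 ℕ.* a)                         ≡⟨ fromℕ-* 5 a ⟩
      fromℕ 5 * fromℕ a                       ≡⟨ swap (fromℕ a) (fromℕ 8) (ln2-partial 2) ⟨
      fromℕ 8 * (fromℕ a * ln2-partial 2)     ≤⟨ *-monoˡ (0≤fromℕ 8) (upper 2) ⟩
      fromℕ 8 * fromℕ N                       ≡⟨ fromℕ-* 8 N ⟨
      fromℕ (8 ℕ.* N)                         ∎)
      where
      open ℚ.≤-Reasoning
      a = 2 ℕ.^ m ℕ.* m
      swap : ∀ a b c → b * (a * c) ≡ (b * c) * a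
      swap = solve-∀ ℚ-ring

    -- For m ≥ 2 this follows from 5m/8 ≥ 1. For m = 1 the estimate is only N ≥ 5/4, and integrality
    -- gives N ≥ 2.
    M≤N : 2 ℕ.^ m ℕ.≤ N
    M≤N = go m 1≤m 5Mm≤8N
      where
      go : ∀ m → 1 ℕ.≤ m → 5 ℕ.* (2 ℕ.^ m ℕ.* m) ℕ.≤ 8 ℕ.* N → 2 ℕ.^ m ℕ.≤ N
      go 1 _ le = ℕ.*-cancelˡ-< 8 1 N (ℕ.≤-trans (ℕ.n≤1+n 9) le)
      go (suc (suc k)) _ le = ℕ.*-cancelˡ-≤ 8 (ℕ.≤-trans (ℕ.≤-trans (ℕ.m≤n+m (8 ℕ.* M) (2 ℕ.* M)) (ℕ.≤-reflexive eq))
        (ℕ.≤-trans (ℕ.*-monoʳ-≤ 5 (ℕ.*-monoʳ-≤ M {2} {suc (suc k)} (ℕ.s≤s (ℕ.s≤s ℕ.z≤n)))) le))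
        where
        M = 2 ℕ.^ suc (suc k)
        eq : 2 ℕ.* M ℕ.+ 8 ℕ.* M ≡ 5 ℕ.* (M ℕ.* 2)
        eq = trans (sym (ℕ.*-distribʳ-+ M 2 8)) (trans (ℕ.*-assoc 5 2 M) (cong (5 ℕ.*_) (ℕ.*-comm 2 M)))

open Logarithm

-- The probability of surjectivity under the uniform distribution

module Occupation where

  open import Data.Rational.Base using (_+_; _*_; _-_; -_; _≤_; _<_; nonNegative; positive)
  open import Data.Rational.Properties using (≤-trans; ≤-refl; ≤-reflexive; _≤?_)
  open All using (All)
  open ListUnique using (Unique)

  -- Inclusion-exclusion cut after order t: the signed sum of products of a over the sublists of l
  -- of length at most t. The recursion splits them by whether they contain y.
  truncated : ∀ {A : Set} → ℕ → (A → ℚ) → List A → ℚ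
  truncated zero    a l       = 1ℚ
  truncated (suc t) a []      = 1ℚ
  truncated (suc t) a (y ∷ l) = truncated (suc t) a l - a y * truncated t a l

  none : ∀ {A : Set} → (A → ℚ) → List A → ℚ
  none a []      = 1ℚ
  none a (y ∷ l) = (1ℚ - a y) * none a l

  module _ {A : Set} {a : A → ℚ} (0≤a : ∀ y → 0ℚ ≤ a y) (a≤1 : ∀ y → a y ≤ 1ℚ) where

    private
      split : ∀ a p → (1ℚ - a) * p ≡ p - a * p
      split = solve-∀ ℚ-ring

    none-nonneg : ∀ l → 0ℚ ≤ none a l
    none-nonneg []      = 0≤1
    none-nonneg (y ∷ l) = 0≤q-p (a≤1 y) ⊗ none-nonneg l

    none≤1 : ∀ l → none a l ≤ 1ℚ
    none≤1 []      = ≤-refl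
    none≤1 (y ∷ l) = *-mono (0≤q-p (a≤1 y)) 0≤1 (≤-by (0≤a y) (restore (a y))) (none≤1 l)
      where
      restore : ∀ a → 1ℚ ≡ 1ℚ - a + a
      restore = solve-∀ ℚ-ring

    -- Bonferroni by alternation: `none` obeys the untruncated form of the same recursion, and
    -- multiplication by - a y turns a bound at order t into the opposite bound at order t + 1.
    lower⇒upper : ∀ t → (∀ l → truncated t a l ≤ none a l) → ∀ l → none a l ≤ truncated (suc t) a l
    lower⇒upper t lower []      = ≤-refl
    lower⇒upper t lower (y ∷ l) = ≤-trans (≤-reflexive (split (a y) (none a l)))
      (ℚ.+-mono-≤ (lower⇒upper t lower l) (ℚ.neg-antimono-≤ (*-monoˡ (0≤a y) (lower l))))

    upper⇒lower : ∀ t → (∀ l → none a l ≤ truncated t a l) → ∀ l → truncated (suc t) a l ≤ none a l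
    upper⇒lower t upper []      = ≤-refl
    upper⇒lower t upper (y ∷ l) = ≤-trans
      (ℚ.+-mono-≤ (upper⇒lower t upper l) (ℚ.neg-antimono-≤ (*-monoˡ (0≤a y) (upper l))))
      (≤-reflexive (sym (split (a y) (none a l))))

    bonferroni₃ : ∀ l → truncated 3 a l ≤ none a l
    bonferroni₃ = upper⇒lower 2 (lower⇒upper 1 (upper⇒lower 0 none≤1))

  none-zero : ∀ {A : Set} {a : A → ℚ} {y l} → y ∈ l → a y ≡ 1ℚ → none a l ≡ 0ℚ
  none-zero {a = a} {l = y ∷ l} (here refl) eq = trans (cong (λ s → (1ℚ - s) * none a l) eq) (ℚ.*-zeroˡ (none a l))
  none-zero {a = a} {l = z ∷ l} (there y∈l) eq = trans (cong ((1ℚ - a z) *_) (none-zero y∈l eq)) (ℚ.*-zeroʳ (1ℚ - a z))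

  funToFin-cong : ∀ m {n} {f g : Fin m → Fin n} → (∀ i → f i ≡ g i) → funToFin f ≡ funToFin g
  funToFin-cong zero    eq = refl
  funToFin-cong (suc m) eq = cong₂ combine (eq zero) (funToFin-cong m (eq ∘ suc))

  encode-cong : ∀ m {f g : Fin m → Bool} → (∀ i → f i ≡ g i) → encode f ≡ encode g
  encode-cong m eq = funToFin-cong m (λ i → cong (Inverse.from 2↔Bool) (eq i))

  decode : ∀ {m} → Fin (2 ℕ.^ m) → Bits m
  decode {m} y = Vec.tabulate λ j → Inverse.to 2↔Bool (finToFun {2} {m} y j)

  encode-decode : ∀ m (y : Fin (2 ℕ.^ m)) → encode (lookup (decode {m} y)) ≡ y
  encode-decode m y = trans (funToFin-cong m (λ j →
      trans (cong (Inverse.from 2↔Bool) (lookup∘tabulate _ j)) (Inverse.strictlyInverseʳ 2↔Bool (finToFun {2} {m} y j))))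
    (funToFin-finToFin {m} {2} y)

  decode-encode : ∀ {m} (b : Bits m) → decode (encode (lookup b)) ≡ b
  decode-encode {m} b = trans (tabulate-cong (λ j →
      trans (cong (Inverse.to 2↔Bool) (finToFun-funToFin (λ j → Inverse.from 2↔Bool (lookup b j)) j))
        (Inverse.strictlyInverseˡ 2↔Bool (lookup b j))))
    (tabulate∘lookup b)

  block≡ : ∀ N m X i → block N m X i ≡ encode (lookup (lookup (blocks N m X) i))
  block≡ N m X i = encode-cong m (λ j → sym (lookup-blocks N m X i j))

  Surjective : ∀ N m → Bits (N ℕ.* m) → Set
  Surjective N m X = ∀ y → ∃[ i ] block N m X i ≡ y

  surjective? : ∀ N m X → Dec (Surjective N m X)
  surjective? N m X = all? λ y → any? λ i → block N m X i ≟ᶠ y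

  fSurj-true : ∀ N m X → fSurj N m X ≡ true → ∀ y → ∃[ i ] lookup (blocks N m X) i ≡ y
  fSurj-true N m X eq y with subst (λ b → if b then Surjective N m X else ¬ Surjective N m X) eq (invert (proof (surjective? N m X))) (encode (lookup y))
  ... | i , hit = i , trans (sym (decode-encode _)) (trans (cong (decode {m}) (trans (sym (block≡ N m X i)) hit)) (decode-encode y))

  fSurj-false : ∀ N m X → fSurj N m X ≡ false → ∃[ y ] ∀ i → lookup (blocks N m X) i ≢ y
  fSurj-false N m X eq with ¬∀⟶∃¬ _ _ (λ y → any? λ i → block N m X i ≟ᶠ y)
      (subst (λ b → if b then Surjective N m X else ¬ Surjective N m X) eq (invert (proof (surjective? N m X))))
  ... | y , miss = decode y , λ i hit → miss (i , trans (block≡ N m X i) (trans (cong (encode ∘ lookup) hit) (encode-decode m y)))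

  -- Listed through `decode`, so that completeness, distinctness and length are inherited from
  -- `allFin`.
  allBits : ∀ m → List (Bits m)
  allBits m = List.map decode (allFin (2 ℕ.^ m))

  ∈-allBits : ∀ {m} (b : Bits m) → b ∈ allBits m
  ∈-allBits {m} b = subst (_∈ allBits m) (decode-encode b) (∈-map⁺ decode (∈-allFin _))

  allBits-unique : ∀ m → Unique (allBits m)
  allBits-unique m = Unique.map⁺ (λ {y} {z} eq → trans (sym (encode-decode m y)) (trans (cong (encode ∘ lookup) eq) (encode-decode m z)))
    (Unique.allFin⁺ (2 ℕ.^ m))

  length-allBits : ∀ m → length (allBits m) ≡ 2 ℕ.^ m
  length-allBits m = trans (List.length-map (decode {m}) (allFin (2 ℕ.^ m))) (List.length-tabulate {n = 2 ℕ.^ m} (λ i → i))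

  sixth : ℚ
  sixth = ℤ.+ 1 / 6

  module Occupancy (N m : ℕ) where

    private
      n = N ℕ.* m
      h = ½ ^ℚ m

    miss : Bits m → Bits m → ℚ
    miss y b = 1ℚ - δ y b

    missAll : List (Bits m) → Bits m → ℚ
    missAll []      b = 1ℚ
    missAll (y ∷ S) b = miss y b * missAll S b

    missed : Bits (N ℕ.* m) → Bits m → ℚ
    missed X y = ∏ (miss y) (blocks N m X)

    0≤miss : ∀ y b → 0ℚ ≤ miss y b
    0≤miss y b = 0≤q-p (δ-≤1 y b)

    miss≤1 : ∀ y b → miss y b ≤ 1ℚ
    miss≤1 y b = ≤-by (δ-nonneg y b) (restore (δ y b))
      where
      restore : ∀ a → 1ℚ ≡ 1ℚ - a + a
      restore = solve-∀ ℚ-ring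

    missAll-≢ : ∀ {S y} → All (y ≢_) S → missAll S y ≡ 1ℚ
    missAll-≢ []           = refl
    missAll-≢ (y≢z ∷ all) = cong₂ _*_ (cong (λ d → 1ℚ - d) (δ-≢ (y≢z ∘ sym))) (missAll-≢ all)

    ∑-missAll : ∀ {S} → Unique S → h * ∑ m (missAll S) ≡ 1ℚ - fromℕ (length S) * h
    ∑-missAll []                = trans (trans (sym (∑-*ˡ m h (λ _ → 1ℚ))) (∑-const m 1ℚ)) (zeros h)
      where
      zeros : ∀ h → 1ℚ ≡ 1ℚ - 0ℚ * h
      zeros = solve-∀ ℚ-ring
    ∑-missAll {y ∷ S} (new ∷ uniq) = begin
      h * ∑ m (λ b → (1ℚ - δ y b) * missAll S b)
        ≡⟨ cong (h *_) (trans (∑-cong m (λ b → split (δ y b) (missAll S b))) (∑-minus m _ _)) ⟩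
      h * (∑ m (missAll S) - ∑ m (λ b → δ y b * missAll S b))
        ≡⟨ cong (λ s → h * (∑ m (missAll S) - s)) (trans (∑-δ y (missAll S)) (missAll-≢ new)) ⟩
      h * (∑ m (missAll S) - 1ℚ)
        ≡⟨ distrib h _ ⟩
      h * ∑ m (missAll S) - h
        ≡⟨ cong (_- h) (∑-missAll uniq) ⟩
      (1ℚ - fromℕ (length S) * h) - h
        ≡⟨ collect (fromℕ (length S)) h ⟩
      1ℚ - (1ℚ + fromℕ (length S)) * h
        ≡⟨ cong (λ s → 1ℚ - s * h) (fromℕ-suc (length S)) ⟨
      1ℚ - fromℕ (length (y ∷ S)) * h ∎
      where
      open ≡-Reasoning
      split : ∀ d a → (1ℚ - d) * a ≡ a - d * a
      split = solve-∀ ℚ-ring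
      distrib : ∀ h s → h * (s - 1ℚ) ≡ h * s - h
      distrib = solve-∀ ℚ-ring
      collect : ∀ l h → (1ℚ - l * h) - h ≡ 1ℚ - (1ℚ + l) * h
      collect = solve-∀ ℚ-ring

    expectation : (Bits n → ℚ) → ℚ
    expectation g = ½ ^ℚ n * ∑ n g

    -- the probability that a given set of s block values is missed
    c : ℕ → ℚ
    c s = (1ℚ - fromℕ s * h) ^ℚ N

    expectation-missAll : ∀ {S} → Unique S → expectation (λ X → ∏ (missAll S) (blocks N m X)) ≡ c (length S)
    expectation-missAll {S} uniq = begin
      ½ ^ℚ n * ∑ n (λ X → ∏ (missAll S) (blocks N m X))   ≡⟨ cong₂ _*_ (^-* ½ N m) (∑-∏-blocks N m (missAll S)) ⟩
      h ^ℚ N * ∑ m (missAll S) ^ℚ N                       ≡⟨ ^-distrib-* h _ N ⟨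
      (h * ∑ m (missAll S)) ^ℚ N                          ≡⟨ cong (_^ℚ N) (∑-missAll uniq) ⟩
      c (length S)                                        ∎
      where open ≡-Reasoning

    -- The expectation of `truncated t` over L further values, on the event that s given values are
    -- missed. By symmetry only the sizes of the sets matter.
    G : ℕ → ℕ → ℕ → ℚ
    G zero    s L       = c s
    G (suc t) s zero    = c s
    G (suc t) s (suc L) = G (suc t) s L - G t (suc s) L

    -- The set S is general because the subtracted branch carries the factor `missed X y`, which
    -- absorbs y into S. Freshness of l keeps S duplicate-free, so its length is the number of
    -- missed values.
    expectation-truncated : ∀ t {S l} → Unique S → Unique l → All (λ y → All (y ≢_) S) l →
      expectation (λ X → ∏ (missAll S) (blocks N m X) * truncated t (missed X) l) ≡ G t (length S) (length l)
    expectation-truncated zero uS ul fresh =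
      trans (cong (½ ^ℚ n *_) (∑-cong n (λ X → ℚ.*-identityʳ _))) (expectation-missAll uS)
    expectation-truncated (suc t) {l = []} uS ul fresh =
      trans (cong (½ ^ℚ n *_) (∑-cong n (λ X → ℚ.*-identityʳ _))) (expectation-missAll uS)
    expectation-truncated (suc t) {S} {y ∷ l} uS (new ∷ ul) (y∉S ∷ fresh) = begin
      expectation (λ X → A S X * (T X - missed X y * U X))
        ≡⟨ cong (½ ^ℚ n *_) (∑-cong n (λ X → trans (split (A S X) (T X) (missed X y) (U X))
             (cong (λ s → A S X * T X - s * U X) (sym (∏-* (miss y) (missAll S) (blocks N m X)))))) ⟩
      expectation (λ X → A S X * T X - A (y ∷ S) X * U X)
        ≡⟨ trans (cong (½ ^ℚ n *_) (∑-minus n _ _)) (distrib (½ ^ℚ n) _ _) ⟩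
      expectation (λ X → A S X * T X) - expectation (λ X → A (y ∷ S) X * U X)
        ≡⟨ cong₂ _-_ (expectation-truncated (suc t) uS ul fresh)
             (expectation-truncated t (y∉S ∷ uS) ul (All.zipWith (λ (y≢z , z∉S) → (y≢z ∘ sym) ∷ z∉S) (new , fresh))) ⟩
      G (suc t) (length S) (suc (length l)) ∎
      where
      open ≡-Reasoning
      A : List (Bits m) → Bits n → ℚ
      A S X = ∏ (missAll S) (blocks N m X)
      T U : Bits n → ℚ
      T X = truncated (suc t) (missed X) l
      U X = truncated t (missed X) l
      split : ∀ a t y u → a * (t - y * u) ≡ a * t - (y * a) * u
      split = solve-∀ ℚ-ring
      distrib : ∀ p a b → p * (a - b) ≡ p * a - p * b
      distrib = solve-∀ ℚ-ring

    -- The recursion solved order by order: up to sign, the coefficients of c in the closed forms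
    -- count the singletons, pairs and triples among L values.
    G₁ : ∀ s L → G 1 s L ≡ c s - fromℕ L * c (suc s)
    G₁ s zero    = lem (c s) (c (suc s))
      where
      lem : ∀ a b → a ≡ a - 0ℚ * b
      lem = solve-∀ ℚ-ring
    G₁ s (suc L) rewrite fromℕ-suc L = trans (cong (_- c (suc s)) (G₁ s L)) (lem (c s) (c (suc s)) (fromℕ L))
      where
      lem : ∀ a b l → (a - l * b) - b ≡ a - (1ℚ + l) * b
      lem = solve-∀ ℚ-ring

    G₂ : ∀ s L → G 2 s L ≡ c s - fromℕ L * c (suc s) + ½ * (fromℕ L * (fromℕ L - 1ℚ) * c (2 ℕ.+ s))
    G₂ s zero    = lem (c s) (c (suc s)) (c (2 ℕ.+ s))
      where
      lem : ∀ a b c → a ≡ a - 0ℚ * b + ½ * (0ℚ * (0ℚ - 1ℚ) * c)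
      lem = solve-∀ ℚ-ring
    G₂ s (suc L) rewrite fromℕ-suc L =
      trans (cong₂ _-_ (G₂ s L) (G₁ (suc s) L)) (lem (c s) (c (suc s)) (c (2 ℕ.+ s)) (fromℕ L))
      where
      lem : ∀ a b c l → (a - l * b + ½ * (l * (l - 1ℚ) * c)) - (b - l * c)
        ≡ a - (1ℚ + l) * b + ½ * ((1ℚ + l) * ((1ℚ + l) - 1ℚ) * c)
      lem = solve-∀ ℚ-ring

    G₃ : ∀ s L → G 3 s L ≡ c s - fromℕ L * c (suc s) + ½ * (fromℕ L * (fromℕ L - 1ℚ) * c (2 ℕ.+ s))
      - sixth * (fromℕ L * (fromℕ L - 1ℚ) * (fromℕ L - (1ℚ + 1ℚ)) * c (3 ℕ.+ s))
    G₃ s zero    = lem (c s) (c (suc s)) (c (2 ℕ.+ s)) (c (3 ℕ.+ s))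
      where
      lem : ∀ a b c d → a ≡ a - 0ℚ * b + ½ * (0ℚ * (0ℚ - 1ℚ) * c) - sixth * (0ℚ * (0ℚ - 1ℚ) * (0ℚ - (1ℚ + 1ℚ)) * d)
      lem = solve-∀ ℚ-ring
    G₃ s (suc L) rewrite fromℕ-suc L =
      trans (cong₂ _-_ (G₃ s L) (G₂ (suc s) L)) (lem (c s) (c (suc s)) (c (2 ℕ.+ s)) (c (3 ℕ.+ s)) (fromℕ L))
      where
      lem : ∀ a b c d l → (a - l * b + ½ * (l * (l - 1ℚ) * c) - sixth * (l * (l - 1ℚ) * (l - (1ℚ + 1ℚ)) * d))
         - (b - l * c + ½ * (l * (l - 1ℚ) * d))
        ≡ a - (1ℚ + l) * b + ½ * ((1ℚ + l) * ((1ℚ + l) - 1ℚ) * c)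
          - sixth * ((1ℚ + l) * ((1ℚ + l) - 1ℚ) * ((1ℚ + l) - (1ℚ + 1ℚ)) * d)
      lem = solve-∀ ℚ-ring

    -- A missed value annihilates its own factor of `none`; on surjective inputs `none` ≤ 1 is
    -- enough.
    none≤fSurj : ∀ X → none (missed X) (allBits m) ≤ ⟨ fSurj N m X ⟩
    none≤fSurj X with fSurj N m X in eq
    ... | true  = none≤1 (λ y → ∏-nonneg (0≤miss y) (blocks N m X)) (λ y → ∏-≤1 (0≤miss y) (miss≤1 y) (blocks N m X)) (allBits m)
    ... | false with fSurj-false N m X eq
    ...   | y , absent = ≤-reflexive (none-zero (∈-allBits y)
      (∏-one (blocks N m X) (λ i → cong (λ d → 1ℚ - d) (δ-≢ (absent i ∘ sym)))))

    Pr-fSurj-lower : G 3 0 (2 ℕ.^ m) ≤ Pr (𝒰 n) (fSurj N m)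
    Pr-fSurj-lower = begin
      G 3 0 (2 ℕ.^ m)                                             ≡⟨ cong (G 3 0) (length-allBits m) ⟨
      G 3 0 (length (allBits m))
        ≡⟨ expectation-truncated 3 [] (allBits-unique m) (All.tabulate (λ _ → [])) ⟨
      expectation (λ X → ∏ (missAll []) (blocks N m X) * truncated 3 (missed X) (allBits m))
        ≡⟨ cong (½ ^ℚ n *_) (∑-cong n (λ X → trans (cong (_* truncated 3 (missed X) (allBits m)) (∏-one {g = missAll []} (blocks N m X) (λ _ → refl))) (ℚ.*-identityˡ _))) ⟩
      expectation (λ X → truncated 3 (missed X) (allBits m))
        ≤⟨ *-monoˡ (½^n≥0 n) (∑-mono n (λ X → ≤-trans (bonferroni₃ (λ y → ∏-nonneg (0≤miss y) (blocks N m X)) (λ y → ∏-≤1 (0≤miss y) (miss≤1 y) (blocks N m X)) (allBits m)) (none≤fSurj X))) ⟩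
      ½ ^ℚ n * ∑ n (λ X → ⟨ fSurj N m X ⟩)
        ≡⟨ trans (ℚ.*-comm (½ ^ℚ n) _) (sym (∑-*ʳ n (½ ^ℚ n) (λ X → ⟨ fSurj N m X ⟩))) ⟩
      ∑ n (λ X → ⟨ fSurj N m X ⟩ * ½ ^ℚ n)                        ≡⟨ Pr-⟨⟩ (𝒰 n) (fSurj N m) ⟨
      Pr (𝒰 n) (fSurj N m)                                        ∎
      where open ℚ.≤-Reasoning

  -- 4/9 is a round value below 1 - 1/8 - 3/7 = 25/56, the relative size of the pair term for M ≥ 8.
  -- 1/18 = 1/2 · 4/9 - 1/6 is the value of the resulting bound in its worst case s = 1.
  4/9ℚ 1/18ℚ : ℚ
  4/9ℚ = ℤ.+ 4 / 9
  1/18ℚ = ℤ.+ 1 / 18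

  -- Amounts to m / (M - 1) ≤ 3/7, with equality at m = 3.
  7m≤3[2^m-1] : ∀ j → 7 ℕ.* (3 ℕ.+ j) ℕ.+ 3 ℕ.≤ 3 ℕ.* 2 ℕ.^ (3 ℕ.+ j)
  7m≤3[2^m-1] zero    = ℕ.≤-refl
  7m≤3[2^m-1] (suc j) = begin
    7 ℕ.* (4 ℕ.+ j) ℕ.+ 3                              ≡⟨ cong (ℕ._+ 3) (ℕ.*-suc 7 (3 ℕ.+ j)) ⟩
    7 ℕ.+ 7 ℕ.* (3 ℕ.+ j) ℕ.+ 3                        ≡⟨ ℕ.+-assoc 7 (7 ℕ.* (3 ℕ.+ j)) 3 ⟩
    7 ℕ.+ (7 ℕ.* (3 ℕ.+ j) ℕ.+ 3)
      ≤⟨ ℕ.+-mono-≤ (ℕ.≤-trans (ℕ.m≤m+n 7 17) (ℕ.*-monoʳ-≤ 3 (ℕ.^-monoʳ-≤ 2 (ℕ.m≤m+n 3 j)))) (7m≤3[2^m-1] j) ⟩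
    3 ℕ.* P ℕ.+ 3 ℕ.* P                                ≡⟨ ℕ.*-distribˡ-+ 3 P P ⟨
    3 ℕ.* (P ℕ.+ P)                                    ≡⟨ cong (λ s → 3 ℕ.* (P ℕ.+ s)) (ℕ.+-identityʳ P) ⟨
    3 ℕ.* 2 ℕ.^ (4 ℕ.+ j)                              ∎
    where
    open ℕ.≤-Reasoning
    P = 2 ℕ.^ (3 ℕ.+ j)

  module _ (j N : ℕ) (few : FewMissing (3 ℕ.+ j) N) (N≤Mm : N ℕ.≤ 2 ℕ.^ (3 ℕ.+ j) ℕ.* (3 ℕ.+ j))
           (r : ℚ) (0≤r : 0ℚ ≤ r) (r-inv : r * (1ℚ - ½ ^ℚ (3 ℕ.+ j)) ≡ 1ℚ) where

    private
      m = 3 ℕ.+ j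
      h = ½ ^ℚ m
      ℓ = fromℕ (2 ℕ.^ m)
      open Occupancy N m

      0≤h : 0ℚ ≤ h
      0≤h = ½^n≥0 m

      h≤⅛ : h ≤ ½ ^ℚ 3
      h≤⅛ = ^-antimono {½} {3} {m} 0≤½ (p≤p+q ½ 0≤½) (ℕ.m≤m+n 3 j)

      0≤1-3h : 0ℚ ≤ 1ℚ - fromℕ 3 * h
      0≤1-3h = 0≤q-p (≤-trans (*-monoˡ (0≤fromℕ 3) h≤⅛) (from-yes (fromℕ 3 * ½ ^ℚ 3 ≤? 1ℚ)))

      0≤ℓ : 0ℚ ≤ ℓ
      0≤ℓ = 0≤fromℕ (2 ℕ.^ m)

      hℓ : h * ℓ ≡ 1ℚ
      hℓ = ½^*2^ m

      0≤1-h : 0ℚ ≤ 1ℚ - h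
      0≤1-h = 0≤q-p (≤-trans h≤⅛ (from-yes (½ ^ℚ 3 ≤? 1ℚ)))

      2≤ℓ : 0ℚ ≤ ℓ - (1ℚ + 1ℚ)
      2≤ℓ = 0≤q-p (fromℕ-mono-≤ {2} {2 ℕ.^ m} (ℕ.≤-trans (ℕ.m≤m+n 2 6) (ℕ.^-monoʳ-≤ 2 (ℕ.m≤m+n 3 j))))

      e s : ℚ
      e = (1ℚ - h) ^ℚ N
      s = ℓ * e

      0≤e : 0ℚ ≤ e
      0≤e = ^-nonneg N 0≤1-h

      0≤s : 0ℚ ≤ s
      0≤s = 0≤ℓ ⊗ 0≤e

      s≤1 : s ≤ 1ℚ
      s≤1 = few

      c₀ : c 0 ≡ 1ℚ
      c₀ = trans (cong (_^ℚ N) (lem h)) (1^ N)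
        where
        lem : ∀ h → 1ℚ - 0ℚ * h ≡ 1ℚ
        lem = solve-∀ ℚ-ring

      c₁ : c 1 ≡ e
      c₁ = cong (λ x → (1ℚ - x) ^ℚ N) (ℚ.*-identityˡ h)

      mhr : fromℕ m * h * r ≤ ℤ.+ 3 / 7
      mhr = *-cancelˡ-≤ (fromℕ 7) (0<fromℕ-suc 6) (begin
        fromℕ 7 * (fromℕ m * h * r)                       ≡⟨ regroup (fromℕ 7) (fromℕ m) h r ⟩
        (fromℕ 7 * fromℕ m + fromℕ 3 - fromℕ 3) * h * r   ≤⟨ *-monoʳ 0≤r (*-monoʳ 0≤h (ℚ.+-monoˡ-≤ (- fromℕ 3) le)) ⟩
        (fromℕ 3 * ℓ - fromℕ 3) * h * r                   ≡⟨ factor ℓ h r ⟩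
        fromℕ 3 * (r * (h * ℓ - h))                       ≡⟨ cong (λ x → fromℕ 3 * (r * (x - h))) hℓ ⟩
        fromℕ 3 * (r * (1ℚ - h))                          ≡⟨ cong (fromℕ 3 *_) r-inv ⟩
        fromℕ 3 * 1ℚ                                      ≡⟨⟩
        fromℕ 7 * (ℤ.+ 3 / 7)                             ∎)
        where
        open ℚ.≤-Reasoning
        regroup : ∀ a b h r → a * (b * h * r) ≡ (a * b + fromℕ 3 - fromℕ 3) * h * r
        regroup = solve-∀ ℚ-ring
        factor : ∀ l h r → (fromℕ 3 * l - fromℕ 3) * h * r ≡ fromℕ 3 * (r * (h * l - h))
        factor = solve-∀ ℚ-ring
        le : fromℕ 7 * fromℕ m + fromℕ 3 ≤ fromℕ 3 * ℓ
        le = subst₂ _≤_ (trans (fromℕ-+ (7 ℕ.* m) 3) (cong (_+ fromℕ 3) (fromℕ-* 7 m))) (fromℕ-* 3 (2 ℕ.^ m))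
          (fromℕ-mono-≤ (7m≤3[2^m-1] j))

      Nh≤m : fromℕ N * h ≤ fromℕ m
      Nh≤m = begin
        fromℕ N * h                 ≤⟨ *-monoʳ 0≤h (fromℕ-mono-≤ N≤Mm) ⟩
        fromℕ (2 ℕ.^ m ℕ.* m) * h   ≡⟨ cong (_* h) (fromℕ-* (2 ℕ.^ m) m) ⟩
        ℓ * fromℕ m * h             ≡⟨ swap ℓ (fromℕ m) h ⟩
        h * ℓ * fromℕ m             ≡⟨ trans (cong (_* fromℕ m) hℓ) (ℚ.*-identityˡ (fromℕ m)) ⟩
        fromℕ m                     ∎
        where
        open ℚ.≤-Reasoning
        swap : ∀ a b c → a * b * c ≡ c * a * b
        swap = solve-∀ ℚ-ring

      -- z = 1 / (M - 1)², and (1 - 2h) / (1 - h)² = 1 - z. So missing two given values is almost as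
      -- likely as under independence: Bernoulli bounds the loss by N z.
      z : ℚ
      z = h * r * (h * r)

      1-2h : 1ℚ - fromℕ 2 * h ≡ (1ℚ - h) * (1ℚ - h) * (1ℚ - z)
      1-2h = begin
        1ℚ - fromℕ 2 * h                                                              ≡⟨ lem₁ h ⟩
        (1ℚ - h) * (1ℚ - h) - h * h * (1ℚ * 1ℚ)
          ≡⟨ cong (λ x → (1ℚ - h) * (1ℚ - h) - h * h * (x * x)) r-inv ⟨
        (1ℚ - h) * (1ℚ - h) - h * h * (r * (1ℚ - h) * (r * (1ℚ - h)))                 ≡⟨ lem₂ h r ⟩
        (1ℚ - h) * (1ℚ - h) * (1ℚ - z)                                                ∎
        where
        open ≡-Reasoning
        lem₁ : ∀ h → 1ℚ - (1ℚ + 1ℚ) * h ≡ (1ℚ - h) * (1ℚ - h) - h * h * (1ℚ * 1ℚ)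
        lem₁ = solve-∀ ℚ-ring
        lem₂ : ∀ h r → (1ℚ - h) * (1ℚ - h) - h * h * (r * (1ℚ - h) * (r * (1ℚ - h)))
          ≡ (1ℚ - h) * (1ℚ - h) * (1ℚ - h * r * (h * r))
        lem₂ = solve-∀ ℚ-ring

      hr≤1 : h * r ≤ 1ℚ
      hr≤1 = begin
        h * r                  ≡⟨ ℚ.*-identityˡ (h * r) ⟨
        1ℚ * (h * r)           ≤⟨ *-monoʳ (0≤h ⊗ 0≤r) (fromℕ-mono-≤ {1} {m} (ℕ.s≤s ℕ.z≤n)) ⟩
        fromℕ m * (h * r)      ≡⟨ ℚ.*-assoc (fromℕ m) h r ⟨
        fromℕ m * h * r        ≤⟨ mhr ⟩
        ℤ.+ 3 / 7              ≤⟨ from-yes (ℤ.+ 3 / 7 ≤? 1ℚ) ⟩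
        1ℚ                     ∎
        where open ℚ.≤-Reasoning

      c₂ : e * e * (1ℚ - fromℕ N * z) ≤ c 2
      c₂ = begin
        e * e * (1ℚ - fromℕ N * z)
          ≤⟨ *-monoˡ (0≤e ⊗ 0≤e) (bernoulli N (*-mono (0≤h ⊗ 0≤r) 0≤1 hr≤1 hr≤1)) ⟩
        e * e * (1ℚ - z) ^ℚ N                          ≡⟨ cong (_* (1ℚ - z) ^ℚ N) (^-distrib-* (1ℚ - h) (1ℚ - h) N) ⟨
        ((1ℚ - h) * (1ℚ - h)) ^ℚ N * (1ℚ - z) ^ℚ N     ≡⟨ ^-distrib-* ((1ℚ - h) * (1ℚ - h)) (1ℚ - z) N ⟨
        ((1ℚ - h) * (1ℚ - h) * (1ℚ - z)) ^ℚ N          ≡⟨ cong (_^ℚ N) 1-2h ⟨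
        c 2                                            ∎
        where open ℚ.≤-Reasoning

      c₃ : c 3 ≤ e * (e * e)
      c₃ = begin
        c 3                                            ≤⟨ ^-mono N 0≤1-3h (≤-by (0≤h ⊗ 0≤h ⊗ (0≤1 ⊕ 0≤1 ⊕ 0≤1-h)) (cube h)) ⟩
        ((1ℚ - h) * ((1ℚ - h) * (1ℚ - h))) ^ℚ N
          ≡⟨ trans (^-distrib-* (1ℚ - h) _ N) (cong (e *_) (^-distrib-* (1ℚ - h) (1ℚ - h) N)) ⟩
        e * (e * e)                                    ∎
        where
        open ℚ.≤-Reasoning
        cube : ∀ h → (1ℚ - h) * ((1ℚ - h) * (1ℚ - h)) ≡ 1ℚ - (1ℚ + 1ℚ + 1ℚ) * h + h * h * (1ℚ + 1ℚ + (1ℚ - h))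
        cube = solve-∀ ℚ-ring

      -- The factor 1 - h = (ℓ - 1) / ℓ comes from counting ordered pairs. It also cancels one r of
      -- z, and what remains is N h · h r ≤ m h r ≤ 3/7.
      correction : 4/9ℚ ≤ (1ℚ - h) * (1ℚ - fromℕ N * z)
      correction = begin
        4/9ℚ                                           ≤⟨ from-yes (4/9ℚ ≤? 1ℚ - ½ ^ℚ 3 - (ℤ.+ 3 / 7)) ⟩
        1ℚ - ½ ^ℚ 3 - (ℤ.+ 3 / 7)
          ≤⟨ ℚ.+-mono-≤ (ℚ.+-monoʳ-≤ 1ℚ (ℚ.neg-antimono-≤ h≤⅛)) (ℚ.neg-antimono-≤ le) ⟩
        1ℚ - h - fromℕ N * h * (h * r) * 1ℚ            ≡⟨ cong (λ x → 1ℚ - h - fromℕ N * h * (h * r) * x) r-inv ⟨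
        1ℚ - h - fromℕ N * h * (h * r) * (r * (1ℚ - h)) ≡⟨ regroup h (fromℕ N) r ⟩
        (1ℚ - h) * (1ℚ - fromℕ N * z)                  ∎
        where
        open ℚ.≤-Reasoning
        le : fromℕ N * h * (h * r) * 1ℚ ≤ ℤ.+ 3 / 7
        le = begin
          fromℕ N * h * (h * r) * 1ℚ    ≡⟨ ℚ.*-identityʳ _ ⟩
          fromℕ N * h * (h * r)         ≤⟨ *-monoʳ (0≤h ⊗ 0≤r) Nh≤m ⟩
          fromℕ m * (h * r)             ≡⟨ ℚ.*-assoc (fromℕ m) h r ⟨
          fromℕ m * h * r               ≤⟨ mhr ⟩
          ℤ.+ 3 / 7                     ∎
        regroup : ∀ h n r → 1ℚ - h - n * h * (h * r) * (r * (1ℚ - h)) ≡ (1ℚ - h) * (1ℚ - n * (h * r * (h * r)))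
        regroup = solve-∀ ℚ-ring

      0≤ℓ-1 : 0ℚ ≤ ℓ - 1ℚ
      0≤ℓ-1 = subst (0ℚ ≤_) (lem ℓ) (2≤ℓ ⊕ 0≤1)
        where
        lem : ∀ l → l - (1ℚ + 1ℚ) + 1ℚ ≡ l - 1ℚ
        lem = solve-∀ ℚ-ring

      second : s * s * 4/9ℚ ≤ ℓ * (ℓ - 1ℚ) * c 2
      second = begin
        s * s * 4/9ℚ                                       ≤⟨ *-monoˡ (0≤s ⊗ 0≤s) correction ⟩
        s * s * ((1ℚ - h) * (1ℚ - fromℕ N * z))            ≡⟨ regroup ℓ e h (1ℚ - fromℕ N * z) ⟩
        ℓ * (ℓ - h * ℓ) * (e * e * (1ℚ - fromℕ N * z))     ≡⟨ cong (λ x → ℓ * (ℓ - x) * (e * e * (1ℚ - fromℕ N * z))) hℓ ⟩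
        ℓ * (ℓ - 1ℚ) * (e * e * (1ℚ - fromℕ N * z))        ≤⟨ *-monoˡ (0≤ℓ ⊗ 0≤ℓ-1) c₂ ⟩
        ℓ * (ℓ - 1ℚ) * c 2                                 ∎
        where
        open ℚ.≤-Reasoning
        regroup : ∀ l e h w → l * e * (l * e) * ((1ℚ - h) * w) ≡ l * (l - h * l) * (e * e * w)
        regroup = solve-∀ ℚ-ring

      third : ℓ * (ℓ - 1ℚ) * (ℓ - (1ℚ + 1ℚ)) * c 3 ≤ s * s
      third = begin
        ℓ * (ℓ - 1ℚ) * (ℓ - (1ℚ + 1ℚ)) * c 3              ≤⟨ *-monoˡ (0≤ℓ ⊗ 0≤ℓ-1 ⊗ 2≤ℓ) c₃ ⟩
        ℓ * (ℓ - 1ℚ) * (ℓ - (1ℚ + 1ℚ)) * (e * (e * e))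
          ≤⟨ *-monoʳ (0≤e ⊗ (0≤e ⊗ 0≤e)) (*-mono (0≤ℓ ⊗ 0≤ℓ-1) 0≤ℓ (*-monoˡ 0≤ℓ (≤-by {ℓ - 1ℚ} {ℓ} 0≤1 (lem₁ ℓ))) (≤-by {ℓ - (1ℚ + 1ℚ)} {ℓ} (0≤1 ⊕ 0≤1) (lem₂ ℓ))) ⟩
        ℓ * ℓ * ℓ * (e * (e * e))                         ≡⟨ regroup ℓ e ⟩
        -- With s ≤ 1 the cubic term is absorbed into s², so the final bound is a quadratic in s.
        s * s * s                                         ≤⟨ *-monoˡ (0≤s ⊗ 0≤s) s≤1 ⟩
        s * s * 1ℚ                                        ≡⟨ ℚ.*-identityʳ _ ⟩
        s * s                                             ∎
        where
        open ℚ.≤-Reasoning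
        lem₁ : ∀ l → l ≡ l - 1ℚ + 1ℚ
        lem₁ = solve-∀ ℚ-ring
        lem₂ : ∀ l → l ≡ l - (1ℚ + 1ℚ) + (1ℚ + 1ℚ)
        lem₂ = solve-∀ ℚ-ring
        regroup : ∀ l e → l * l * l * (e * (e * e)) ≡ l * e * (l * e) * (l * e)
        regroup = solve-∀ ℚ-ring

    surjective-probability : 1/18ℚ ≤ Pr (𝒰 (N ℕ.* m)) (fSurj N m)
    surjective-probability = begin
      -- Expanded in powers of 1 - s, the quadratic has nonnegative coefficients and constant term
      -- 1/18.
      1/18ℚ
        ≤⟨ ≤-by (0≤q-p s≤1 ⊗ (from-yes (0ℚ ≤? (ℤ.+ 16 / 18)) ⊕ from-yes (0ℚ ≤? 1/18ℚ) ⊗ 0≤q-p s≤1)) (final s) ⟩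
      1ℚ - s + ½ * (s * s * 4/9ℚ) - sixth * (s * s)
        ≤⟨ ℚ.+-mono-≤ (ℚ.+-monoʳ-≤ (1ℚ - s) (*-monoˡ 0≤½ second)) (ℚ.neg-antimono-≤ (*-monoˡ (from-yes (0ℚ ≤? sixth)) third)) ⟩
      1ℚ - s + ½ * (ℓ * (ℓ - 1ℚ) * c 2) - sixth * (ℓ * (ℓ - 1ℚ) * (ℓ - (1ℚ + 1ℚ)) * c 3)
        ≡⟨ cong₂ (λ a b → a - ℓ * b + ½ * (ℓ * (ℓ - 1ℚ) * c 2) - sixth * (ℓ * (ℓ - 1ℚ) * (ℓ - (1ℚ + 1ℚ)) * c 3)) c₀ c₁ ⟨
      c 0 - ℓ * c 1 + ½ * (ℓ * (ℓ - 1ℚ) * c 2) - sixth * (ℓ * (ℓ - 1ℚ) * (ℓ - (1ℚ + 1ℚ)) * c 3)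
        ≡⟨ G₃ 0 (2 ℕ.^ m) ⟨
      G 3 0 (2 ℕ.^ m)
        ≤⟨ Pr-fSurj-lower ⟩
      Pr (𝒰 (N ℕ.* m)) (fSurj N m) ∎
      where
      open ℚ.≤-Reasoning
      final : ∀ s → 1ℚ - s + ½ * (s * s * 4/9ℚ) - sixth * (s * s)
        ≡ 1/18ℚ + (1ℚ - s) * ((ℤ.+ 16 / 18) + 1/18ℚ * (1ℚ - s))
      final = solve-∀ ℚ-ring

open Occupation

open import Data.Nat.Base using (_≤_; _*_; _^_)

-- A depth-3 circuit for surjectivity

reflects-map : ∀ {P Q : Set} {b} → (P → Q) → (Q → P) → Reflects P b → Reflects Q b
reflects-map {b = b} f g r = proof (map′ f g (b because r))

reflects-and : ∀ k {P : Fin k → Set} {p : Fin k → Bool} → (∀ i → Reflects (P i) (p i)) →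
  Reflects (∀ i → P i) (and (List.tabulate p))
reflects-and zero    r = ofʸ λ ()
reflects-and (suc k) {P} r = reflects-map
  (λ { (h , t) zero → h ; (h , t) (suc i) → t i }) (λ f → f zero , f ∘ suc)
  (proof ((_ because r zero) ×-dec (_ because reflects-and k (r ∘ suc))))

reflects-or : ∀ k {P : Fin k → Set} {p : Fin k → Bool} → (∀ i → Reflects (P i) (p i)) →
  Reflects (∃[ i ] P i) (or (List.tabulate p))
reflects-or zero    r = ofⁿ λ ()
reflects-or (suc k) r = reflects-map
  (λ { (inj₁ h) → zero , h ; (inj₂ (i , t)) → suc i , t }) (λ { (zero , h) → inj₁ h ; (suc i , t) → inj₂ (i , t) })
  (proof ((_ because r zero) ⊎-dec (_ because reflects-or k (r ∘ suc))))

maxFanIn-tabulate : ∀ {w w′ a} {not : ℕ} {negs : Vec (Fin w) not} (f : Fin w′ → List (Fin (w ℕ.+ not))) →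
  (∀ g → length (f g) ≤ a) → maxFanIn (record { negated = negs ; gates = tabulate f }) ≤ a
maxFanIn-tabulate {w′ = zero}   f le = z≤n
maxFanIn-tabulate {w′ = suc w′} {negs = negs} f le =
  ℕ.⊔-lub (le zero) (maxFanIn-tabulate {negs = negs} (f ∘ suc) (le ∘ suc))

-- AND over the values y, OR over the blocks i, AND over the m bits that compare block i with y. The
-- bottom fanin is thus at most m, and m ≤ log₂ n because M ≤ n.
module SurjCircuit (N m : ℕ) where

  private
    n = N * m
    M = 2 ^ m

  -- The bottom layer negates all inputs in order, so wire n + i carries 1 - xᵢ.
  literalWire : Bool → Fin n → Fin (n ℕ.+ n)
  literalWire true  i = i ↑ˡ n
  literalWire false i = n ↑ʳ i

  blockGate : Fin M → Fin N → List (Fin (n ℕ.+ n))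
  blockGate y i = List.tabulate λ j → literalWire (lookup (decode {m} y) j) (combine i j)

  bottom : Layer n (M * N)
  bottom .nots    = n
  bottom .negated = Vec.allFin n
  bottom .gates   = tabulate (uncurry blockGate ∘ remQuot N)

  middle : Layer (M * N) M
  middle .nots    = 0
  middle .negated = []
  middle .gates   = tabulate λ y → List.tabulate {n = N} λ i → combine y i ↑ˡ 0

  topLayer : Layer M 1
  topLayer .nots    = 0
  topLayer .negated = []
  topLayer .gates   = List.tabulate {n = M} (_↑ˡ 0) ∷ []

  circuit : Circuit n
  circuit .top    = AND
  circuit .depth  = 3
  circuit .layers = layer (layer (layer inputs bottom) middle) topLayer

  module _ (X : Bits n) where

    private
      W₁ = evalLayer AND bottom X
      W₂ = evalLayer OR middle W₁
      wires = X ++ Vec.map (not ∘ lookup X) (Vec.allFin n)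

    reflects-literal : ∀ s i → Reflects (lookup X i ≡ s) (lookup wires (literalWire s i))
    reflects-literal true i rewrite lookup-++ˡ X (Vec.map (not ∘ lookup X) (Vec.allFin n)) i with lookup X i
    ... | true  = ofʸ refl
    ... | false = ofⁿ λ ()
    reflects-literal false i rewrite lookup-++ʳ X (Vec.map (not ∘ lookup X) (Vec.allFin n)) i
      | lookup-map i (not ∘ lookup X) (Vec.allFin n) | lookup-allFin i with lookup X i
    ... | true  = ofⁿ λ ()
    ... | false = ofʸ refl

    reflects-block : ∀ y i → Reflects (block N m X i ≡ y) (lookup W₁ (combine y i))
    reflects-block y i = subst (Reflects (block N m X i ≡ y)) (sym value)
      (reflects-map to from (reflects-and m (λ j → reflects-literal (lookup (decode {m} y) j) (combine i j))))
      where
      value : lookup W₁ (combine y i) ≡ and (List.tabulate λ j → lookup wires (literalWire (lookup (decode {m} y) j) (combine i j)))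
      value = trans (lookup-map (combine y i) _ (gates bottom))
        (cong and (trans (cong (List.map (lookup wires)) (trans (lookup∘tabulate (uncurry blockGate ∘ remQuot N) (combine y i)) (cong (uncurry blockGate) (remQuot-combine {M} {N} y i))))
          (List.map-tabulate _ (lookup wires))))
      to : (∀ j → lookup X (combine i j) ≡ lookup (decode {m} y) j) → block N m X i ≡ y
      to eq = trans (encode-cong m eq) (encode-decode m y)
      from : block N m X i ≡ y → ∀ j → lookup X (combine i j) ≡ lookup (decode {m} y) j
      from refl j = trans (sym (lookup-blocks N m X i j))
        (cong (λ b → lookup b j) (trans (sym (decode-encode (lookup (blocks N m X) i))) (cong (decode {m}) (sym (block≡ N m X i)))))

    reflects-value : ∀ y → Reflects (∃[ i ] block N m X i ≡ y) (lookup W₂ y)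
    reflects-value y = subst (Reflects _) (sym value) (reflects-or N (reflects-block y))
      where
      value : lookup W₂ y ≡ or (List.tabulate λ i → lookup W₁ (combine y i))
      value = trans (lookup-map y _ (gates middle))
        (cong or (trans (cong (List.map (lookup (W₁ ++ []))) (lookup∘tabulate _ y))
          (trans (List.map-tabulate _ (lookup (W₁ ++ []))) (List.tabulate-cong (λ i → lookup-++ˡ W₁ [] (combine y i))))))

    reflects-circuit : Reflects (Surjective N m X) (eval circuit X)
    reflects-circuit = subst (Reflects (Surjective N m X)) (sym value) (reflects-and M reflects-value)
      where
      value : eval circuit X ≡ and (List.tabulate (lookup W₂))
      value = cong and (trans (List.map-tabulate _ (lookup (W₂ ++ []))) (List.tabulate-cong (lookup-++ˡ W₂ [])))

  -- Circuit output and decision procedure reflect the same proposition, hence are the same Boolean.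
  circuit-computes : Computes circuit (fSurj N m)
  circuit-computes X = det (reflects-circuit X) (proof (surjective? N m X))

  circuit-bottomFanIn : bottomFanIn circuit ≤ m
  circuit-bottomFanIn = maxFanIn-tabulate {negs = Vec.allFin n} (uncurry blockGate ∘ remQuot N)
    (λ g → ℕ.≤-reflexive (List.length-tabulate {n = m} _))

  module _ (1≤m : 1 ≤ m) (M≤N : M ≤ N) where

    N≤n : N ≤ n
    N≤n = ℕ.≤-trans (ℕ.≤-reflexive (sym (ℕ.*-identityʳ N))) (ℕ.*-monoʳ-≤ N 1≤m)

    M≤n : M ≤ n
    M≤n = ℕ.≤-trans M≤N N≤n

    m≤log : m ≤ ⌊log₂ n ⌋
    m≤log = ℕ.≤-trans (ℕ.≤-reflexive (sym (⌊log₂[2^n]⌋≡n m))) (⌊log₂⌋-mono-≤ M≤n)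

    1≤n : 1 ≤ n
    1≤n = ℕ.≤-trans (ℕ.m^n>0 2 m) M≤n

    -- n NOT gates and M N + M + 1 other gates; each of the four summands is at most n².
    circuit-size : size circuit ≤ 4 * n ^ 2
    circuit-size = ℕ.≤-trans (ℕ.+-mono-≤ (ℕ.≤-trans (ℕ.≤-reflexive (ℕ.+-identityʳ _)) (ℕ.+-mono-≤ (ℕ.≤-trans (ℕ.≤-reflexive (ℕ.+-identityʳ _)) (ℕ.+-mono-≤ le₁ le₂)) le₃)) le₄)
      (ℕ.≤-reflexive four)
      where
      sq : ∀ {a b} → a ≤ n → b ≤ n → a * b ≤ n ^ 2
      sq a≤n b≤n = ℕ.≤-trans (ℕ.*-mono-≤ a≤n b≤n) (ℕ.≤-reflexive (cong (n *_) (sym (ℕ.*-identityʳ n))))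
      le₁ : n ≤ n ^ 2
      le₁ = ℕ.≤-trans (ℕ.≤-reflexive (sym (ℕ.*-identityʳ n))) (sq ℕ.≤-refl 1≤n)
      le₂ : M * N ≤ n ^ 2
      le₂ = sq M≤n N≤n
      le₃ : M ≤ n ^ 2
      le₃ = ℕ.≤-trans M≤n le₁
      le₄ : 1 ≤ n ^ 2
      le₄ = ℕ.≤-trans 1≤n le₁
      four : n ^ 2 ℕ.+ n ^ 2 ℕ.+ n ^ 2 ℕ.+ n ^ 2 ≡ 4 * n ^ 2
      four = trans (ℕ.+-assoc (n ^ 2 ℕ.+ n ^ 2) _ _) (trans (ℕ.+-assoc (n ^ 2) _ _)
        (cong (λ s → n ^ 2 ℕ.+ (n ^ 2 ℕ.+ (n ^ 2 ℕ.+ s))) (sym (ℕ.+-identityʳ _))))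

-- The gap between the two distributions, for every m

abstract
  inverse : ∀ p → 0ℚ ℚ.< p → Σ[ r ∈ ℚ ] (0ℚ ℚ.≤ r × r ℚ.* p ≡ 1ℚ)
  inverse p 0<p = (ℚ.1/ p) {{p≢0}}
    , *-cancelˡ-≤ p 0<p (subst₂ ℚ._≤_ (sym (ℚ.*-zeroʳ p)) (sym (ℚ.*-inverseʳ p {{p≢0}})) 0≤1)
    , ℚ.*-inverseˡ p {{p≢0}}
    where
    p≢0 : ℚ.NonZero p
    p≢0 = ℚ.pos⇒nonZero p {{ℚ.positive 0<p}}

½^m≤½ : ∀ {m} → 1 ≤ m → ½ ^ℚ m ℚ.≤ ½
½^m≤½ {m} 1≤m = ^-antimono {½} {1} {m} 0≤½ (p≤p+q ½ 0≤½) 1≤m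

module Counterexample {m N : ℕ} (1≤m : 1 ≤ m) (N≤Mm : N ≤ 2 ^ m * m) where

  private
    n = N * m
    h = ½ ^ℚ m

    0<1-h : 0ℚ ℚ.< 1ℚ ℚ.- h
    0<1-h = ℚ.<-≤-trans (ℚ.positive⁻¹ ½) (ℚ.+-monoʳ-≤ 1ℚ (ℚ.neg-antimono-≤ (½^m≤½ 1≤m)))

    r = proj₁ (inverse (1ℚ ℚ.- h) 0<1-h)
    0≤r = proj₁ (proj₂ (inverse (1ℚ ℚ.- h) 0<1-h))
    r-inv = proj₂ (proj₂ (inverse (1ℚ ℚ.- h) 0<1-h))

  open Missing m r 0≤r r-inv using (avoid; missing; missing-fooled)

  𝒟 : Distribution n
  𝒟 = missing N

  fooled : ∀ k → fromℕ k ℚ.* h ℚ.≤ ½ → AlmostIndependent (fromℕ 2 ℚ.* (fromℕ k ℚ.* h)) k 𝒟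
  fooled = missing-fooled N

  Pr-𝒟 : Pr 𝒟 (fSurj N m) ≡ 0ℚ
  Pr-𝒟 = trans (∑-cong n (λ X → if-zero (fSurj N m X) (massless X))) (∑-0 n)
    where
    if-zero : ∀ b {q} → (b ≡ true → q ≡ 0ℚ) → (if b then q else 0ℚ) ≡ 0ℚ
    if-zero true  q≡0 = q≡0 refl
    if-zero false _   = refl
    avoid-self : ∀ {y b} → b ≡ y → avoid y b ≡ 0ℚ
    avoid-self {y} refl = trans (cong (λ d → h ℚ.* r ℚ.* (1ℚ ℚ.- d)) (δ-refl y)) (ℚ.*-zeroʳ (h ℚ.* r))
    massless : ∀ X → fSurj N m X ≡ true → mass 𝒟 X ≡ 0ℚ
    massless X surj = trans (cong (h ℚ.*_) (trans (∑-cong m (λ y →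
        let i , hit = fSurj-true N m X surj y in ∏-zero (blocks N m X) i (avoid-self hit))) (∑-0 m)))
      (ℚ.*-zeroʳ h)

  gap-from : ∀ {c} → c ℚ.≤ Pr (𝒰 n) (fSurj N m) → c ℚ.≤ Pr (𝒰 n) (fSurj N m) ℚ.- Pr 𝒟 (fSurj N m)
  gap-from le = ℚ.≤-trans le (ℚ.≤-reflexive (sym (trans (cong (λ s → Pr (𝒰 n) (fSurj N m) ℚ.- s) Pr-𝒟) (ℚ.+-identityʳ _))))

  Nh≤m : fromℕ N ℚ.* h ℚ.≤ fromℕ m
  Nh≤m = begin
    fromℕ N ℚ.* h                   ≤⟨ *-monoʳ (½^n≥0 m) (fromℕ-mono-≤ N≤Mm) ⟩
    fromℕ (2 ^ m * m) ℚ.* h         ≡⟨ cong (ℚ._* h) (fromℕ-* (2 ^ m) m) ⟩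
    fromℕ (2 ^ m) ℚ.* fromℕ m ℚ.* h ≡⟨ swap (fromℕ (2 ^ m)) (fromℕ m) h ⟩
    h ℚ.* fromℕ (2 ^ m) ℚ.* fromℕ m ≡⟨ trans (cong (ℚ._* fromℕ m) (½^*2^ m)) (ℚ.*-identityˡ (fromℕ m)) ⟩
    fromℕ m                         ∎
    where
    open ℚ.≤-Reasoning
    swap : ∀ a b c → a ℚ.* b ℚ.* c ≡ c ℚ.* a ℚ.* b
    swap = solve-∀ ℚ-ring

  -- ε n = 2 k m (N / M) and N / M ≤ m: one logarithm is the block length, the other the number of
  -- blocks per value.
  ε-bound : ∀ k {l} → m ≤ l → fromℕ 2 ℚ.* (fromℕ k ℚ.* h) ℚ.* fromℕ n ℚ.≤ fromℕ (2 * (k * l ^ 2))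
  ε-bound k {l} m≤l = begin
    fromℕ 2 ℚ.* (fromℕ k ℚ.* h) ℚ.* fromℕ n                ≡⟨ cong (fromℕ 2 ℚ.* (fromℕ k ℚ.* h) ℚ.*_) (fromℕ-* N m) ⟩
    fromℕ 2 ℚ.* (fromℕ k ℚ.* h) ℚ.* (fromℕ N ℚ.* fromℕ m)  ≡⟨ regroup (fromℕ 2) (fromℕ k) h (fromℕ N) (fromℕ m) ⟩
    fromℕ 2 ℚ.* fromℕ k ℚ.* (fromℕ m ℚ.* (fromℕ N ℚ.* h))  ≤⟨ *-monoˡ (0≤fromℕ 2 ⊗ 0≤fromℕ k) (*-monoˡ (0≤fromℕ m) Nh≤m) ⟩
    fromℕ 2 ℚ.* fromℕ k ℚ.* (fromℕ m ℚ.* fromℕ m)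
      ≡⟨ trans (cong₂ ℚ._*_ (sym (fromℕ-* 2 k)) (sym (fromℕ-* m m))) (sym (fromℕ-* (2 * k) (m * m))) ⟩
    fromℕ (2 * k * (m * m))
      ≤⟨ fromℕ-mono-≤ (ℕ.≤-trans (ℕ.*-monoʳ-≤ (2 * k) (ℕ.*-mono-≤ m≤l m≤l))
                                                                (ℕ.≤-reflexive (trans (ℕ.*-assoc 2 k (l * l)) (cong (λ s → 2 * (k * (l * s))) (sym (ℕ.*-identityʳ l)))))) ⟩
    fromℕ (2 * (k * l ^ 2))                                ∎
    where
    open ℚ.≤-Reasoning
    regroup : ∀ a k h n m → a ℚ.* (k ℚ.* h) ℚ.* (n ℚ.* m) ≡ a ℚ.* k ℚ.* (m ℚ.* (n ℚ.* h))
    regroup = solve-∀ ℚ-ring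

gap-large : ∀ j N (few : FewMissing (3 ℕ.+ j) N) (N≤Mm : N ≤ 2 ^ (3 ℕ.+ j) * (3 ℕ.+ j)) →
  1/18ℚ ℚ.≤ Pr (𝒰 (N * (3 ℕ.+ j))) (fSurj N (3 ℕ.+ j))
gap-large j N few N≤Mm = surjective-probability j N few N≤Mm (proj₁ r) (proj₁ (proj₂ r)) (proj₂ (proj₂ r))
  where
  r = inverse (1ℚ ℚ.- ½ ^ℚ (3 ℕ.+ j))
    (ℚ.<-≤-trans (ℚ.positive⁻¹ ½) (ℚ.+-monoʳ-≤ 1ℚ (ℚ.neg-antimono-≤ (½^m≤½ {3 ℕ.+ j} (s≤s z≤n)))))

2k≤M⇒ : ∀ k m → 2 * k ≤ 2 ^ m → fromℕ k ℚ.* ½ ^ℚ m ℚ.≤ ½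
2k≤M⇒ k m 2k≤M = *-cancelˡ-≤ (fromℕ 2) (0<fromℕ-suc 1) (begin
  fromℕ 2 ℚ.* (fromℕ k ℚ.* ½ ^ℚ m)    ≡⟨ ℚ.*-assoc (fromℕ 2) (fromℕ k) (½ ^ℚ m) ⟨
  fromℕ 2 ℚ.* fromℕ k ℚ.* ½ ^ℚ m      ≡⟨ cong (ℚ._* ½ ^ℚ m) (fromℕ-* 2 k) ⟨
  fromℕ (2 * k) ℚ.* ½ ^ℚ m            ≤⟨ *-monoʳ (½^n≥0 m) (fromℕ-mono-≤ 2k≤M) ⟩
  fromℕ (2 ^ m) ℚ.* ½ ^ℚ m            ≡⟨ trans (ℚ.*-comm _ (½ ^ℚ m)) (½^*2^ m) ⟩
  1ℚ                                  ∎)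
  where open ℚ.≤-Reasoning

Pr-𝒰-witness : ∀ n {f : Bits n → Bool} X → f X ≡ true → ½ ^ℚ n ℚ.≤ Pr (𝒰 n) f
Pr-𝒰-witness n {f} X eq = ℚ.≤-trans (ℚ.≤-reflexive (sym (cong (λ b → if b then ½ ^ℚ n else 0ℚ) eq)))
  (∑-term n nonneg X)
  where
  nonneg : ∀ X → 0ℚ ℚ.≤ (if f X then ½ ^ℚ n else 0ℚ)
  nonneg X with f X
  ... | true  = ½^n≥0 n
  ... | false = ℚ.≤-refl

surjection₁ : ∀ {N} → 2 ≤ N → ∃[ X ] fSurj N 1 X ≡ true
surjection₁ {suc (suc e)} _ = false ∷ true ∷ Vec.replicate (e * 1) false , refl
surjection₁ {0} ()
surjection₁ {1} (s≤s ())

surjection₂ : ∀ {N} → 4 ≤ N → ∃[ X ] fSurj N 2 X ≡ true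
surjection₂ {suc (suc (suc (suc e)))} _ =
  false ∷ false ∷ false ∷ true ∷ true ∷ false ∷ true ∷ true ∷ Vec.replicate (e * 2) false , refl
surjection₂ {0} ()
surjection₂ {1} (s≤s ())
surjection₂ {2} (s≤s (s≤s ()))
surjection₂ {3} (s≤s (s≤s (s≤s ())))

uniform-surjective-small : ∀ N m → N * m ≤ 16 → (∃[ X ] fSurj N m X ≡ true) →
  ½ ^ℚ 16 ℚ.≤ Pr (𝒰 (N * m)) (fSurj N m)
uniform-surjective-small N m n≤16 (X , surj) =
  ℚ.≤-trans (^-antimono {½} {N * m} {16} 0≤½ (p≤p+q ½ 0≤½) n≤16) (Pr-𝒰-witness (N * m) X surj)

-- The truncated sums are estimated for M ≥ 8 only. For m ≤ 2, n ≤ M m² ≤ 16, so one surjective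
-- input has mass at least 2⁻¹⁶; M ≤ N provides it.
uniform-surjective : ∀ m N → 1 ≤ m → FewMissing m N → N ≤ 2 ^ m * m → 2 ^ m ≤ N →
  ½ ^ℚ 16 ℚ.≤ Pr (𝒰 (N * m)) (fSurj N m)
uniform-surjective 1 N _ _ N≤2 2≤N =
  uniform-surjective-small N 1 (ℕ.≤-trans (ℕ.*-monoˡ-≤ 1 N≤2) (ℕ.m≤m+n 2 14)) (surjection₁ 2≤N)
uniform-surjective 2 N _ _ N≤8 4≤N =
  uniform-surjective-small N 2 (ℕ.*-monoˡ-≤ 2 N≤8) (surjection₂ 4≤N)
uniform-surjective (suc (suc (suc j))) N _ few N≤Mm _ =
  ℚ.≤-trans (from-yes (½ ^ℚ 16 ℚ.≤? 1/18ℚ)) (gap-large j N few N≤Mm)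

-- The lengths at which GLN fails

-- m = 2 P, so that k = 2ᴾ = √M and ε = 2 k / M = 2 / k.
module Family (p : ℕ) where

  m M N n k P : ℕ
  -- The offset gives m ≥ 4, so that the bound 1/18 applies, and k ≥ 4, so that 4 k ≤ k² = M.
  P = 2 ℕ.+ p
  m = P ℕ.+ P
  M = 2 ^ m
  N = M * m
  n = N * m
  k = 2 ^ P

  M≡k*k : M ≡ k * k
  M≡k*k = ℕ.^-distribˡ-+-* 2 P P

  1≤m : 1 ≤ m
  1≤m = s≤s z≤n

  open Counterexample {m} {N} 1≤m ℕ.≤-refl public using (𝒟; fooled; gap-from)
  open SurjCircuit N m public using (circuit; circuit-computes)

  M≤N : M ≤ N
  M≤N = ℕ.≤-trans (ℕ.≤-reflexive (sym (ℕ.*-identityʳ M))) (ℕ.*-monoʳ-≤ M 1≤m)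

  M≤n : M ≤ n
  M≤n = ℕ.≤-trans M≤N (ℕ.≤-trans (ℕ.≤-reflexive (sym (ℕ.*-identityʳ N))) (ℕ.*-monoʳ-≤ N 1≤m))

  circuit-size : size circuit ≤ 4 * n ^ 2
  circuit-size = SurjCircuit.circuit-size N m 1≤m M≤N

  gap : 1/18ℚ ℚ.≤ Pr (𝒰 n) (fSurj N m) ℚ.- Pr 𝒟 (fSurj N m)
  gap = gap-from (subst (λ m → 1/18ℚ ℚ.≤ Pr (𝒰 (2 ^ m * m * m)) (fSurj (2 ^ m * m) m)) m≡
    (gap-large (1 ℕ.+ (p ℕ.+ p)) _ (full⇒FewMissing (4 ℕ.+ (p ℕ.+ p))) ℕ.≤-refl))
    where
    m≡ : 4 ℕ.+ (p ℕ.+ p) ≡ m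
    m≡ = cong (2 ℕ.+_) (trans (cong suc (sym (ℕ.+-suc p p))) (sym (ℕ.+-suc p (suc p))))

  p<M : p ℕ.< M
  p<M = ℕ.≤-<-trans (ℕ.≤-trans (ℕ.m≤n+m p 2) (ℕ.m≤m+n P P)) (n<2^n m)

  -- Bounds the search for p at a given length, and shows that the family reaches arbitrarily large
  -- lengths.
  p<n : p ℕ.< n
  p<n = ℕ.<-≤-trans p<M M≤n

  4≤k : 4 ≤ k
  4≤k = ℕ.^-monoʳ-≤ 2 (ℕ.m≤m+n 2 p)

  4k≤M : 4 * k ≤ M
  4k≤M = ℕ.≤-trans (ℕ.*-monoˡ-≤ k 4≤k) (ℕ.≤-reflexive (sym M≡k*k))

  k≤n : k ≤ n
  k≤n = ℕ.≤-trans (ℕ.≤-trans (ℕ.m≤n*m k 4) 4k≤M) M≤n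

  -- n = M m² ≤ M³ and M = k².
  n≤k^6 : n ≤ k ^ 6
  n≤k^6 = ℕ.≤-trans (ℕ.*-mono-≤ (ℕ.*-monoʳ-≤ M (ℕ.<⇒≤ (n<2^n m))) (ℕ.<⇒≤ (n<2^n m)))
    (ℕ.≤-reflexive (begin
      M * M * M                 ≡⟨ ℕ.*-assoc M M M ⟩
      M * (M * M)               ≡⟨ cong (λ s → M * (M * s)) (ℕ.*-identityʳ M) ⟨
      M ^ 3                     ≡⟨ cong (_^ 3) (trans M≡k*k (cong (k *_) (sym (ℕ.*-identityʳ k)))) ⟩
      (k ^ 2) ^ 3               ≡⟨ ℕ.^-*-assoc k 2 3 ⟩
      k ^ 6                     ∎))
    where open ≡-Reasoning

  h ε : ℚ
  h = ½ ^ℚ m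
  ε = fromℕ 2 ℚ.* (fromℕ k ℚ.* h)

  0≤ε : 0ℚ ℚ.≤ ε
  0≤ε = 0≤fromℕ 2 ⊗ (0≤fromℕ k ⊗ ½^n≥0 m)

  2k≤M : 2 * k ≤ M
  2k≤M = ℕ.≤-trans (ℕ.*-monoˡ-≤ k (ℕ.m≤m+n 2 2)) 4k≤M

  independent : AlmostIndependent ε k 𝒟
  independent = fooled k (2k≤M⇒ k m 2k≤M)

  kkh≡1 : fromℕ k ℚ.* fromℕ k ℚ.* h ≡ 1ℚ
  kkh≡1 = trans (cong (ℚ._* h) (trans (sym (fromℕ-* k k)) (cong fromℕ (sym M≡k*k))))
    (trans (ℚ.*-comm (fromℕ M) h) (½^*2^ m))

  -- ε = 2 / k, so the left side is 4 / k. Its sixth power, with n ≤ k⁶, yields ε¹² n ≤ 1.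
  ε²k≤1 : ε ^ℚ 2 ℚ.* fromℕ k ℚ.≤ 1ℚ
  ε²k≤1 = begin
    ε ^ℚ 2 ℚ.* fromℕ k                               ≡⟨ regroup (fromℕ k) h ⟩
    fromℕ 4 ℚ.* fromℕ k ℚ.* h ℚ.* (fromℕ k ℚ.* fromℕ k ℚ.* h)
      ≡⟨ trans (cong (fromℕ 4 ℚ.* fromℕ k ℚ.* h ℚ.*_) kkh≡1) (ℚ.*-identityʳ _) ⟩
    fromℕ 4 ℚ.* fromℕ k ℚ.* h                        ≡⟨ cong (ℚ._* h) (fromℕ-* 4 k) ⟨
    fromℕ (4 * k) ℚ.* h                              ≤⟨ *-monoʳ (½^n≥0 m) (fromℕ-mono-≤ 4k≤M) ⟩
    fromℕ M ℚ.* h                                    ≡⟨ trans (ℚ.*-comm (fromℕ M) h) (½^*2^ m) ⟩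
    1ℚ                                               ∎
    where
    open ℚ.≤-Reasoning
    regroup : ∀ k h → fromℕ 2 ℚ.* (k ℚ.* h) ℚ.* (fromℕ 2 ℚ.* (k ℚ.* h) ℚ.* 1ℚ) ℚ.* k ≡ fromℕ 4 ℚ.* k ℚ.* h ℚ.* (k ℚ.* k ℚ.* h)
    regroup = solve-∀ ℚ-ring

  ε-small : ℚ.∣ ε ∣ ^ℚ 12 ℚ.* fromℕ n ℚ.≤ 1ℚ
  ε-small = begin
    ℚ.∣ ε ∣ ^ℚ 12 ℚ.* fromℕ n            ≡⟨ cong (λ s → s ^ℚ 12 ℚ.* fromℕ n) (ℚ.0≤p⇒∣p∣≡p 0≤ε) ⟩
    ε ^ℚ 12 ℚ.* fromℕ n                  ≤⟨ *-monoˡ (^-nonneg 12 0≤ε) (fromℕ-mono-≤ n≤k^6) ⟩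
    ε ^ℚ 12 ℚ.* fromℕ (k ^ 6)            ≡⟨ cong₂ ℚ._*_ (^-* ε 6 2) (fromℕ-^ k 6) ⟩
    (ε ^ℚ 2) ^ℚ 6 ℚ.* fromℕ k ^ℚ 6       ≡⟨ ^-distrib-* (ε ^ℚ 2) (fromℕ k) 6 ⟨
    (ε ^ℚ 2 ℚ.* fromℕ k) ^ℚ 6            ≤⟨ ^-≤1 6 (^-nonneg 2 0≤ε ⊗ 0≤fromℕ k) ε²k≤1 ⟩
    1ℚ                                   ∎
    where open ℚ.≤-Reasoning

-- Quadratic circuit size is 2 to a subpolynomial exponent

log-bounds : ∀ n → ∃[ l ] 2 ^ l ≤ suc n × suc n ℕ.< 2 ^ suc l
log-bounds zero    = 0 , s≤s z≤n , s≤s (s≤s z≤n)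
log-bounds (suc n) with log-bounds n
... | l , lower , upper with ℕ.m≤n⇒m<n∨m≡n upper
... | inj₁ lt = l , ℕ.≤-trans lower (ℕ.n≤1+n _) , lt
... | inj₂ eq = suc l , ℕ.≤-reflexive (sym eq) , ℕ.<-≤-trans (ℕ.≤-reflexive (cong suc eq)) (2^-< (suc l))
  where
  2^-< : ∀ l → suc (2 ^ l) ≤ 2 ^ suc l
  2^-< l = ℕ.+-mono-≤ (ℕ.m^n>0 2 l) (ℕ.≤-reflexive (sym (ℕ.+-identityʳ _)))

-- With l = ⌊log₂ n⌋ for n ≥ 1, n < 2^(l+1) gives 4 n² ≤ 2^(2l+4).
sizeExponent : ℕ → ℕ
sizeExponent zero    = 0
sizeExponent (suc n) = 2 * proj₁ (log-bounds n) ℕ.+ 4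

q²≤2^q : ∀ i → (4 ℕ.+ i) * (4 ℕ.+ i) ≤ 2 ^ (4 ℕ.+ i)
q²≤2^q zero    = ℕ.≤-refl
q²≤2^q (suc i) = begin
  suc q * suc q              ≡⟨ cong (suc q ℕ.+_) (ℕ.*-suc q q) ⟩
  suc q ℕ.+ (q ℕ.+ q * q)    ≡⟨ ℕ.+-assoc (suc q) q (q * q) ⟨
  suc (q ℕ.+ q) ℕ.+ q * q    ≤⟨ ℕ.+-monoˡ-≤ (q * q) 2q+1≤ ⟩
  q * q ℕ.+ q * q            ≤⟨ ℕ.+-mono-≤ (q²≤2^q i) (q²≤2^q i) ⟩
  2 ^ q ℕ.+ 2 ^ q            ≡⟨ cong (2 ^ q ℕ.+_) (ℕ.+-identityʳ (2 ^ q)) ⟨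
  2 ^ suc q                  ∎
  where
  open ℕ.≤-Reasoning
  q = 4 ℕ.+ i
  2q+1≤ : suc (q ℕ.+ q) ≤ q * q
  2q+1≤ = begin
    suc (q ℕ.+ q)              ≤⟨ ℕ.+-monoˡ-≤ (q ℕ.+ q) (ℕ.m≤m+n 1 (3 ℕ.+ i)) ⟩
    q ℕ.+ (q ℕ.+ q)            ≡⟨ cong (λ s → q ℕ.+ (q ℕ.+ s)) (ℕ.+-identityʳ q) ⟨
    3 * q                      ≤⟨ ℕ.*-monoˡ-≤ q (ℕ.m≤m+n 3 (1 ℕ.+ i)) ⟩
    q * q                      ∎

-- For q = ⌊l / a⌋ it suffices that 2l + 4 ≤ 2^q, as q a ≤ l. With b = 2a + 4 ≤ q, which is what the
-- threshold b a on l ensures, 2l + 4 ≤ b + 2 a q ≤ b q ≤ q² ≤ 2^q.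
polylog : ∀ a′ l → let a = suc a′ in (2 * a ℕ.+ 4) * a ≤ l → (2 * l ℕ.+ 4) ^ a ≤ 2 ^ l
polylog a′ l L≤l = begin
  (2 * l ℕ.+ 4) ^ a     ≤⟨ ℕ.^-monoˡ-≤ a base ⟩
  (2 ^ q) ^ a           ≡⟨ ℕ.^-*-assoc 2 q a ⟩
  2 ^ (q * a)           ≤⟨ ℕ.^-monoʳ-≤ 2 (ℕ.≤-trans (ℕ.m≤n+m (q * a) (l ℕ.% a)) (ℕ.≤-reflexive (sym (m≡m%n+[m/n]*n l a)))) ⟩
  2 ^ l                 ∎
  where
  open ℕ.≤-Reasoning
  a = suc a′
  q = l ℕ./ a
  b = 2 * a ℕ.+ 4
  b≤q : b ≤ q
  b≤q = ℕ.≤-trans (ℕ.≤-reflexive (sym (m*n/n≡m b a))) (/-monoˡ-≤ a L≤l)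
  l≤ : l ≤ a ℕ.+ q * a
  l≤ = ℕ.≤-trans (ℕ.≤-reflexive (m≡m%n+[m/n]*n l a)) (ℕ.+-monoˡ-≤ (q * a) (ℕ.<⇒≤ (m%n<n l a)))
  q²≤ : q * q ≤ 2 ^ q
  q²≤ with ℕ.m≤n⇒∃[o]m+o≡n (ℕ.≤-trans (ℕ.m≤n+m 4 (2 * a)) b≤q)
  ... | i , eq = subst (λ q → q * q ≤ 2 ^ q) eq (q²≤2^q i)
  base : 2 * l ℕ.+ 4 ≤ 2 ^ q
  base = begin
    2 * l ℕ.+ 4                          ≤⟨ ℕ.+-monoˡ-≤ 4 (ℕ.*-monoʳ-≤ 2 l≤) ⟩
    2 * (a ℕ.+ q * a) ℕ.+ 4              ≡⟨ cong (ℕ._+ 4) (ℕ.*-distribˡ-+ 2 a (q * a)) ⟩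
    2 * a ℕ.+ 2 * (q * a) ℕ.+ 4          ≡⟨ ℕ.+-assoc (2 * a) (2 * (q * a)) 4 ⟩
    2 * a ℕ.+ (2 * (q * a) ℕ.+ 4)        ≡⟨ cong (2 * a ℕ.+_) (ℕ.+-comm (2 * (q * a)) 4) ⟩
    2 * a ℕ.+ (4 ℕ.+ 2 * (q * a))        ≡⟨ ℕ.+-assoc (2 * a) 4 (2 * (q * a)) ⟨
    b ℕ.+ 2 * (q * a)                    ≤⟨ ℕ.+-monoˡ-≤ (2 * (q * a)) (ℕ.≤-trans b≤q (ℕ.m≤n*m q 4)) ⟩
    4 * q ℕ.+ 2 * (q * a)                ≡⟨ cong (4 * q ℕ.+_) (trans (cong (2 *_) (ℕ.*-comm q a)) (sym (ℕ.*-assoc 2 a q))) ⟩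
    4 * q ℕ.+ 2 * a * q                  ≡⟨ ℕ.+-comm (4 * q) _ ⟩
    2 * a * q ℕ.+ 4 * q                  ≡⟨ ℕ.*-distribʳ-+ q (2 * a) 4 ⟨
    b * q                                ≤⟨ ℕ.*-monoˡ-≤ q b≤q ⟩
    q * q                                ≤⟨ q²≤ ⟩
    2 ^ q                                ∎

sizeExponent-subpolynomial : Subpolynomial sizeExponent
sizeExponent-subpolynomial (suc a′) _ = 2 ^ L , large
  where
  a = suc a′
  L = (2 * a ℕ.+ 4) * a
  large : ∀ n → 2 ^ L ≤ n → sizeExponent n ^ a ≤ n
  large zero    le = z≤n
  large (suc n) le with log-bounds n
  ... | l , lower , upper = ℕ.≤-trans (polylog a′ l (ℕ.≮⇒≥ λ l<L →
      ℕ.<-irrefl refl (ℕ.<-≤-trans upper (ℕ.≤-trans (ℕ.^-monoʳ-≤ 2 l<L) le)))) lower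

4n²≤2^sizeExponent : ∀ n → 4 * n ^ 2 ≤ 2 ^ sizeExponent n
4n²≤2^sizeExponent zero    = z≤n
4n²≤2^sizeExponent (suc n) with log-bounds n
... | l , _ , upper = begin
  4 * suc n ^ 2              ≤⟨ ℕ.*-monoʳ-≤ 4 (ℕ.^-monoˡ-≤ 2 (ℕ.<⇒≤ upper)) ⟩
  4 * (2 ^ suc l) ^ 2        ≡⟨ cong (4 *_) (ℕ.^-*-assoc 2 (suc l) 2) ⟩
  2 ^ 2 * 2 ^ (suc l * 2)    ≡⟨ ℕ.^-distribˡ-+-* 2 2 (suc l * 2) ⟨
  2 ^ (4 ℕ.+ l * 2)          ≡⟨ cong (2 ^_) (trans (ℕ.+-comm 4 (l * 2)) (cong (ℕ._+ 4) (ℕ.*-comm l 2))) ⟩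
  2 ^ (2 * l ℕ.+ 4)          ∎
  where open ℕ.≤-Reasoning

-- One instance per length, and the contradiction with GLN

-- The exponents 12 and 6 and the depth 3 do not depend on n, so the asymptotic hypotheses of `GLN`
-- hold from length 0 on. The gap is claimed at the lengths of the family only.
record Instance (n : ℕ) : Set where
  field
    D           : Distribution n
    ε           : ℚ
    k           : ℕ
    f           : Bits n → Bool
    C           : Circuit n
    ε-small     : ℚ.∣ ε ∣ ^ℚ 12 ℚ.* fromℕ n ℚ.≤ 1ℚ
    k-large     : n ≤ k ^ 6
    k≤n         : k ≤ n
    independent : AlmostIndependent ε k D
    computes    : Computes C f
    depth≤3     : depth C ≤ 3
    size≤       : size C ≤ 2 ^ sizeExponent n
    gap         : (∃[ p ] n ≡ Family.n p) → 1/18ℚ ℚ.≤ Pr (𝒰 n) f ℚ.- Pr D f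

family : ∀ p → Instance (Family.n p)
family p = record
  { D           = 𝒟
  ; ε           = ε
  ; k           = k
  ; f           = fSurj N m
  ; C           = circuit
  ; ε-small     = ε-small
  ; k-large     = n≤k^6
  ; k≤n         = k≤n
  ; independent = independent
  ; computes    = circuit-computes
  ; depth≤3     = ℕ.≤-refl
  ; size≤       = ℕ.≤-trans circuit-size (4n²≤2^sizeExponent n)
  ; gap         = λ _ → gap
  }
  where open Family p

uniform : ∀ n → ¬ (∃[ p ] n ≡ Family.n p) → Instance n
uniform n outside = record
  { D           = 𝒰 n
  ; ε           = 0ℚ
  ; k           = n
  ; f           = λ _ → true
  -- The AND of no wires is the constant true.
  ; C           = record { top = AND ; depth = 1 ; layers = layer inputs (record { nots = 0 ; negated = [] ; gates = [] ∷ [] }) }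
  ; ε-small     = ℚ.≤-trans (ℚ.≤-reflexive (ℚ.*-zeroˡ (fromℕ n))) 0≤1
  ; k-large     = n≤n^6 n
  ; k≤n         = ℕ.≤-refl
  ; independent = λ C → ℚ.≤-reflexive (ℚ.*-identityˡ (Pr (𝒰 n) ⟦ C ⟧)) , ℚ.≤-reflexive (sym (ℚ.*-identityˡ (Pr (𝒰 n) ⟦ C ⟧)))
  ; computes    = λ _ → refl
  ; depth≤3     = s≤s z≤n
  ; size≤       = ℕ.m^n>0 2 (sizeExponent n)
  ; gap         = λ p → contradiction p outside
  }
  where
  n≤n^6 : ∀ n → n ≤ n ^ 6
  n≤n^6 zero    = z≤n
  n≤n^6 (suc n) = ℕ.m≤m*n (suc n) (suc n ^ 5) {{ℕ.m^n≢0 (suc n) 5}}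

instanceAt : ∀ n → Instance n
instanceAt n with any? {n} (λ i → n ℕ.≟ Family.n (toℕ i))
... | yes (i , eq) = subst Instance (sym eq) (family (toℕ i))
... | no  none     = uniform n λ (p , eq) →
  none (fromℕ< (p<n p eq) , trans eq (cong Family.n (sym (toℕ-fromℕ< (p<n p eq)))))
  where
  p<n : ∀ p → n ≡ Family.n p → p ℕ.< n
  p<n p eq = subst (p ℕ.<_) (sym eq) (Family.p<n p)

¬GLN : ¬ GLN
¬GLN gln = ℚ.<-irrefl refl (ℚ.≤-<-trans (gap I (n₀ , refl)) (ℚ.≤-<-trans reverse (small n (ℕ.<⇒≤ (Family.p<n n₀)))))
  where
  open Instance
  vanishing : Vanishing λ n → Pr (D (instanceAt n)) (f (instanceAt n)) ℚ.- Pr (𝒰 n) (f (instanceAt n))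
  vanishing = gln (λ n → D (instanceAt n)) (λ n → ε (instanceAt n)) (λ n → k (instanceAt n))
    (12 , s≤s z≤n , 0 , λ n _ → ε-small (instanceAt n))
    (6 , s≤s z≤n , 0 , λ n _ → k-large (instanceAt n))
    (λ n → k≤n (instanceAt n))
    (λ n → independent (instanceAt n))
    (λ n → f (instanceAt n)) (λ n → C (instanceAt n)) (λ n → computes (instanceAt n))
    (3 , λ n → depth≤3 (instanceAt n))
    (sizeExponent , sizeExponent-subpolynomial , λ n → size≤ (instanceAt n))
  n₀ = proj₁ (vanishing 1/18ℚ (ℚ.positive⁻¹ 1/18ℚ))
  small = proj₂ (vanishing 1/18ℚ (ℚ.positive⁻¹ 1/18ℚ))
  -- The threshold itself serves as the index, since `Family.n n₀` exceeds n₀.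
  n = Family.n n₀
  I = instanceAt n
  u = Pr (𝒰 n) (f I)
  d = Pr (D I) (f I)
  reverse : u ℚ.- d ℚ.≤ ℚ.∣ d ℚ.- u ∣
  reverse = ℚ.≤-trans (p≤∣p∣ (u ℚ.- d)) (ℚ.≤-reflexive (trans (cong ℚ.∣_∣ (negate u d)) (ℚ.∣-p∣≡∣p∣ (d ℚ.- u))))
    where
    negate : ∀ u d → u ℚ.- d ≡ ℚ.- (d ℚ.- u)
    negate = solve-∀ ℚ-ring
    p≤∣p∣ : ∀ p → p ℚ.≤ ℚ.∣ p ∣
    p≤∣p∣ p with ℚ.≤-total 0ℚ p
    ... | inj₁ 0≤p = ℚ.≤-reflexive (sym (ℚ.0≤p⇒∣p∣≡p 0≤p))
    ... | inj₂ p≤0 = ℚ.≤-trans p≤0 (ℚ.0≤∣p∣ p)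

theorem10 : ¬ GLN
    × (∃[ A ] ∃[ B ] ∀ (m N : ℕ) → 1 ≤ m → N ≡⌈ 2 ^ m * m ·ln2⌉ →
    let n = N * m in
    Σ[ C ∈ Circuit n ]
    Computes C (fSurj N m)
    × size C ≤ A * n ^ 2
    × depth C ≡ 3
    × bottomFanIn C ≤ B * ⌊log₂ n ⌋)
    × (∃[ K ] Σ[ c ∈ ℚ ] 0ℚ ℚ.< c × (∀ (m N : ℕ) → 1 ≤ m → N ≡⌈ 2 ^ m * m ·ln2⌉ →
    let n = N * m in
    Σ[ D ∈ Distribution n ]
    (∀ (k : ℕ) → 1 ≤ k → 2 * k ≤ 2 ^ m →
    Σ[ ε ∈ ℚ ]
    ε ℚ.* fromℕ n ℚ.≤ fromℕ (K * (k * ⌊log₂ n ⌋ ^ 2))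
    × AlmostIndependent ε k D)
    × c ℚ.≤ Pr (𝒰 n) (fSurj N m) ℚ.- Pr D (fSurj N m)))
theorem10 = ¬GLN
  , (4 , 1 , circuits)
  -- 2 is the factor in ε = 2 k / M. The constant 2⁻¹⁶ comes from m ≤ 2; from m = 3 on the gap is at
  -- least 1/18.
  , (2 , ½ ^ℚ 16 , ℚ.positive⁻¹ (½ ^ℚ 16) , distributions)
  where
  circuits : ∀ m N → 1 ≤ m → N ≡⌈ 2 ^ m * m ·ln2⌉ → Σ[ C ∈ Circuit (N * m) ]
    Computes C (fSurj N m) × size C ≤ 4 * (N * m) ^ 2 × depth C ≡ 3 × bottomFanIn C ≤ 1 * ⌊log₂ N * m ⌋
  circuits m N 1≤m ceil = circuit , circuit-computes , circuit-size 1≤m M≤N , refl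
    , ℕ.≤-trans circuit-bottomFanIn (ℕ.≤-trans (m≤log 1≤m M≤N) (ℕ.≤-reflexive (sym (ℕ.*-identityˡ _))))
    where
    open SurjCircuit N m
    open Ceiling 1≤m ceil

  distributions : ∀ m N → 1 ≤ m → N ≡⌈ 2 ^ m * m ·ln2⌉ → Σ[ D ∈ Distribution (N * m) ]
    (∀ k → 1 ≤ k → 2 * k ≤ 2 ^ m → Σ[ ε ∈ ℚ ]
      ε ℚ.* fromℕ (N * m) ℚ.≤ fromℕ (2 * (k * ⌊log₂ N * m ⌋ ^ 2)) × AlmostIndependent ε k D)
    × ½ ^ℚ 16 ℚ.≤ Pr (𝒰 (N * m)) (fSurj N m) ℚ.- Pr D (fSurj N m)
  distributions m N 1≤m ceil = 𝒟
    , (λ k _ 2k≤M → fromℕ 2 ℚ.* (fromℕ k ℚ.* ½ ^ℚ m)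
        , ε-bound k (SurjCircuit.m≤log N m 1≤m M≤N) , fooled k (2k≤M⇒ k m 2k≤M))
    , gap-from (uniform-surjective m N 1≤m few N≤Mm M≤N)
    where
    open Ceiling 1≤m ceil
    open Counterexample 1≤m N≤Mm
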